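{- Let $m\ge 1$, $s$ and $t$ be integers with $s>t\ge 0$ and $\gcd(s,t)=1$. Define $$S(m;s,t)=\{a(m(sn+t),k)\mid n\ge 1,\ k\ge 0\},\qquad R(m;s,t)=\{c(m(sn+t),k)\mid n\ge 1,\ k\ge 0\}.$$ Then $S(m;s,t)=R(m;s,t)=\mathbb{Z}$.
   Context: For a positive integer $N$, $\Phi_N(x)$ denotes the $N$-th cyclotomic polynomial, and $a(N,k)$ denotes the coefficient of $x^k$ in $\Phi_N(x)$ (so $a(N,k)=0$ for $k>\varphi(N)$). Also $c(N,k)$ denotes the coefficient of $x^k$ in the formal power series (Taylor series around $x=0$) of $1/\Phi_N(x)$, i.e. $1/\Phi_N(x)=\sum_{k\ge 0}c(N,k)x^k$. -}

module Defs where

open import Data.Nat as ℕ using (ℕ; zero; suc; _<_)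
open import Data.Nat.Divisibility using (_∣?_)
open import Data.Nat.Induction using (<-rec)
open import Data.Integer as ℤ using (ℤ; +_; -_; _+_; _*_)
open import Data.Fin using (Fin; toℕ)
open import Data.Fin.Properties using (toℕ<n)
open import Data.List using (List; []; _∷_; map; foldr; upTo; allFin)
open import Relation.Nullary using (yes; no)

-- Formal power series over ℤ, represented by their coefficient function.
Series : Set
Series = ℕ → ℤ

one : Series
one zero    = + 1
one (suc _) = + 0

xpow-1 : ℕ → Series
xpow-1 N k with k ℕ.≟ 0 | k ℕ.≟ N
... | yes _ | yes _ = + 0
... | yes _ | no  _ = - (+ 1)
... | no  _ | yes _ = + 1
... | no  _ | no  _ = + 0

_⊛_ : Series → Series → Series
(f ⊛ g) k = foldr _+_ (+ 0) (map (λ i → f i * g (k ℕ.∸ i)) (upTo (suc k)))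

prodS : List Series → Series
prodS = foldr _⊛_ one

-- Multiplicative inverse of a power series whose constant term u is a unit (u = ±1,
-- so u⁻¹ = u):  c_0 = u,  c_k = - u * Σ_{i=1}^{k} f_i c_{k-i}.
-- invRev f k = [c_k, c_{k-1}, ..., c_0].
private
  dot : Series → ℕ → List ℤ → ℤ
  dot f j []       = + 0
  dot f j (r ∷ rs) = f (suc j) * r + dot f (suc j) rs

invRev : Series → ℕ → List ℤ
invRev f zero    = f 0 ∷ []
invRev f (suc k) = let rs = invRev f k in (- (f 0 * dot f 0 rs)) ∷ rs

invS : Series → Series
invS f k with invRev f k
... | []    = + 0
... | c ∷ _ = c

-- Cyclotomic polynomials, defined by  x^N - 1 = ∏_{d ∣ N} Φ_d(x)  (N ≥ 1), i.e.
-- Φ_N = (x^N - 1) · (∏_{d ∣ N, d < N} Φ_d)^{-1}, computed in ℤ[[x]]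
-- (the product has constant term ±1, so it is invertible). Φ_0 is junk (never used).
Φ : ℕ → Series
Φ = <-rec (λ _ → Series) step
  where
  step : (N : ℕ) → ({d : ℕ} → d < N → Series) → Series
  step zero    _  = one
  step (suc n) IH = xpow-1 (suc n) ⊛ invS (prodS (map factor (allFin (suc n))))
    where
    factor : Fin (suc n) → Series
    factor i with toℕ i ∣? suc n
    ... | yes _ = IH {toℕ i} (toℕ<n i)
    ... | no  _ = one

a : ℕ → ℕ → ℤ
a N k = Φ N k

c : ℕ → ℕ → ℤ
c N k = invS (Φ N) k

{-# OPTIONS --safe #-}

-- For a prime p ∤ N one has Φ_{Np}(x) = Φ_N(x^p)/Φ_N(x), and for p ∣ N one has
-- Φ_{Np}(x) = Φ_N(x^p).  Hence Φ_N^{±1} = A(x^h) for some h, and a new prime p replaces A by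
-- A(x)/A(x^p) and flips the exponent, while an old prime only changes h.
--
-- Let H be such a series for Φ_M, with H(0) = 1 and H'(0) = f = ±1.  It is a polynomial with top
-- coefficient ±1, and 1/H is periodic.  For a prime q > 2 deg H the coefficient of
-- G = H(x)/H(x^q) at e + jq (e < q) is H_e (1/H)_j, so G is periodic, sparse, and takes both
-- values ±1.  If primes p_1, …, p_r lie in one residue class modulo the period of G and in
-- [x, 2x), adjoining them gives G(x) (1 − f Σ x^{p_i}) modulo x^{2x}; at a suitable exponent G
-- vanishes while all its shifts equal σ = ±1, so the coefficient is −r f σ, an arbitrary integer.
--
-- Such clusters exist by pigeonhole, since otherwise the primes beyond some bound would be so
-- sparse that they could not divide all the numbers 1 + B (j + 1), j < 2^J, for B a large
-- factorial; no equidistribution of primes is needed.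
--
-- The procedure is run twice, the second time with the opposite exponent, so that the same integer
-- z becomes a coefficient of both Φ_N and 1/Φ_N.  Finally N/m is multiplied by a number u whose
-- prime factors exceed all exponents used, chosen so that the product is ≡ t mod s; this changes
-- neither coefficient (up to exchanging Φ_N and 1/Φ_N, and up to x ↦ x^h).
module Submission where

-- `Φ` is defined inside the ring of power series, so even the finiteness of its degree has to be
-- proved. Roots of unity are avoided: two distinct cyclotomic series satisfy a Bézout identity with
-- polynomial coefficients and a nonzero integer on the right, and this lets x^N - 1 be divided by
-- them one after another. The prime q comes before the cluster because nothing is known about
-- vanishing coefficients of 1/H. Spreading 1/H over blocks of length q leaves gaps, and the gaps
-- provide an exponent where G is 0 although a prescribed shift of it meets σ. Integers of both
-- signs require -1 among the coefficients of 1/H. This is not automatic: an auxiliary prime creates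
-- it before the first pass, while in the second pass 1/H is the series found in the first pass,
-- whose linear coefficient is kept at -1 for this purpose.

-- Many primes of one residue class in a short interval

module PrimeClusters where

  open import Data.Nat using (ℕ; zero; suc; _+_; _*_; _∸_; _^_; _<_; _≤_; z≤n; s≤s; NonZero; >-nonZero; _!; _%_; _≟_; _≤?_; nonTrivial⇒n>1)
  open import Data.Nat.Properties
  open import Data.Nat.Divisibility
  open import Data.Nat.DivMod using (m%n<n)
  open import Data.Nat.Primality using (Prime; prime?; prime⇒nonTrivial; prime⇒irreducible; euclidsLemma)
  open import Data.Nat.Primality.Factorisation using (factorise; PrimeFactorisation)
  open import Data.Nat.Coprimality as Cop using (Coprime; coprime-divisor)
  open import Data.Nat.Tactic.RingSolver using (solve-∀)
  open import Data.Nat.ListAction using (product)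
  open import Data.List using (List; []; _∷_; map; filter; upTo; length; _++_; take)
  open import Data.List.Properties using (length-take)
  open import Data.List.Membership.Propositional using (_∈_; lose)
  open import Data.List.Membership.Propositional.Properties using (∈-filter⁺; ∈-filter⁻; ∈-map⁺; ∈-map⁻; ∈-upTo⁺; ∈-upTo⁻; ∈-++⁺ˡ; ∈-++⁺ʳ)
  open import Data.List.Relation.Unary.Any using (Any; here; there)
  open import Data.List.Relation.Unary.All as All using (All; []; _∷_)
  import Data.List.Relation.Unary.All.Properties as Allₚ
  open import Data.List.Relation.Unary.Unique.Propositional using (Unique)
  import Data.List.Relation.Unary.Unique.Propositional.Properties as Uniqueₚ
  open import Data.Product using (_×_; _,_; ∃-syntax; proj₁; proj₂)
  open import Data.Sum using (_⊎_; inj₁; inj₂)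
  open import Data.Empty using (⊥-elim)
  open import Relation.Nullary using (yes; no; Dec; contradiction; ¬_; ¬?)
  open import Relation.Unary using (Decidable)
  open import Relation.Binary.PropositionalEquality hiding (J)

  prime>1 : ∀ {p} → Prime p → 1 < p
  prime>1 {p} pr = nonTrivial⇒n>1 p {{prime⇒nonTrivial pr}}

  prime∤1 : ∀ {p} → Prime p → p ∤ 1
  prime∤1 pr p∣1 = <⇒≢ (prime>1 pr) (sym (∣1⇒≡1 p∣1))

  primeDivisor : ∀ n → 1 < n → ∃[ p ] Prime p × p ∣ n
  primeDivisor n 1<n = go (factors F) (isFactorisation F) (factorsPrime F)
    where
    open PrimeFactorisation
    F = factorise n {{>-nonZero (<⇒≤ 1<n)}}
    go : ∀ ps → n ≡ product ps → All Prime ps → ∃[ p ] Prime p × p ∣ n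
    go [] e _ = contradiction (sym e) (<⇒≢ 1<n)
    go (p ∷ ps) e (pr ∷ _) = p , pr , subst (p ∣_) (sym e) (m∣m*n (product ps))

  prime-∤⇒coprime : ∀ {p e} → Prime p → p ∤ e → Coprime e p
  prime-∤⇒coprime pr p∤e (i∣e , i∣p) with prime⇒irreducible pr i∣p
  ... | inj₁ i≡1  = i≡1
  ... | inj₂ refl = contradiction i∣e p∤e

  ≤⇒∣! : ∀ {p n} → 1 ≤ p → p ≤ n → p ∣ n !
  ≤⇒∣! {suc p} _ p≤n = ∣-trans (m∣m*n (p !)) (m≤n⇒m!∣n! p≤n)

  prime∣!⇒≤ : ∀ {p} → Prime p → ∀ n → p ∣ n ! → p ≤ n
  prime∣!⇒≤ pr zero    p∣1 = contradiction p∣1 (prime∤1 pr)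
  prime∣!⇒≤ pr (suc n) p∣  with euclidsLemma (suc n) (n !) pr p∣
  ... | inj₁ p∣sn = ∣⇒≤ p∣sn
  ... | inj₂ p∣n! = m≤n⇒m≤1+n (prime∣!⇒≤ pr n p∣n!)

  opaque
    prime-above : ∀ n → ∃[ p ] Prime p × n < p
    prime-above n with primeDivisor (suc (n !)) (s≤s (1≤n! n))
    ... | p , pr , p∣ = p , pr , ≰⇒> λ p≤n → prime∤1 pr
          (∣m+n∣m⇒∣n (subst (p ∣_) (+-comm 1 (n !)) p∣) (≤⇒∣! (<⇒≤ (prime>1 pr)) p≤n))

  module Counting {P : ℕ → Set} (P? : Decidable P) where

    ind : {Q : Set} → Dec Q → ℕ
    ind (yes _) = 1
    ind (no _)  = 0

    count : ℕ → ℕ → ℕ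
    count s zero    = 0
    count s (suc l) = ind (P? s) + count (suc s) l

    count-none : ∀ s l → (∀ j → s ≤ j → j < s + l → ¬ P j) → count s l ≡ 0
    count-none s zero    none = refl
    count-none s (suc l) none with P? s
    ... | yes p = contradiction p (none s ≤-refl (m<m+n s (s≤s z≤n)))
    ... | no _  = count-none (suc s) l (λ j s<j j< → none j (<⇒≤ s<j) (subst (j <_) (sym (+-suc s l)) j<))

    count-+ : ∀ s a b → count s (a + b) ≡ count s a + count (s + a) b
    count-+ s zero    b = cong (λ t → count t b) (sym (+-identityʳ s))
    count-+ s (suc a) b = trans (cong (ind (P? s) +_) (trans (count-+ (suc s) a b) (cong (λ t → count (suc s) a + count t b) (sym (+-suc s a)))))
      (sym (+-assoc (ind (P? s)) _ _))

    module _ (b : ℕ) (spaced : ∀ i j → i < j → P i → P j → i + b ≤ j) where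

      count-block : ∀ s l → l ≤ b → count s l ≤ 1
      count-block s zero    _   = z≤n
      count-block s (suc l) l<b with P? s
      ... | yes p = s≤s (≤-reflexive (count-none (suc s) l (λ j s<j j< q →
              <-irrefl refl (<-≤-trans j< (≤-trans (subst (_≤ s + b) (+-suc s l) (+-monoʳ-≤ s l<b)) (spaced s j s<j p q))))))
      ... | no _  = count-block (suc s) l (<⇒≤ l<b)

      count-blocks : ∀ s n → count s (n * b) ≤ n
      count-blocks s zero    = z≤n
      count-blocks s (suc n) = subst (_≤ suc n) (sym (count-+ s b (n * b))) (+-mono-≤ (count-block s b ≤-refl) (count-blocks (s + b) n))

    count-mono : ∀ s {l l′} → l ≤ l′ → count s l ≤ count s l′
    count-mono s {l} {l′} le = subst (λ t → count s l ≤ count s t) (m+[n∸m]≡n le)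
      (subst (count s l ≤_) (sym (count-+ s l (l′ ∸ l))) (m≤m+n _ _))

  open Counting using (ind; count; count-blocks; count-mono)

  Σ[_]_ : List ℕ → (ℕ → ℕ) → ℕ
  Σ[ []     ] f = 0
  Σ[ d ∷ ds ] f = f d + Σ[ ds ] f

  Σ-+ : ∀ ds f g → Σ[ ds ] (λ d → f d + g d) ≡ Σ[ ds ] f + Σ[ ds ] g
  Σ-+ []       f g = refl
  Σ-+ (d ∷ ds) f g = trans (cong (f d + g d +_) (Σ-+ ds f g)) (lem (f d) (g d) (Σ[ ds ] f) (Σ[ ds ] g))
    where
    lem : ∀ a b c d → (a + b) + (c + d) ≡ (a + c) + (b + d)
    lem = solve-∀

  Σ-++ : ∀ ds es f → Σ[ ds ++ es ] f ≡ Σ[ ds ] f + Σ[ es ] f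
  Σ-++ []       es f = refl
  Σ-++ (d ∷ ds) es f = trans (cong (f d +_) (Σ-++ ds es f)) (sym (+-assoc (f d) _ _))

  Σ-≤ : ∀ ds f c → (∀ d → d ∈ ds → f d ≤ c) → Σ[ ds ] f ≤ length ds * c
  Σ-≤ []       f c le = z≤n
  Σ-≤ (d ∷ ds) f c le = +-mono-≤ (le d (here refl)) (Σ-≤ ds f c (λ e e∈ → le e (there e∈)))

  module _ {Q : ℕ → ℕ → Set} (Q? : ∀ d j → Dec (Q d j)) where

    Σ-ind : ∀ ds j → Any (λ d → Q d j) ds → 1 ≤ Σ[ ds ] (λ d → ind (Q? d) (Q? d j))
    Σ-ind (d ∷ ds) j (here q) with Q? d j
    ... | yes _ = s≤s z≤n
    ... | no ¬q = contradiction q ¬q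
    Σ-ind (d ∷ ds) j (there a) = ≤-trans (Σ-ind ds j a) (m≤n+m _ _)

    -- Double counting: every j of the range is counted by some d. The covering hypothesis starts at
    -- 0 and not at s, so it passes unchanged to the recursive call.
    covered : ∀ ds s l → (∀ j → j < s + l → Any (λ d → Q d j) ds) → l ≤ Σ[ ds ] (λ d → count (Q? d) s l)
    covered ds s zero    cov = z≤n
    covered ds s (suc l) cov = subst (suc l ≤_) (sym (Σ-+ ds (λ d → ind (Q? d) (Q? d s)) (λ d → count (Q? d) (suc s) l)))
      (+-mono-≤ (Σ-ind ds s (cov s (m<m+n s (s≤s z≤n)))) (covered ds (suc s) l (λ j j< → cov j (subst (j <_) (sym (+-suc s l)) j<))))

  -- Two solutions j differ by a multiple of d ≥ 2^i, because d divides B times their difference and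
  -- is coprime to B. For J < i the truncated exponent is 0, and a single block of length 2^i
  -- contains the whole range.
  progression-count : ∀ A B d i J → Coprime d B → 2 ^ i ≤ d → count (λ j → d ∣? (A + B * j)) 0 (2 ^ J) ≤ 2 ^ (J ∸ i)
  progression-count A B d i J cop le = ≤-trans
    (count-mono (λ j → d ∣? (A + B * j)) 0 (≤-trans (^-monoʳ-≤ 2 (subst (J ≤_) (+-comm i (J ∸ i)) (m≤n+m∸n J i))) (≤-reflexive (^-distribˡ-+-* 2 (J ∸ i) i))))
    (count-blocks (λ j → d ∣? (A + B * j)) (2 ^ i) spaced 0 (2 ^ (J ∸ i)))
    where
    spaced : ∀ i′ j → i′ < j → d ∣ A + B * i′ → d ∣ A + B * j → i′ + 2 ^ i ≤ j
    spaced i′ j i<j p q = subst (i′ + 2 ^ i ≤_) (m+[n∸m]≡n (<⇒≤ i<j)) (+-monoʳ-≤ i′ (≤-trans le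
      (∣⇒≤ {{>-nonZero (m<n⇒0<n∸m i<j)}} (coprime-divisor cop (∣m+n∣m⇒∣n (subst (d ∣_) eq q) p)))))
      where
      lem : ∀ A B i k → A + B * (i + k) ≡ (A + B * i) + B * k
      lem = solve-∀
      eq : A + B * j ≡ (A + B * i′) + B * (j ∸ i′)
      eq = trans (cong (λ t → A + B * t) (sym (m+[n∸m]≡n (<⇒≤ i<j)))) (lem A B i′ (j ∸ i′))

  n<2^n : ∀ n → n < 2 ^ n
  n<2^n zero    = s≤s z≤n
  n<2^n (suc n) = begin-strict
    suc n          ≡⟨ +-comm 1 n ⟩
    n + 1          <⟨ +-mono-<-≤ (n<2^n n) (≤-trans (s≤s z≤n) (n<2^n n)) ⟩
    2 ^ n + 2 ^ n  ≡⟨ cong (2 ^ n +_) (sym (+-identityʳ (2 ^ n))) ⟩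
    2 ^ suc n      ∎
    where open ≤-Reasoning

  linear<2^ : ∀ a b → ∃[ J ] b ≤ J × a * J + b < 2 ^ J
  -- With J = 2t the power 2^J is the square of 2^t > t, so it beats a quadratic in t; t is at least
  -- 2a and at least b.
  linear<2^ a b = t + t , ≤-trans (m≤n+m b (a + a)) (m≤m+n t t) , (begin-strict
    a * (t + t) + b       ≡⟨ cong (_+ b) (lem a t) ⟩
    (a + a) * t + b       ≤⟨ +-mono-≤ (*-monoˡ-≤ t (m≤m+n (a + a) b)) (m≤n+m b (a + a)) ⟩
    t * t + t             <⟨ s≤s (≤-trans (m≤m+n (t * t + t) t) (≤-reflexive (lem2 t))) ⟩
    suc t * suc t         ≤⟨ *-mono-≤ (n<2^n t) (n<2^n t) ⟩
    2 ^ t * 2 ^ t         ≡⟨ sym (^-distribˡ-+-* 2 t t) ⟩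
    2 ^ (t + t)           ∎)
    where
    open ≤-Reasoning
    t = (a + a) + b
    lem : ∀ a t → a * (t + t) ≡ (a + a) * t
    lem = solve-∀
    lem2 : ∀ t → t * t + t + t ≡ t + t * suc t
    lem2 = solve-∀

  length-filter-¬ : ∀ {P : ℕ → Set} (P? : Decidable P) xs → length xs ≡ length (filter P? xs) + length (filter (λ x → ¬? (P? x)) xs)
  length-filter-¬ P? [] = refl
  length-filter-¬ P? (x ∷ xs) with P? x
  ... | yes _ = cong suc (length-filter-¬ P? xs)
  ... | no _  = trans (cong suc (length-filter-¬ P? xs)) (sym (+-suc _ _))

  -- Induction on the number of classes: if the last class has fewer than R elements, discarding it
  -- keeps the hypothesis for the remaining ones.
  pigeonhole : ∀ {P : ℕ → Set} (f : ℕ → ℕ) n R V → All (λ v → f v < n) V → All P V → Unique V → n * R < length V →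
    ∃[ α ] ∃[ ps ] R ≤ length ps × All (λ p → f p ≡ α) ps × All P ps × Unique ps
  pigeonhole f zero    R (v ∷ V) (() ∷ _) _ _ _
  pigeonhole f (suc n) R V bound PV uV len with R ≤? length (filter (λ v → f v ≟ n) V)
  ... | yes le = n , filter (λ v → f v ≟ n) V , le , Allₚ.all-filter (λ v → f v ≟ n) V
               , Allₚ.filter⁺ (λ v → f v ≟ n) PV , Uniqueₚ.filter⁺ (λ v → f v ≟ n) uV
  ... | no nle = pigeonhole f n R V′
        (All.map (λ { (≢n , <sn) → ≤∧≢⇒< (≤-pred <sn) ≢n }) (All.zip (Allₚ.all-filter _ V , Allₚ.filter⁺ _ bound)))
        (Allₚ.filter⁺ _ PV) (Uniqueₚ.filter⁺ _ uV)
        (+-cancelˡ-< R _ _ (<-≤-trans len (≤-trans (≤-reflexive (length-filter-¬ (λ v → f v ≟ n) V)) (+-monoˡ-≤ (length V′) (<⇒≤ (≰⇒> nle))))))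
    where V′ = filter (λ v → ¬? (f v ≟ n)) V

  module _ (C : ℕ) (1≤C : 1 ≤ C) where

    instance
      C≢0 : NonZero C
      C≢0 = >-nonZero 1≤C

    -- The offset C creates slack: with x = C + 2^i, every p below C + 2^(i+1) satisfies p + C < 2x,
    -- as `Cluster` demands.
    window : ℕ → List ℕ
    window i = filter prime? (map (λ t → (C + 2 ^ i) + t) (upTo (2 ^ i)))

    InWindow : ℕ → ℕ → Set
    InWindow i p = Prime p × C + 2 ^ i ≤ p × p < C + 2 ^ suc i

    double : ∀ i → (C + 2 ^ i) + 2 ^ i ≡ C + 2 ^ suc i
    double i = trans (+-assoc C (2 ^ i) (2 ^ i)) (cong (λ t → C + (2 ^ i + t)) (sym (+-identityʳ (2 ^ i))))

    window⁻ : ∀ i {p} → p ∈ window i → InWindow i p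
    window⁻ i p∈ with ∈-filter⁻ prime? {xs = map (λ t → (C + 2 ^ i) + t) (upTo (2 ^ i))} p∈
    ... | p∈m , pr with ∈-map⁻ (λ t → (C + 2 ^ i) + t) p∈m
    ...   | t , t∈ , refl = pr , m≤m+n _ t , subst (C + 2 ^ i + t <_) (double i) (+-monoʳ-< (C + 2 ^ i) (∈-upTo⁻ t∈))

    window⁺ : ∀ i {p} → InWindow i p → p ∈ window i
    window⁺ i {p} (pr , le , lt) = ∈-filter⁺ prime? (subst (_∈ map (λ t → (C + 2 ^ i) + t) (upTo (2 ^ i))) (m+[n∸m]≡n le)
      (∈-map⁺ (λ t → (C + 2 ^ i) + t) (∈-upTo⁺ (+-cancelˡ-< (C + 2 ^ i) _ _
        (subst₂ _<_ (sym (m+[n∸m]≡n le)) (sym (double i)) lt))))) pr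

    window-Unique : ∀ i → Unique (window i)
    window-Unique i = Uniqueₚ.filter⁺ prime? (Uniqueₚ.map⁺ (+-cancelˡ-≡ (C + 2 ^ i) _ _) (Uniqueₚ.upTo⁺ (2 ^ i)))

    windows : ℕ → ℕ → List ℕ
    windows i zero    = []
    windows i (suc n) = window i ++ windows (suc i) n

    windows⁺ : ∀ i n {p} → Prime p → C + 2 ^ i ≤ p → p < C + 2 ^ (i + n) → p ∈ windows i n
    windows⁺ i zero {p} pr le lt = contradiction (<-≤-trans lt (≤-trans (≤-reflexive (cong (λ t → C + 2 ^ t) (+-identityʳ i))) le)) (<-irrefl refl)
    windows⁺ i (suc n) {p} pr le lt with (C + 2 ^ suc i) ≤? p
    ... | yes le′ = ∈-++⁺ʳ (window i) (windows⁺ (suc i) n pr le′ (subst (λ t → p < C + 2 ^ t) (+-suc i n) lt))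
    ... | no nle  = ∈-++⁺ˡ (window⁺ i (pr , le , ≰⇒> nle))

    rich-window : ∀ R′ i n → (∃[ i′ ] i ≤ i′ × R′ < length (window i′)) ⊎ (∀ i′ → i ≤ i′ → i′ < i + n → length (window i′) ≤ R′)
    rich-window R′ i zero = inj₂ λ i′ le lt → contradiction (<-≤-trans lt (≤-trans (≤-reflexive (+-identityʳ i)) le)) (<-irrefl refl)
    rich-window R′ i (suc n) with length (window i) ≤? R′ | rich-window R′ (suc i) n
    ... | no nle | _ = inj₁ (i , ≤-refl , ≰⇒> nle)
    ... | yes _ | inj₁ (i′ , le , r) = inj₁ (i′ , <⇒≤ le , r)
    ... | yes w | inj₂ all = inj₂ λ i′ le lt → case i′ (m≤n⇒m<n∨m≡n le) lt
      where
      case : ∀ i′ → i < i′ ⊎ i ≡ i′ → i′ < i + suc n → length (window i′) ≤ R′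
      case i′ (inj₁ i<i′) lt = all i′ i<i′ (subst (i′ <_) (+-suc i n) lt)
      case i′ (inj₂ refl) lt = w

    module _ (R′ A B J i₀ : ℕ) (coprime : ∀ {p} → Prime p → C + 2 ^ i₀ ≤ p → Coprime p B) where

      -- A prime of window i is at least 2^i, so it divides at most 2^(J ∸ i) of the values. The
      -- geometric series over the windows yields 2 * 2^(J ∸ i); the summand n pays for the windows
      -- with i ≥ J, where the truncated exponent no longer halves the bound.
      Σ-windows : ∀ i n → i₀ ≤ i → (∀ i′ → i ≤ i′ → i′ < i + n → length (window i′) ≤ R′) →
        Σ[ windows i n ] (λ d → count (λ j → d ∣? (A + B * j)) 0 (2 ^ J)) ≤ R′ * (2 * 2 ^ (J ∸ i) + n)
      Σ-windows i zero    i₀≤i small = z≤n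
      Σ-windows i (suc n) i₀≤i small = begin
        Σ[ window i ++ windows (suc i) n ] f                    ≡⟨ Σ-++ (window i) (windows (suc i) n) f ⟩
        Σ[ window i ] f + Σ[ windows (suc i) n ] f              ≤⟨ +-mono-≤ first rest ⟩
        R′ * 2 ^ (J ∸ i) + R′ * (2 * 2 ^ (J ∸ suc i) + n)       ≡⟨ sym (*-distribˡ-+ R′ _ _) ⟩
        R′ * (2 ^ (J ∸ i) + (2 * 2 ^ (J ∸ suc i) + n))          ≤⟨ *-monoʳ-≤ R′ (+-monoʳ-≤ (2 ^ (J ∸ i)) (+-monoˡ-≤ n (halve J i))) ⟩
        R′ * (2 ^ (J ∸ i) + ((2 ^ (J ∸ i) + 1) + n))            ≡⟨ cong (R′ *_) (lem (2 ^ (J ∸ i)) n) ⟩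
        R′ * (2 * 2 ^ (J ∸ i) + suc n)                          ∎
        where
        open ≤-Reasoning
        f = λ d → count (λ j → d ∣? (A + B * j)) 0 (2 ^ J)
        lem : ∀ a n → a + ((a + 1) + n) ≡ 2 * a + suc n
        lem = solve-∀
        halve : ∀ J i → 2 * 2 ^ (J ∸ suc i) ≤ 2 ^ (J ∸ i) + 1
        halve zero    zero    = ≤-refl
        halve zero    (suc i) = ≤-refl
        halve (suc J) zero    = m≤m+n _ 1
        halve (suc J) (suc i) = halve J i
        first : Σ[ window i ] f ≤ R′ * 2 ^ (J ∸ i)
        first = ≤-trans (Σ-≤ (window i) f (2 ^ (J ∸ i)) (λ d d∈ → let (pr , le , _) = window⁻ i d∈ in
            progression-count A B d i J (coprime pr (≤-trans (+-monoʳ-≤ C (^-monoʳ-≤ 2 i₀≤i)) le)) (≤-trans (m≤n+m _ C) le)))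
          (*-monoˡ-≤ (2 ^ (J ∸ i)) (small i ≤-refl (m<m+n i (s≤s z≤n))))
        rest : Σ[ windows (suc i) n ] f ≤ R′ * (2 * 2 ^ (J ∸ suc i) + n)
        rest = Σ-windows (suc i) n (m≤n⇒m≤1+n i₀≤i) (λ i′ le lt → small i′ (<⇒≤ le) (subst (i′ <_) (sym (+-suc i n)) lt))

    -- Otherwise the primes in the windows could not cover the values 1 + B (j + 1), j < 2^J,
    -- where B is the factorial of everything below the windows.
    module _ (R′ L : ℕ) where
      private
        open ≤-Reasoning
        -- From 4 R′ ≤ 2^i₀ the geometric part of `total`, doubled, is at most 2^J (`part₁`); the
        -- summand L pushes the window beyond L.
        i₀ = 4 * R′ + L
        y = C + 2 ^ i₀ ∸ 1
        B = y !
        -- All values are at most (B + 1) 2^J < 2^n for n = suc B + J, so n windows reach every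
        -- prime factor. J is large enough that the remaining part 2 R′ n of the doubled bound stays
        -- below 2^J (`part₂`).
        J = proj₁ (linear<2^ (2 * R′) (2 * R′ * suc B + i₀))
        i₀≤J : i₀ ≤ J
        i₀≤J = ≤-trans (m≤n+m i₀ (2 * R′ * suc B)) (proj₁ (proj₂ (linear<2^ (2 * R′) (2 * R′ * suc B + i₀))))
        n = suc B + J
        sy≡ : suc y ≡ C + 2 ^ i₀
        sy≡ = m+[n∸m]≡n (≤-trans 1≤C (m≤m+n C _))
        lem : ∀ R a b J → 2 * (R * (2 * a + (b + J))) ≡ (4 * R) * a + (2 * R * J + 2 * R * b)
        lem = solve-∀
        part₁ : (4 * R′) * 2 ^ (J ∸ i₀) ≤ 2 ^ J
        part₁ = ≤-trans (*-monoˡ-≤ (2 ^ (J ∸ i₀)) (≤-trans (m≤m+n (4 * R′) L) (<⇒≤ (n<2^n i₀))))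
          (≤-reflexive (trans (sym (^-distribˡ-+-* 2 i₀ (J ∸ i₀))) (cong (2 ^_) (m+[n∸m]≡n i₀≤J))))
        part₂ : 2 * R′ * J + 2 * R′ * suc B < 2 ^ J
        part₂ = ≤-<-trans (+-monoʳ-≤ (2 * R′ * J) (m≤m+n (2 * R′ * suc B) i₀)) (proj₂ (proj₂ (linear<2^ (2 * R′) (2 * R′ * suc B + i₀))))
        coprime : ∀ {p} → Prime p → C + 2 ^ i₀ ≤ p → Coprime p B
        coprime {p} pr le = Cop.sym (prime-∤⇒coprime pr (λ p∣B → <⇒≱ (subst (_≤ p) (sym sy≡) le) (prime∣!⇒≤ pr y p∣B)))
        cover : ∀ j → j < 0 + 2 ^ J → Any (λ d → d ∣ suc B + B * j) (windows i₀ n)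
        cover j j<2^J with primeDivisor (suc B + B * j) (≤-trans (s≤s (1≤n! y)) (m≤m+n (suc B) _))
        ... | p , pr , p∣ = lose (windows⁺ i₀ n pr large small′) p∣
          where
          eq : suc B + B * j ≡ B * suc j + 1
          eq = lem′ B j
            where
            lem′ : ∀ B j → suc B + B * j ≡ B * suc j + 1
            lem′ = solve-∀
          large : C + 2 ^ i₀ ≤ p
          large = subst (_≤ p) sy≡ (≰⇒> λ p≤y → prime∤1 pr (∣m+n∣m⇒∣n (subst (p ∣_) eq p∣)
            (∣m⇒∣m*n (suc j) (≤⇒∣! (<⇒≤ (prime>1 pr)) p≤y))))
          small′ : p < C + 2 ^ (i₀ + n)
          small′ = begin-strict
            p                        ≤⟨ ∣⇒≤ p∣ ⟩
            suc B + B * j            ≤⟨ +-monoʳ-≤ (suc B) (*-monoˡ-≤ j (n≤1+n B)) ⟩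
            suc B + suc B * j        ≡⟨ sym (*-suc (suc B) j) ⟩
            suc B * suc j            ≤⟨ *-monoʳ-≤ (suc B) j<2^J ⟩
            suc B * 2 ^ J            <⟨ *-monoˡ-< (2 ^ J) {{m^n≢0 2 J}} (n<2^n (suc B)) ⟩
            2 ^ suc B * 2 ^ J        ≡⟨ sym (^-distribˡ-+-* 2 (suc B) J) ⟩
            2 ^ n                    ≤⟨ ^-monoʳ-≤ 2 (m≤n+m n i₀) ⟩
            2 ^ (i₀ + n)             ≤⟨ m≤n+m _ C ⟩
            C + 2 ^ (i₀ + n)         ∎
        total : (∀ i′ → i₀ ≤ i′ → i′ < i₀ + n → length (window i′) ≤ R′) → 2 ^ J ≤ R′ * (2 * 2 ^ (J ∸ i₀) + n)
        total small = ≤-trans (covered (λ d j → d ∣? (suc B + B * j)) (windows i₀ n) 0 (2 ^ J) cover)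
          (Σ-windows R′ (suc B) B J i₀ coprime i₀ n ≤-refl small)

      ∃-rich-window : ∃[ i ] L ≤ i × R′ < length (window i)
      ∃-rich-window with rich-window R′ i₀ n
      ... | inj₁ (i , le , r) = i , ≤-trans (m≤n+m L (4 * R′)) le , r
      ... | inj₂ small = ⊥-elim (<-irrefl refl (begin-strict
          2 * 2 ^ J                                              ≤⟨ *-monoʳ-≤ 2 (total small) ⟩
          2 * (R′ * (2 * 2 ^ (J ∸ i₀) + n))                      ≡⟨ lem R′ (2 ^ (J ∸ i₀)) (suc B) J ⟩
          (4 * R′) * 2 ^ (J ∸ i₀) + (2 * R′ * J + 2 * R′ * suc B)  <⟨ +-mono-≤-< part₁ part₂ ⟩
          2 ^ J + 2 ^ J                                          ≡⟨ cong (2 ^ J +_) (sym (+-identityʳ (2 ^ J))) ⟩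
          2 * 2 ^ J                                              ∎))

    -- `x ≤ p` pushes products of two contributions to exponents from 2x on. `p + C < x + x` leaves
    -- a full period of length C between the primes and 2x, so an exponent of any class modulo C is
    -- available there.
    record Cluster (R L : ℕ) : Set where
      field
        {x α}    : ℕ
        {primes} : List ℕ
        size     : length primes ≡ R
        distinct : Unique primes
        member   : All (λ p → Prime p × L < p × x ≤ p × p + C < x + x × p % C ≡ α) primes

    cluster : ∀ R L → Cluster R L
    cluster R L with ∃-rich-window (C * R) L
    ... | i , L≤i , rich with pigeonhole {P = InWindow i} (λ p → p % C) C R (window i)
            (All.tabulate (λ {p} _ → m%n<n p C)) (All.tabulate (window⁻ i)) (window-Unique i) rich
    ...   | α , ps , le , mod , inw , uniq = record
      { x = C + 2 ^ i ; α = α ; primes = take R ps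
      ; size = trans (length-take R ps) (m≤n⇒m⊓n≡m le)
      ; distinct = Uniqueₚ.take⁺ R uniq
      ; member = Allₚ.take⁺ R (All.map conv (All.zip (mod , inw))) }
      where
      lem : ∀ C a → (C + 2 * a) + C ≡ (C + a) + (C + a)
      lem = solve-∀
      conv : ∀ {p} → p % C ≡ α × InWindow i p → _
      conv {p} (m , pr , lo , hi) = pr , <-≤-trans (≤-<-trans L≤i (n<2^n i)) (≤-trans (m≤n+m _ C) lo) , lo
        , subst (p + C <_) (lem C (2 ^ i)) (+-monoˡ-< C hi) , m

-- The ring of formal power series over the integers

module SeriesRing where

  open import Defs
  open import Data.Nat as ℕ using (ℕ; zero; suc; _<_; _≤_; z≤n; s≤s)
  import Data.Nat.Properties as ℕₚ
  open import Data.Nat.Divisibility using (_∣_; _∤_; _∣?_; divides; divides-refl; ∣m+n∣m⇒∣n; ∣-refl; ∣⇒≤)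
  open import Data.Nat.Induction using (<-rec)
  open import Data.Integer as ℤ using (ℤ; +_; -_; _+_; _*_)
  import Data.Integer.Properties as ℤₚ
  open import Data.Integer.Tactic.RingSolver using (solve-∀)
  open import Data.List using (List; _∷_; foldr)
  open import Data.List.Properties using (map-applyUpTo)
  open import Data.Maybe using (Maybe)
  open import Data.Product using (_,_)
  open import Data.Sum using (inj₁; inj₂)
  open import Function using (id)
  open import Level using (0ℓ)
  open import Algebra.Bundles using (CommutativeRing)
  import Algebra.Solver.Ring
  open import Algebra.Solver.Ring.AlmostCommutativeRing using (AlmostCommutativeRing; fromCommutativeRing; _-Raw-AlmostCommutative⟶_)
  open import Relation.Nullary using (yes; no; Dec; contradiction)
  open import Relation.Nullary.Decidable using (dec⇒maybe; map′)
  open import Relation.Binary.PropositionalEquality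
  import Relation.Binary.Reasoning.Setoid as SetoidReasoning

  infix 4 _≈_
  record _≈_ (f g : Series) : Set where
    constructor pointwise
    field at : ∀ k → f k ≡ g k
  open _≈_ public

  tail : Series → Series
  tail f k = f (suc k)

  infixl 6 _⊕_
  _⊕_ : Series → Series → Series
  (f ⊕ g) k = f k + g k

  ⊖_ : Series → Series
  (⊖ f) k = - f k

  const : ℤ → Series
  const a zero    = a
  const a (suc _) = + 0

  scale : ℤ → Series → Series
  scale a f k = a * f k

  nil : Series
  nil _ = + 0

  infixl 7 _∙_
  opaque
    _∙_ : Series → Series → Series
    _∙_ = _⊛_

    ∙-⊛ : ∀ f g → f ∙ g ≡ f ⊛ g
    ∙-⊛ f g = refl

    ∙-zero : ∀ f g → (f ∙ g) 0 ≡ f 0 * g 0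
    ∙-zero f g = ℤₚ.+-identityʳ _

    -- This is f = f(0) + x · `tail f`. Together with `∙-zero` it determines the product, and the
    -- ring laws become inductions on the exponent, generalised over the series, without reindexing
    -- of sums.
    ∙-suc : ∀ f g k → (f ∙ g) (suc k) ≡ f 0 * g (suc k) + (tail f ∙ g) k
    ∙-suc f g k = cong (λ l → f 0 * g (suc k) + foldr _+_ (+ 0) l)
      (trans (map-applyUpTo suc (λ i → f i * g (suc k ℕ.∸ i)) (suc k))
             (sym (map-applyUpTo id (λ i → f (suc i) * g (k ℕ.∸ i)) (suc k))))

  -- Coefficient k of a product sees only coefficients up to k, so a factor may be replaced by a
  -- truncation.
  ∙-cong≤ : ∀ {f f′ g g′} k → (∀ i → i ≤ k → f i ≡ f′ i) → (∀ i → i ≤ k → g i ≡ g′ i) →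
            (f ∙ g) k ≡ (f′ ∙ g′) k
  ∙-cong≤ {f} {f′} {g} {g′} zero F G =
    trans (∙-zero f g) (trans (cong₂ _*_ (F 0 z≤n) (G 0 z≤n)) (sym (∙-zero f′ g′)))
  ∙-cong≤ {f} {f′} {g} {g′} (suc k) F G = trans (∙-suc f g k) (trans
    (cong₂ _+_ (cong₂ _*_ (F 0 z≤n) (G (suc k) ℕₚ.≤-refl))
               (∙-cong≤ k (λ i i≤k → F (suc i) (s≤s i≤k)) (λ i i≤k → G i (ℕₚ.m≤n⇒m≤1+n i≤k))))
    (sym (∙-suc f′ g′ k)))

  ∙-cong : ∀ {f f′ g g′} → f ≈ f′ → g ≈ g′ → f ∙ g ≈ f′ ∙ g′
  ∙-cong F G = pointwise λ k → ∙-cong≤ k (λ i _ → at F i) (λ i _ → at G i)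

  ∙-distribʳ : ∀ f g h → (f ⊕ g) ∙ h ≈ (f ∙ h) ⊕ (g ∙ h)
  ∙-distribʳ f g h = pointwise (go f g)
    where
    lem : ∀ a b c p q → (a + b) * c + (p + q) ≡ (a * c + p) + (b * c + q)
    lem = solve-∀
    go : ∀ f g k → ((f ⊕ g) ∙ h) k ≡ (f ∙ h) k + (g ∙ h) k
    go f g zero = trans (∙-zero (f ⊕ g) h) (trans (ℤₚ.*-distribʳ-+ (h 0) (f 0) (g 0))
      (sym (cong₂ _+_ (∙-zero f h) (∙-zero g h))))
    go f g (suc k) = trans (∙-suc (f ⊕ g) h k) (trans (cong (λ z → (f 0 + g 0) * h (suc k) + z) (go (tail f) (tail g) k))
      (trans (lem (f 0) (g 0) (h (suc k)) _ _) (sym (cong₂ _+_ (∙-suc f h k) (∙-suc g h k)))))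

  scale-∙ : ∀ a f g → scale a f ∙ g ≈ scale a (f ∙ g)
  scale-∙ a f g = pointwise (go f)
    where
    lem : ∀ a b c d → a * b * c + a * d ≡ a * (b * c + d)
    lem = solve-∀
    go : ∀ f k → (scale a f ∙ g) k ≡ a * (f ∙ g) k
    go f zero = trans (∙-zero (scale a f) g) (trans (ℤₚ.*-assoc a (f 0) (g 0)) (cong (a *_) (sym (∙-zero f g))))
    go f (suc k) = trans (∙-suc (scale a f) g k) (trans (cong (λ z → a * f 0 * g (suc k) + z) (go (tail f) k))
      (trans (lem a (f 0) (g (suc k)) _) (cong (a *_) (sym (∙-suc f g k)))))

  -- The mirror image of `∙-suc`, peeling the second factor; commutativity follows by playing the
  -- two recursions against each other.
  ∙-suc′ : ∀ f g k → (f ∙ g) (suc k) ≡ f (suc k) * g 0 + (f ∙ tail g) k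
  ∙-suc′ f g zero = trans (∙-suc f g 0) (trans (cong (λ z → f 0 * g 1 + z) (∙-zero (tail f) g))
    (trans (ℤₚ.+-comm (f 0 * g 1) (f 1 * g 0)) (cong (λ z → f 1 * g 0 + z) (sym (∙-zero f (tail g))))))
  ∙-suc′ f g (suc k) = trans (∙-suc f g (suc k)) (trans (cong (λ z → f 0 * g (suc (suc k)) + z) (∙-suc′ (tail f) g k))
    (trans (lem (f 0 * g (suc (suc k))) (f (suc (suc k)) * g 0) _)
           (cong (λ z → f (suc (suc k)) * g 0 + z) (sym (∙-suc f (tail g) k)))))
    where
    lem : ∀ a b c → a + (b + c) ≡ b + (a + c)
    lem = solve-∀

  ∙-comm : ∀ f g → f ∙ g ≈ g ∙ f
  ∙-comm f g = pointwise (go f g)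
    where
    go : ∀ f g k → (f ∙ g) k ≡ (g ∙ f) k
    go f g zero = trans (∙-zero f g) (trans (ℤₚ.*-comm (f 0) (g 0)) (sym (∙-zero g f)))
    go f g (suc k) = trans (∙-suc f g k) (trans (cong₂ _+_ (ℤₚ.*-comm (f 0) (g (suc k))) (go (tail f) g k)) (sym (∙-suc′ g f k)))

  ∙-assoc : ∀ f g h → (f ∙ g) ∙ h ≈ f ∙ (g ∙ h)
  ∙-assoc f g h = pointwise (go f g)
    where
    lem : ∀ a b c d e → a * b * c + (a * d + e) ≡ a * (b * c + d) + e
    lem = solve-∀
    go : ∀ f g k → ((f ∙ g) ∙ h) k ≡ (f ∙ (g ∙ h)) k
    go f g zero = trans (∙-zero (f ∙ g) h) (trans (cong (_* h 0) (∙-zero f g)) (trans (ℤₚ.*-assoc (f 0) (g 0) (h 0))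
      (trans (cong (f 0 *_) (sym (∙-zero g h))) (sym (∙-zero f (g ∙ h))))))
    go f g (suc k) = begin
      ((f ∙ g) ∙ h) (suc k)
        ≡⟨ ∙-suc (f ∙ g) h k ⟩
      (f ∙ g) 0 * h (suc k) + (tail (f ∙ g) ∙ h) k
        ≡⟨ cong₂ _+_ (cong (_* h (suc k)) (∙-zero f g)) (∙-cong≤ k (λ i _ → ∙-suc f g i) (λ _ _ → refl)) ⟩
      f 0 * g 0 * h (suc k) + ((scale (f 0) (tail g) ⊕ (tail f ∙ g)) ∙ h) k
        ≡⟨ cong (λ z → f 0 * g 0 * h (suc k) + z) (at (∙-distribʳ (scale (f 0) (tail g)) (tail f ∙ g) h) k) ⟩
      f 0 * g 0 * h (suc k) + ((scale (f 0) (tail g) ∙ h) k + ((tail f ∙ g) ∙ h) k)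
        ≡⟨ cong (λ z → f 0 * g 0 * h (suc k) + z) (cong₂ _+_ (at (scale-∙ (f 0) (tail g) h) k) (go (tail f) g k)) ⟩
      f 0 * g 0 * h (suc k) + (f 0 * (tail g ∙ h) k + (tail f ∙ (g ∙ h)) k)
        ≡⟨ lem (f 0) (g 0) (h (suc k)) _ _ ⟩
      f 0 * (g 0 * h (suc k) + (tail g ∙ h) k) + (tail f ∙ (g ∙ h)) k
        ≡⟨ cong (λ z → f 0 * z + (tail f ∙ (g ∙ h)) k) (sym (∙-suc g h k)) ⟩
      f 0 * (g ∙ h) (suc k) + (tail f ∙ (g ∙ h)) k
        ≡⟨ sym (∙-suc f (g ∙ h) k) ⟩
      (f ∙ (g ∙ h)) (suc k) ∎
      where open ≡-Reasoning

  nil-∙ : ∀ g → nil ∙ g ≈ nil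
  nil-∙ g = pointwise go
    where
    go : ∀ k → (nil ∙ g) k ≡ + 0
    go zero    = trans (∙-zero nil g) (ℤₚ.*-zeroˡ (g 0))
    go (suc k) = trans (∙-suc nil g k) (trans (cong₂ _+_ (ℤₚ.*-zeroˡ (g (suc k))) (go k)) refl)

  const-∙ : ∀ a g → const a ∙ g ≈ scale a g
  const-∙ a g = pointwise go
    where
    go : ∀ k → (const a ∙ g) k ≡ a * g k
    go zero    = ∙-zero (const a) g
    go (suc k) = trans (∙-suc (const a) g k) (trans (cong (λ z → a * g (suc k) + z) (at (nil-∙ g) k)) (ℤₚ.+-identityʳ _))

  one≈const1 : one ≈ const (+ 1)
  one≈const1 = pointwise λ { zero → refl ; (suc k) → refl }

  ∙-identityˡ : ∀ g → one ∙ g ≈ g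
  ∙-identityˡ g = pointwise λ k → trans (at (∙-cong one≈const1 (pointwise λ _ → refl)) k)
    (trans (at (const-∙ (+ 1) g) k) (ℤₚ.*-identityˡ (g k)))

  ≈-refl : ∀ {f} → f ≈ f
  ≈-refl = pointwise λ _ → refl
  ≈-sym : ∀ {f g} → f ≈ g → g ≈ f
  ≈-sym F = pointwise λ k → sym (at F k)
  ≈-trans : ∀ {f g h} → f ≈ g → g ≈ h → f ≈ h
  ≈-trans F G = pointwise λ k → trans (at F k) (at G k)

  seriesRing : CommutativeRing 0ℓ 0ℓ
  seriesRing = record
    { Carrier = Series ; _≈_ = _≈_ ; _+_ = _⊕_ ; _*_ = _∙_ ; -_ = ⊖_ ; 0# = nil ; 1# = one
    ; isCommutativeRing = record
      { isRing = record
        { +-isAbelianGroup = record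
          { isGroup = record
            { isMonoid = record
              { isSemigroup = record
                { isMagma = record
                  { isEquivalence = record { refl = ≈-refl ; sym = ≈-sym ; trans = ≈-trans }
                  ; ∙-cong = λ F G → pointwise λ k → cong₂ _+_ (at F k) (at G k) }
                ; assoc = λ f g h → pointwise λ k → ℤₚ.+-assoc (f k) (g k) (h k) }
              ; identity = (λ f → pointwise λ k → ℤₚ.+-identityˡ (f k)) , (λ f → pointwise λ k → ℤₚ.+-identityʳ (f k)) }
            ; inverse = (λ f → pointwise λ k → ℤₚ.+-inverseˡ (f k)) , (λ f → pointwise λ k → ℤₚ.+-inverseʳ (f k))
            ; ⁻¹-cong = λ F → pointwise λ k → cong -_ (at F k) }
          ; comm = λ f g → pointwise λ k → ℤₚ.+-comm (f k) (g k) }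
        ; *-cong = ∙-cong
        ; *-assoc = ∙-assoc
        ; *-identity = ∙-identityˡ , λ f → ≈-trans (∙-comm f one) (∙-identityˡ f)
        ; distrib = (λ f g h → ≈-trans (∙-comm f (g ⊕ h)) (≈-trans (∙-distribʳ g h f)
                      (pointwise λ k → cong₂ _+_ (at (∙-comm g f) k) (at (∙-comm h f) k))))
                  , λ f g h → ∙-distribʳ g h f }
      ; *-comm = ∙-comm } }

  seriesACR : AlmostCommutativeRing 0ℓ 0ℓ
  seriesACR = fromCommutativeRing seriesRing

  constMorphism : ℤ.+-*-rawRing -Raw-AlmostCommutative⟶ seriesACR
  constMorphism = record
    { ⟦_⟧ = const
    ; +-homo = λ a b → pointwise λ { zero → refl ; (suc k) → refl }
    ; *-homo = λ a b → ≈-sym (≈-trans (const-∙ a (const b)) (pointwise λ { zero → refl ; (suc k) → ℤₚ.*-zeroʳ a }))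
    ; -‿homo = λ a → pointwise λ { zero → refl ; (suc k) → refl }
    ; 0-homo = pointwise λ { zero → refl ; (suc k) → refl }
    ; 1-homo = ≈-sym one≈const1 }

  const≟ : ∀ a b → Maybe (const a ≈ const b)
  const≟ a b = dec⇒maybe (map′ (λ { refl → ≈-refl }) (λ e → at e 0) (a ℤ.≟ b))

  module SeriesSolver = Algebra.Solver.Ring ℤ.+-*-rawRing seriesACR constMorphism const≟

  -- The private helper of invRev; unification in invRev-suc recovers it.
  mutual
    dot : Series → ℕ → List ℤ → ℤ
    dot = _

    invRev-suc : ∀ f k → invRev f (suc k) ≡ - (f 0 * dot f 0 (invRev f k)) ∷ invRev f k
    invRev-suc f k with invRev f k | 0
    ... | rs | j = refl

  record Unit (f : Series) : Set where
    constructor unit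
    field square : f 0 * f 0 ≡ + 1
  open Unit public

  opaque
    inv : Series → Series
    inv = invS

    inv-invS : ∀ f → inv f ≡ invS f
    inv-invS f = refl

    inv-zero : ∀ f → inv f 0 ≡ f 0
    inv-zero f = refl

    -- The list holds the coefficients of the inverse in descending order, so pairing it with
    -- ascending coefficients of f is a convolution; j is the offset reached in f.
    dot-invRev : ∀ f j k → dot f j (invRev f k) ≡ ((λ i → f (suc (i ℕ.+ j))) ∙ inv f) k
    dot-invRev f j zero = trans (ℤₚ.+-identityʳ _) (sym (∙-zero (λ i → f (suc (i ℕ.+ j))) (invS f)))
    dot-invRev f j (suc k) = trans
      (cong (λ z → f (suc j) * inv f (suc k) + z)
        (trans (dot-invRev f (suc j) k)
          (∙-cong≤ k (λ i _ → cong (λ t → f (suc t)) (ℕₚ.+-suc i j)) (λ _ _ → refl))))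
      (sym (∙-suc (λ i → f (suc (i ℕ.+ j))) (inv f) k))

    inv-suc : ∀ f k → inv f (suc k) ≡ - (f 0 * (tail f ∙ inv f) k)
    inv-suc f k = cong (λ z → - (f 0 * z)) (trans (dot-invRev f 0 k)
      (∙-cong≤ k (λ i _ → cong (λ t → f (suc t)) (ℕₚ.+-identityʳ i)) (λ _ _ → refl)))

  -- By `inv-suc`, coefficient k + 1 of the product is 1 - f(0)² times a coefficient of
  -- `tail f ∙ inv f`, and f(0)² = 1.
  ∙-inv : ∀ {f} → Unit f → f ∙ inv f ≈ one
  ∙-inv {f} u = pointwise go
    where
    lem : ∀ a b → a * (- (a * b)) + b ≡ (+ 1 + - (a * a)) * b
    lem = solve-∀
    go : ∀ k → (f ∙ inv f) k ≡ one k
    go zero = trans (∙-zero f (inv f)) (trans (cong (f 0 *_) (inv-zero f)) (square u))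
    go (suc k) = trans (∙-suc f (inv f) k) (trans (cong (λ z → f 0 * z + (tail f ∙ inv f) k) (inv-suc f k))
      (trans (lem (f 0) _) (cong (λ z → (+ 1 + - z) * (tail f ∙ inv f) k) (square u))))

  open CommutativeRing seriesRing using () renaming (setoid to seriesSetoid; *-identityʳ to ∙-identityʳ) public
  module ≈-R = SetoidReasoning seriesSetoid

  inv-∙-cancel : ∀ {f} g → Unit f → inv f ∙ (f ∙ g) ≈ g
  inv-∙-cancel {f} g u = ≈-trans (≈-sym (∙-assoc (inv f) f g))
    (≈-trans (∙-cong (≈-trans (∙-comm (inv f) f) (∙-inv u)) ≈-refl) (∙-identityˡ g))

  ∙-cancelˡ : ∀ {f g h} → Unit f → f ∙ g ≈ f ∙ h → g ≈ h
  ∙-cancelˡ {f} {g} {h} u e = ≈-trans (≈-sym (inv-∙-cancel g u)) (≈-trans (∙-cong ≈-refl e) (inv-∙-cancel h u))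

  inv-unique : ∀ {f g} → Unit f → f ∙ g ≈ one → g ≈ inv f
  inv-unique u e = ∙-cancelˡ u (≈-trans e (≈-sym (∙-inv u)))

  sq : ∀ a b → a * a ≡ + 1 → b * b ≡ + 1 → (a * b) * (a * b) ≡ + 1
  sq a b p q = trans (lem a b) (cong₂ _*_ p q)
    where
    lem : ∀ a b → (a * b) * (a * b) ≡ (a * a) * (b * b)
    lem = solve-∀

  Unit-one : Unit one
  Unit-one = unit refl

  Unit-∙ : ∀ {f g} → Unit f → Unit g → Unit (f ∙ g)
  Unit-∙ {f} {g} (unit u) (unit v) = unit (trans (cong₂ _*_ (∙-zero f g) (∙-zero f g)) (sq (f 0) (g 0) u v))

  Unit-inv : ∀ {f} → Unit f → Unit (inv f)
  Unit-inv {f} (unit u) = unit (trans (cong₂ _*_ (inv-zero f) (inv-zero f)) u)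

  Unit-≈ : ∀ {f g} → f ≈ g → Unit f → Unit g
  Unit-≈ e (unit u) = unit (trans (sym (cong₂ _*_ (at e 0) (at e 0))) u)

  inv-cong : ∀ {f g} → Unit f → f ≈ g → inv f ≈ inv g
  inv-cong {f} {g} u e = inv-unique (Unit-≈ e u) (≈-trans (∙-cong (≈-sym e) ≈-refl) (∙-inv u))

  inv-involutive : ∀ {f} → Unit f → inv (inv f) ≈ f
  inv-involutive {f} u = ≈-sym (inv-unique (Unit-inv u) (≈-trans (∙-comm (inv f) f) (∙-inv u)))

  interchange : ∀ f g h k → (f ∙ g) ∙ (h ∙ k) ≈ (f ∙ h) ∙ (g ∙ k)
  interchange = solve 4 (λ f g h k → (f :* g) :* (h :* k) := (f :* h) :* (g :* k)) ≈-refl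
    where open SeriesSolver

  inv-∙ : ∀ {f g} → Unit f → Unit g → inv (f ∙ g) ≈ inv f ∙ inv g
  inv-∙ {f} {g} u v = ≈-sym (inv-unique (Unit-∙ u v)
    (≈-trans (interchange f g (inv f) (inv g)) (≈-trans (∙-cong (∙-inv u) (∙-inv v)) (∙-identityˡ one))))

  -- Multiplication by x^p and substitution of x^p

  shift : ℕ → Series → Series
  shift zero    f k       = f k
  shift (suc p) f zero    = + 0
  shift (suc p) f (suc k) = shift p f k

  shift-< : ∀ p f {k} → k < p → shift p f k ≡ + 0
  shift-< (suc p) f {zero}  _         = refl
  shift-< (suc p) f {suc k} (s≤s k<p) = shift-< p f k<p

  shift-+ : ∀ p f k → shift p f (p ℕ.+ k) ≡ f k
  shift-+ zero    f k = refl
  shift-+ (suc p) f k = shift-+ p f k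

  shift-cong : ∀ p {f g} k → (∀ j → p ℕ.+ j ≡ k → f j ≡ g j) → shift p f k ≡ shift p g k
  shift-cong zero    k       e = e k refl
  shift-cong (suc p) zero    e = refl
  shift-cong (suc p) (suc k) e = shift-cong p k (λ j q → e j (cong suc q))

  shift-∙ : ∀ p f g → shift p f ∙ g ≈ shift p (f ∙ g)
  shift-∙ zero    f g = ≈-refl
  shift-∙ (suc p) f g = pointwise go
    where
    go : ∀ k → (shift (suc p) f ∙ g) k ≡ shift (suc p) (f ∙ g) k
    go zero    = trans (∙-zero (shift (suc p) f) g) (ℤₚ.*-zeroˡ (g 0))
    go (suc k) = trans (∙-suc (shift (suc p) f) g k)
      (trans (cong (_+ (shift p f ∙ g) k) (ℤₚ.*-zeroˡ (g (suc k))))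
        (trans (ℤₚ.+-identityˡ _) (at (shift-∙ p f g) k)))

  head-tail : ∀ f → f ≈ const (f 0) ⊕ shift 1 (tail f)
  head-tail f = pointwise λ { zero → sym (ℤₚ.+-identityʳ (f 0)) ; (suc k) → sym (ℤₚ.+-identityˡ (f (suc k))) }

  opaque
    -- f(x^p); junk for p = 0.
    dil : ℕ → Series → Series
    dil p f k with p ∣? k
    ... | yes (divides q _) = f q
    ... | no _              = + 0

    dil-* : ∀ p f q → 1 ≤ p → dil p f (q ℕ.* p) ≡ f q
    dil-* p f q 1≤p with p ∣? (q ℕ.* p)
    ... | yes (divides q′ e) = cong f (sym (ℕₚ.*-cancelʳ-≡ q q′ p {{ℕ.>-nonZero 1≤p}} e))
    ... | no ¬p∣ = contradiction (divides-refl q) ¬p∣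

    dil-∤ : ∀ p f k → p ∤ k → dil p f k ≡ + 0
    dil-∤ p f k ¬p∣k with p ∣? k
    ... | yes p∣k = contradiction p∣k ¬p∣k
    ... | no _ = refl

    dil-cong≡ : ∀ p {f g} k → (∀ q → k ≡ q ℕ.* p → f q ≡ g q) → dil p f k ≡ dil p g k
    dil-cong≡ p k e with p ∣? k
    ... | yes (divides q eq) = e q eq
    ... | no _ = refl

    dil-⊕ : ∀ p f g k → dil p (f ⊕ g) k ≡ dil p f k + dil p g k
    dil-⊕ p f g k with p ∣? k
    ... | yes _ = refl
    ... | no _ = refl

    dil-scale : ∀ p a f k → dil p (scale a f) k ≡ a * dil p f k
    dil-scale p a f k with p ∣? k
    ... | yes _ = refl
    ... | no _ = sym (ℤₚ.*-zeroʳ a)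

  dil-cong : ∀ p {f g} → f ≈ g → dil p f ≈ dil p g
  dil-cong p e = pointwise λ k → dil-cong≡ p k (λ q _ → at e q)

  dil-zero : ∀ p f → 1 ≤ p → dil p f 0 ≡ f 0
  dil-zero p f 1≤p = dil-* p f 0 1≤p

  dil-small : ∀ p f {k} → suc k < p → dil p f (suc k) ≡ + 0
  dil-small p f {k} k<p = dil-∤ p f (suc k) (λ p∣ → ℕₚ.<⇒≱ k<p (∣⇒≤ p∣))

  Unit-dil : ∀ p {f} → 1 ≤ p → Unit f → Unit (dil p f)
  Unit-dil p {f} 1≤p (unit u) = unit (trans (cong₂ _*_ (dil-zero p f 1≤p) (dil-zero p f 1≤p)) u)

  dil-shift : ∀ p f → 1 ≤ p → dil p (shift 1 f) ≈ shift p (dil p f)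
  dil-shift p f 1≤p = pointwise λ k → go k (ℕₚ.<-≤-connex k p)
    where
    go : ∀ k → _ → dil p (shift 1 f) k ≡ shift p (dil p f) k
    go zero (inj₁ k<p) = trans (dil-zero p (shift 1 f) 1≤p) (sym (shift-< p (dil p f) k<p))
    go (suc k) (inj₁ k<p) = trans (dil-small p (shift 1 f) k<p) (sym (shift-< p (dil p f) k<p))
    go k (inj₂ p≤k) = subst (λ k → dil p (shift 1 f) k ≡ shift p (dil p f) k) (ℕₚ.m+[n∸m]≡n p≤k)
      (trans (lem (k ℕ.∸ p) (p ∣? (k ℕ.∸ p))) (sym (shift-+ p (dil p f) (k ℕ.∸ p))))
      where
      lem : ∀ k → Dec (p ∣ k) → dil p (shift 1 f) (p ℕ.+ k) ≡ dil p f k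
      lem k (yes (divides-refl q)) = trans (dil-* p (shift 1 f) (suc q) 1≤p) (sym (dil-* p f q 1≤p))
      lem k (no ¬p∣k) = trans (dil-∤ p (shift 1 f) (p ℕ.+ k) (λ d → ¬p∣k (∣m+n∣m⇒∣n d ∣-refl)))
                              (sym (dil-∤ p f k ¬p∣k))

  dil-const : ∀ p a → 1 ≤ p → dil p (const a) ≈ const a
  dil-const p a 1≤p = pointwise λ { zero → dil-zero p (const a) 1≤p ; (suc k) → lem k (p ∣? suc k) }
    where
    lem : ∀ k → Dec (p ∣ suc k) → dil p (const a) (suc k) ≡ + 0
    lem k (yes (divides (suc q) e)) = trans (cong (dil p (const a)) e) (dil-* p (const a) (suc q) 1≤p)
    lem k (no ¬p∣k) = dil-∤ p (const a) (suc k) ¬p∣k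

  dil-one : ∀ p → 1 ≤ p → dil p one ≈ one
  dil-one p 1≤p = ≈-trans (dil-cong p one≈const1) (≈-trans (dil-const p (+ 1) 1≤p) (≈-sym one≈const1))

  dil-head : ∀ p f → 1 ≤ p → dil p f ≈ const (f 0) ⊕ shift p (dil p (tail f))
  dil-head p f 1≤p = ≈-trans (dil-cong p (head-tail f)) (pointwise λ k → trans (dil-⊕ p (const (f 0)) (shift 1 (tail f)) k)
    (cong₂ _+_ (at (dil-const p (f 0) 1≤p) k) (at (dil-shift p (tail f) 1≤p) k)))

  -- Splitting off f(0) leaves x (`tail f` ∙ g), and dilation turns this x into x^p. As p ≥ 1,
  -- coefficient k then needs the claim only below k, for a different f.
  dil-∙ : ∀ p f g → 1 ≤ p → dil p (f ∙ g) ≈ dil p f ∙ dil p g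
  dil-∙ p f g 1≤p = pointwise λ k → <-rec _ step k f g
    where
    expand : ∀ f g → f ∙ g ≈ scale (f 0) g ⊕ shift 1 (tail f ∙ g)
    expand f g = ≈-trans (∙-cong (head-tail f) ≈-refl) (≈-trans (∙-distribʳ (const (f 0)) (shift 1 (tail f)) g)
      (pointwise λ k → cong₂ _+_ (at (const-∙ (f 0) g) k) (at (shift-∙ 1 (tail f) g) k)))
    step : ∀ k → (∀ {j} → j < k → ∀ f g → dil p (f ∙ g) j ≡ (dil p f ∙ dil p g) j) →
           ∀ f g → dil p (f ∙ g) k ≡ (dil p f ∙ dil p g) k
    step k IH f g = begin
      dil p (f ∙ g) k
        ≡⟨ at (dil-cong p (expand f g)) k ⟩
      dil p (scale (f 0) g ⊕ shift 1 (tail f ∙ g)) k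
        ≡⟨ dil-⊕ p (scale (f 0) g) (shift 1 (tail f ∙ g)) k ⟩
      dil p (scale (f 0) g) k + dil p (shift 1 (tail f ∙ g)) k
        ≡⟨ cong₂ _+_ (dil-scale p (f 0) g k) (at (dil-shift p (tail f ∙ g) 1≤p) k) ⟩
      f 0 * dil p g k + shift p (dil p (tail f ∙ g)) k
        ≡⟨ cong (λ z → f 0 * dil p g k + z) (shift-cong p k (λ j e →
             IH (subst (j <_) e (ℕₚ.m<n+m j 1≤p)) (tail f) g)) ⟩
      f 0 * dil p g k + shift p (dil p (tail f) ∙ dil p g) k
        ≡⟨ cong₂ _+_ (sym (at (const-∙ (f 0) (dil p g)) k)) (sym (at (shift-∙ p (dil p (tail f)) (dil p g)) k)) ⟩
      (const (f 0) ∙ dil p g) k + (shift p (dil p (tail f)) ∙ dil p g) k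
        ≡⟨ sym (at (∙-distribʳ (const (f 0)) (shift p (dil p (tail f))) (dil p g)) k) ⟩
      ((const (f 0) ⊕ shift p (dil p (tail f))) ∙ dil p g) k
        ≡⟨ sym (at (∙-cong (dil-head p f 1≤p) (≈-refl {dil p g})) k) ⟩
      (dil p f ∙ dil p g) k ∎
      where open ≡-Reasoning

  dil-inv : ∀ p {f} → 1 ≤ p → Unit f → dil p (inv f) ≈ inv (dil p f)
  dil-inv p {f} 1≤p u = inv-unique (Unit-dil p 1≤p u)
    (≈-trans (≈-sym (dil-∙ p f (inv f) 1≤p)) (≈-trans (dil-cong p (∙-inv u)) (dil-one p 1≤p)))

  dil-dil : ∀ p q f → 1 ≤ p → 1 ≤ q → dil p (dil q f) ≈ dil (p ℕ.* q) f
  dil-dil p q f 1≤p 1≤q = pointwise λ k → go k (p ∣? k)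
    where
    pq : 1 ≤ p ℕ.* q
    pq = ℕₚ.*-mono-≤ 1≤p 1≤q
    comm : ∀ r → (r ℕ.* q) ℕ.* p ≡ r ℕ.* (p ℕ.* q)
    comm r = trans (ℕₚ.*-assoc r q p) (cong (r ℕ.*_) (ℕₚ.*-comm q p))
    go : ∀ k → Dec (p ∣ k) → dil p (dil q f) k ≡ dil (p ℕ.* q) f k
    go k (no ¬p∣k) = trans (dil-∤ p _ k ¬p∣k) (sym (dil-∤ (p ℕ.* q) f k
      (λ { (divides r e) → ¬p∣k (divides (r ℕ.* q) (trans e (sym (comm r)))) })))
    go k (yes (divides-refl t)) with q ∣? t
    ... | yes (divides-refl r) = trans (dil-* p _ (r ℕ.* q) 1≤p) (trans (dil-* q f r 1≤q)
            (sym (trans (cong (dil (p ℕ.* q) f) (comm r)) (dil-* (p ℕ.* q) f r pq))))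
    ... | no ¬q∣t = trans (dil-* p _ t 1≤p) (trans (dil-∤ q f t ¬q∣t) (sym (dil-∤ (p ℕ.* q) f (t ℕ.* p)
            (λ { (divides r e) → ¬q∣t (divides r (ℕₚ.*-cancelʳ-≡ t (r ℕ.* q) p {{ℕ.>-nonZero 1≤p}} (trans e (sym (comm r))))) }))))

-- Cyclotomic series and the adjunction of a prime

module Cyclotomic where

  open import Defs
  open PrimeClusters using (prime>1; prime-∤⇒coprime)
  open SeriesRing
  open import Data.Nat as ℕ using (ℕ; zero; suc; _<_; _≤_; z≤n; s≤s; _<′_)
  import Data.Nat.Properties as ℕₚ
  open import Data.Nat.Divisibility
  open import Data.Nat.Induction using (<-rec; <′-wellFounded; <′-wellFounded′)
  open import Data.Nat.Primality using (Prime)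
  open import Data.Nat.Coprimality using (coprime-divisor)
  open import Data.Integer using (+_; -_)
  open import Data.List using (map; tabulate)
  open import Data.List.Properties using (map-cong)
  open import Data.Fin as Fin using (Fin; toℕ)
  open import Data.Fin.Properties using (toℕ<n)
  open import Function using (_∘_)
  open import Induction.WellFounded using (Acc; acc)
  open import Relation.Nullary using (yes; no; Dec; contradiction; ¬_)
  open import Relation.Binary.PropositionalEquality

  open ≈-R

  opaque
    ∏ : ℕ → (ℕ → Series) → Series
    ∏ zero    h = one
    ∏ (suc n) h = h 0 ∙ ∏ n (h ∘ suc)

    ∏-suc : ∀ n h → ∏ (suc n) h ≡ h 0 ∙ ∏ n (h ∘ suc)
    ∏-suc n h = refl

    ∏-cong : ∀ n {h h′} → (∀ i → i < n → h i ≈ h′ i) → ∏ n h ≈ ∏ n h′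
    ∏-cong zero    e = ≈-refl
    ∏-cong (suc n) e = ∙-cong (e 0 (s≤s z≤n)) (∏-cong n (λ i i<n → e (suc i) (s≤s i<n)))

    ∏-∙ : ∀ n h h′ → ∏ n (λ i → h i ∙ h′ i) ≈ ∏ n h ∙ ∏ n h′
    ∏-∙ zero    h h′ = ≈-sym (∙-identityˡ one)
    ∏-∙ (suc n) h h′ = ≈-trans (∙-cong ≈-refl (∏-∙ n (h ∘ suc) (h′ ∘ suc)))
      (interchange (h 0) (h′ 0) (∏ n (h ∘ suc)) (∏ n (h′ ∘ suc)))

    ∏-ones : ∀ n h → (∀ i → i < n → h i ≈ one) → ∏ n h ≈ one
    ∏-ones zero    h e = ≈-refl
    ∏-ones (suc n) h e = ≈-trans (∙-cong (e 0 (s≤s z≤n)) (∏-ones n (h ∘ suc) (λ i i<n → e (suc i) (s≤s i<n)))) (∙-identityˡ one)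

    ∏-+ : ∀ a b h → ∏ (a ℕ.+ b) h ≈ ∏ a h ∙ ∏ b (λ i → h (a ℕ.+ i))
    ∏-+ zero    b h = ≈-sym (∙-identityˡ _)
    ∏-+ (suc a) b h = ≈-trans (∙-cong ≈-refl (∏-+ a b (h ∘ suc))) (≈-sym (∙-assoc _ _ _))

    ∏-extend : ∀ {a b} h → a ≤ b → (∀ i → a ≤ i → h i ≈ one) → ∏ b h ≈ ∏ a h
    ∏-extend {a} {b} h a≤b e = subst (λ b → ∏ b h ≈ ∏ a h) (ℕₚ.m+[n∸m]≡n a≤b)
      (≈-trans (∏-+ a (b ℕ.∸ a) h) (≈-trans (∙-cong ≈-refl (∏-ones (b ℕ.∸ a) _ (λ i _ → e (a ℕ.+ i) (ℕₚ.m≤m+n a i)))) (∙-identityʳ _)))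

    ∏-snoc : ∀ n h → ∏ (suc n) h ≈ ∏ n h ∙ h n
    ∏-snoc n h = subst₂ (λ a b → ∏ a h ≈ ∏ n h ∙ h b) (ℕₚ.+-comm n 1) (ℕₚ.+-identityʳ n)
      (≈-trans (∏-+ n 1 h) (∙-cong ≈-refl (∙-identityʳ _)))

    -- Each block of p consecutive indices, counted from 0, contains one multiple of p, namely its
    -- first element.
    ∏-multiples : ∀ p L h → 1 ≤ p → (∀ e → p ∤ e → h e ≈ one) → ∏ (L ℕ.* p) h ≈ ∏ L (λ d → h (d ℕ.* p))
    ∏-multiples p zero h 1≤p e = ≈-refl
    ∏-multiples p@(suc p′) (suc L) h 1≤p e = ≈-trans (∏-+ p (L ℕ.* p) h) (∙-cong
      (≈-trans (∙-cong ≈-refl (∏-ones p′ (h ∘ suc) (λ i i<p′ → e (suc i) (>⇒∤ (s≤s i<p′))))) (∙-identityʳ _))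
      (∏-multiples p L (λ i → h (p ℕ.+ i)) 1≤p (λ i p∤i → e (p ℕ.+ i) (λ d → p∤i (∣m+n∣m⇒∣n d ∣-refl)))))

    ∏-Unit : ∀ n h → (∀ i → i < n → Unit (h i)) → Unit (∏ n h)
    ∏-Unit zero    h u = Unit-one
    ∏-Unit (suc n) h u = Unit-∙ (u 0 (s≤s z≤n)) (∏-Unit n (h ∘ suc) (λ i i<n → u (suc i) (s≤s i<n)))

    dil-∏ : ∀ p n h → 1 ≤ p → dil p (∏ n h) ≈ ∏ n (λ i → dil p (h i))
    dil-∏ p zero    h 1≤p = dil-one p 1≤p
    dil-∏ p (suc n) h 1≤p = ≈-trans (dil-∙ p (h 0) (∏ n (h ∘ suc)) 1≤p) (∙-cong ≈-refl (dil-∏ p n (h ∘ suc) 1≤p))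

    prodS-∏ : ∀ {A : Set} (F : A → Series) n (g : Fin n → A) (h : ℕ → Series) →
              (∀ i → F (g i) ≡ h (toℕ i)) → prodS (map F (tabulate g)) ≈ ∏ n h
    prodS-∏ F zero    g h e = ≈-refl
    prodS-∏ F (suc n) g h e = subst (_≈ ∏ (suc n) h) (∙-⊛ (F (g Fin.zero)) (prodS (map F (tabulate (g ∘ Fin.suc)))))
      (∙-cong (subst (F (g Fin.zero) ≈_) (e Fin.zero) ≈-refl) (prodS-∏ F n (g ∘ Fin.suc) (h ∘ suc) (λ i → e (Fin.suc i))))

  -- Products over divisors run over all indices, with `one` in place of the non-divisors; they can
  -- then be lengthened, split and compared index by index.
  when : {P : Set} → Dec P → Series → Series
  when (yes _) f = f
  when (no _)  f = one

  unless : {P : Set} → Dec P → Series → Series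
  unless (yes _) f = one
  unless (no _)  f = f

  when-cong : {P : Set} (d : Dec P) {f g : Series} → (P → f ≈ g) → when d f ≈ when d g
  when-cong (yes p) e = e p
  when-cong (no _)  e = ≈-refl

  when-⇔ : {P Q : Set} (d : Dec P) (d′ : Dec Q) (f : Series) → (P → Q) → (Q → P) → when d f ≈ when d′ f
  when-⇔ (yes p) (yes q) f to from = ≈-refl
  when-⇔ (yes p) (no ¬q) f to from = contradiction (to p) ¬q
  when-⇔ (no ¬p) (yes q) f to from = contradiction (from q) ¬p
  when-⇔ (no ¬p) (no ¬q) f to from = ≈-refl

  when-no : {P : Set} (d : Dec P) (f : Series) → ¬ P → when d f ≈ one
  when-no (yes p) f ¬p = contradiction p ¬p
  when-no (no _)  f ¬p = ≈-refl

  when-yes : {P : Set} (d : Dec P) (f : Series) → P → when d f ≈ f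
  when-yes (yes p) f _ = ≈-refl
  when-yes (no ¬p) f p = contradiction p ¬p

  when-∙ : {P : Set} (d : Dec P) (f g : Series) → when d f ∙ when d g ≈ when d (f ∙ g)
  when-∙ (yes p) f g = ≈-refl
  when-∙ (no _)  f g = ∙-identityˡ one

  when-unless : {P : Set} (d : Dec P) (f : Series) → f ≈ when d f ∙ unless d f
  when-unless (yes p) f = ≈-sym (∙-identityʳ f)
  when-unless (no _)  f = ≈-sym (∙-identityˡ f)

  Unit-when : {P : Set} (d : Dec P) {f : Series} → (P → Unit f) → Unit (when d f)
  Unit-when (yes p) u = u p
  Unit-when (no _)  u = Unit-one

  dil-when : {P : Set} (d : Dec P) (p : ℕ) (f : Series) → 1 ≤ p → dil p (when d f) ≈ when d (dil p f)
  dil-when (yes _) p f 1≤p = ≈-refl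
  dil-when (no _)  p f 1≤p = dil-one p 1≤p

  -- The helper functions of Φ are local to its definition; the underscores below are
  -- solved by unification against Φ and give them names.
  Rec : ℕ → Set
  Rec n = ∀ {y} → y <′ suc n → Acc _<′_ y

  mutual
    fac : ∀ n → Fin (suc n) → Series
    fac = _

    Φ-fac : ∀ n → Φ (suc n) ≡ xpow-1 (suc n) ⊛ invS (one ⊛ prodS (map (fac n) (tabulate {n = n} Fin.suc)))
    Φ-fac n = refl

  mutual
    ΦAcc : ∀ d → Acc _<′_ d → Series
    ΦAcc = _

    facDec : ∀ n i → Dec _ → Series
    facDec n i (yes _) = ΦAcc (toℕ i) (<′-wellFounded′ (suc n) (ℕₚ.<⇒<′ (toℕ<n i)))
    facDec n i (no _) = one

    fac-facDec : ∀ n i → fac n i ≡ facDec n i (toℕ i ∣? suc n)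
    fac-facDec n i with toℕ i ∣? suc n
    ... | no _ = refl
    ... | yes _ with toℕ i | <′-wellFounded′ (suc n) (ℕₚ.<⇒<′ (toℕ<n i))
    ...   | d | q = refl

  mutual
    facAcc : ∀ n → Rec n → Fin (suc n) → Series
    facAcc = _

    ΦAcc-facAcc : ∀ n (rs : Rec n) →
      ΦAcc (suc n) (acc rs) ≡ xpow-1 (suc n) ⊛ invS (one ⊛ prodS (map (facAcc n rs) (tabulate {n = n} Fin.suc)))
    ΦAcc-facAcc n rs = refl

  -- The unfolded recursion of `Φ` carries accessibility proofs. As its values do not depend on
  -- them, the factor at a divisor d is `Φ d` itself, and the recurrence can be stated in terms of
  -- `Φ`.
  ΦAcc-irrelevant : ∀ d (q q′ : Acc _<′_ d) → ΦAcc d q ≡ ΦAcc d q′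
  facAcc-irrelevant : ∀ n (rs rs′ : Rec n) i → facAcc n rs i ≡ facAcc n rs′ i
  ΦAcc-irrelevant zero    (acc _)  (acc _)   = refl
  ΦAcc-irrelevant (suc n) (acc rs) (acc rs′) =
    cong (λ l → xpow-1 (suc n) ⊛ invS (one ⊛ prodS l)) (map-cong (facAcc-irrelevant n rs rs′) (tabulate Fin.suc))
  facAcc-irrelevant n rs rs′ i with toℕ i ∣? suc n
  ... | yes _ = ΦAcc-irrelevant (toℕ i) (rs (ℕₚ.<⇒<′ (toℕ<n i))) (rs′ (ℕₚ.<⇒<′ (toℕ<n i)))
  ... | no _  = refl

  xpow-1-Unit : ∀ N → 1 ≤ N → Unit (xpow-1 N)
  xpow-1-Unit (suc N) _ = unit refl

  fac-Φ : ∀ n i → fac n i ≡ when (toℕ i ∣? suc n) (Φ (toℕ i))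
  fac-Φ n i with toℕ i ∣? suc n
  ... | yes _ = ΦAcc-irrelevant (toℕ i) (<′-wellFounded′ (suc n) (ℕₚ.<⇒<′ (toℕ<n i))) (<′-wellFounded (toℕ i))
  ... | no _  = refl

  -- An opaque copy of Φ, so that unification does not unfold the recursion.
  opaque
    Ψ : ℕ → Series
    Ψ = Φ

    Ψ-Φ : ∀ n → Ψ n ≡ Φ n
    Ψ-Φ n = refl

    Ψ-zero : Ψ 0 ≡ one
    Ψ-zero = refl

    Ψ-step : ∀ n → Ψ (suc n) ≡ xpow-1 (suc n) ⊛ invS (one ⊛ prodS (map (λ i → when (toℕ i ∣? suc n) (Ψ (toℕ i))) (tabulate {n = n} Fin.suc)))
    Ψ-step n = trans (Φ-fac n) (cong (λ l → xpow-1 (suc n) ⊛ invS (one ⊛ prodS l)) (map-cong (fac-Φ n) (tabulate Fin.suc)))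

  Ψ∣ : ℕ → ℕ → Series
  Ψ∣ N d = when (d ∣? N) (Ψ d)

  Ψ-step∙ : ∀ n → Ψ (suc n) ≡ xpow-1 (suc n) ∙ inv (one ∙ prodS (map (λ i → Ψ∣ (suc n) (toℕ i)) (tabulate {n = n} Fin.suc)))
  Ψ-step∙ n = trans (Ψ-step n) (sym (trans (∙-⊛ _ _) (cong (xpow-1 (suc n) ⊛_) (trans (inv-invS _) (cong invS (∙-⊛ one _))))))

  Ψ-prod : ∀ n → one ∙ prodS (map (λ i → Ψ∣ (suc n) (toℕ i)) (tabulate {n = n} Fin.suc)) ≈ ∏ (suc n) (Ψ∣ (suc n))
  Ψ-prod n = subst (one ∙ prodS (map (λ i → Ψ∣ (suc n) (toℕ i)) (tabulate {n = n} Fin.suc)) ≈_) (sym (∏-suc n (Ψ∣ (suc n)))) (∙-cong (≈-sym (when-no (0 ∣? suc n) (Ψ 0) (λ { (divides q e) → contradiction (trans e (ℕₚ.*-zeroʳ q)) λ () })))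
    (prodS-∏ (λ i → Ψ∣ (suc n) (toℕ i)) n Fin.suc (λ i → Ψ∣ (suc n) (suc i)) (λ i → refl)))

  Ψ-unit : ∀ N → Unit (Ψ N)
  Ψ-unit = <-rec (λ N → Unit (Ψ N)) step
    where
    step : ∀ N → (∀ {d} → d < N → Unit (Ψ d)) → Unit (Ψ N)
    step zero    IH = subst Unit (sym Ψ-zero) Unit-one
    step (suc n) IH = subst Unit (sym (Ψ-step∙ n))
      (Unit-∙ (xpow-1-Unit (suc n) (s≤s z≤n)) (Unit-inv (Unit-≈ (≈-sym (Ψ-prod n))
        (∏-Unit (suc n) _ (λ i i<n → Unit-when (i ∣? suc n) (λ _ → IH i<n))))))

  Ψ∣-Unit : ∀ N d → Unit (Ψ∣ N d)
  Ψ∣-Unit N d = Unit-when (d ∣? N) (λ _ → Ψ-unit d)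

  Ψ-∏ : ∀ n → Ψ (suc n) ≈ xpow-1 (suc n) ∙ inv (∏ (suc n) (Ψ∣ (suc n)))
  Ψ-∏ n = subst (_≈ xpow-1 (suc n) ∙ inv (∏ (suc n) (Ψ∣ (suc n)))) (sym (Ψ-step∙ n))
    (∙-cong ≈-refl (inv-cong (Unit-≈ (≈-sym (Ψ-prod n)) (∏-Unit (suc n) _ (λ i _ → Ψ∣-Unit (suc n) i))) (Ψ-prod n)))

  -- The cofactor of Φ_N in x^N - 1 (`properΨ∙Ψ`).
  properΨ : ℕ → Series
  properΨ N = ∏ N (Ψ∣ N)

  properΨ-Unit : ∀ N → Unit (properΨ N)
  properΨ-Unit N = ∏-Unit N _ (λ i _ → Ψ∣-Unit N i)

  properΨ∙Ψ : ∀ N → 1 ≤ N → properΨ N ∙ Ψ N ≈ xpow-1 N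
  properΨ∙Ψ (suc n) _ = begin
    P ∙ Ψ (suc n)            ≈⟨ ∙-cong ≈-refl (Ψ-∏ n) ⟩
    P ∙ (X ∙ inv P)          ≈⟨ ≈-trans (≈-sym (∙-assoc P X (inv P))) (≈-trans (∙-cong (∙-comm P X) ≈-refl) (∙-assoc X P (inv P))) ⟩
    X ∙ (P ∙ inv P)          ≈⟨ ∙-cong ≈-refl (∙-inv (properΨ-Unit (suc n))) ⟩
    X ∙ one                  ≈⟨ ∙-identityʳ X ⟩
    X ∎
    where
    P = properΨ (suc n)
    X = xpow-1 (suc n)

  ∏Ψ : ∀ N → 1 ≤ N → ∏ (suc N) (Ψ∣ N) ≈ xpow-1 N
  ∏Ψ N 1≤N = ≈-trans (∏-snoc N (Ψ∣ N)) (≈-trans (∙-cong ≈-refl (when-yes (N ∣? N) (Ψ N) ∣-refl)) (properΨ∙Ψ N 1≤N))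

  xpow-1-top : ∀ N → 1 ≤ N → xpow-1 N N ≡ + 1
  xpow-1-top (suc n) _ with suc n ℕ.≟ suc n
  ... | yes _ = refl
  ... | no ¬e = contradiction refl ¬e

  xpow-1-mid : ∀ N k → k ≢ 0 → k ≢ N → xpow-1 N k ≡ + 0
  xpow-1-mid N k k≢0 k≢N with k ℕ.≟ 0 | k ℕ.≟ N
  ... | yes e | _     = contradiction e k≢0
  ... | no _  | yes e = contradiction e k≢N
  ... | no _  | no _  = refl

  xpow-1-0 : ∀ N → 1 ≤ N → xpow-1 N 0 ≡ - (+ 1)
  xpow-1-0 (suc N) _ = refl

  dil-xpow-1 : ∀ p n → 1 ≤ p → 1 ≤ n → dil p (xpow-1 n) ≈ xpow-1 (n ℕ.* p)
  dil-xpow-1 p n 1≤p 1≤n = pointwise λ k → go k (p ∣? k)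
    where
    np : 1 ≤ n ℕ.* p
    np = ℕₚ.*-mono-≤ 1≤n 1≤p
    go : ∀ k → Dec (p ∣ k) → dil p (xpow-1 n) k ≡ xpow-1 (n ℕ.* p) k
    go k (no p∤k) = trans (dil-∤ p _ k p∤k) (sym (xpow-1-mid (n ℕ.* p) k
      (λ { refl → p∤k (p ∣0) }) (λ { refl → p∤k (divides-refl n) })))
    go k (yes (divides-refl zero)) = trans (dil-* p _ 0 1≤p) (trans (xpow-1-0 n 1≤n) (sym (xpow-1-0 (n ℕ.* p) np)))
    go k (yes (divides-refl (suc q))) with suc q ℕ.≟ n
    ... | yes refl = trans (dil-* p _ n 1≤p) (trans (xpow-1-top n 1≤n) (sym (xpow-1-top (n ℕ.* p) np)))
    ... | no q≢n = trans (dil-* p _ (suc q) 1≤p) (trans (xpow-1-mid n (suc q) (λ ()) q≢n)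
          (sym (xpow-1-mid (n ℕ.* p) (suc q ℕ.* p) (ℕₚ.m<n⇒n≢0 (ℕₚ.*-mono-≤ {1} {suc q} (s≤s z≤n) 1≤p)) (λ e → q≢n (ℕₚ.*-cancelʳ-≡ (suc q) n p {{ℕ.>-nonZero 1≤p}} e)))))

  -- The expected form of Φ_d(x^p) for a prime p, confirmed in `Ψ^-dil`.
  Ψ^ : ℕ → ℕ → Series
  Ψ^ p d = Ψ (d ℕ.* p) ∙ unless (p ∣? d) (Ψ d)

  module _ {p : ℕ} (pr : Prime p) where
    private
      1≤p = ℕₚ.<⇒≤ (prime>1 pr)

    -- A divisor of n p is either d p with d ∣ n, or a divisor of n prime to p.
    ∏-Ψ^ : ∀ n → 1 ≤ n → ∏ (suc n) (λ d → when (d ∣? n) (Ψ^ p d)) ≈ xpow-1 (n ℕ.* p)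
    ∏-Ψ^ n 1≤n = ≈-sym (begin
      xpow-1 np
        ≈⟨ ≈-sym (∏Ψ np 1≤np) ⟩
      ∏ (suc np) (Ψ∣ np)
        -- The range is lengthened from n p + 1 to (n + 1) p, so that it consists of full blocks of
        -- length p; indices above n p do not divide n p and add only factors `one`.
        ≈⟨ ≈-sym (∏-extend (Ψ∣ np) (ℕₚ.+-monoˡ-≤ np 1≤p) (λ i np<i → when-no (i ∣? np) (Ψ i) (big 1≤np np<i))) ⟩
      ∏ (suc n ℕ.* p) (Ψ∣ np)
        ≈⟨ ∏-cong (suc n ℕ.* p) (λ i _ → when-unless (p ∣? i) (Ψ∣ np i)) ⟩
      ∏ (suc n ℕ.* p) (λ i → h₁ i ∙ h₂ i)
        ≈⟨ ∏-∙ (suc n ℕ.* p) h₁ h₂ ⟩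
      ∏ (suc n ℕ.* p) h₁ ∙ ∏ (suc n ℕ.* p) h₂
        ≈⟨ ∙-cong left right ⟩
      ∏ (suc n) (λ d → when (d ∣? n) (Ψ (d ℕ.* p))) ∙ ∏ (suc n) (λ d → when (d ∣? n) (unless (p ∣? d) (Ψ d)))
        ≈⟨ ≈-sym (∏-∙ (suc n) _ _) ⟩
      ∏ (suc n) (λ d → when (d ∣? n) (Ψ (d ℕ.* p)) ∙ when (d ∣? n) (unless (p ∣? d) (Ψ d)))
        ≈⟨ ∏-cong (suc n) (λ d _ → when-∙ (d ∣? n) _ _) ⟩
      ∏ (suc n) (λ d → when (d ∣? n) (Ψ^ p d)) ∎)
      where
      np = n ℕ.* p
      1≤np : 1 ≤ np
      1≤np = ℕₚ.*-mono-≤ 1≤n 1≤p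
      big : ∀ {a i} → 1 ≤ a → a < i → i ∤ a
      big {a} 1≤a a<i = >⇒∤ {{ℕ.>-nonZero 1≤a}} a<i
      h₁ h₂ : ℕ → Series
      h₁ i = when (p ∣? i) (Ψ∣ np i)
      h₂ i = unless (p ∣? i) (Ψ∣ np i)
      left : ∏ (suc n ℕ.* p) h₁ ≈ ∏ (suc n) (λ d → when (d ∣? n) (Ψ (d ℕ.* p)))
      left = ≈-trans (∏-multiples p (suc n) h₁ 1≤p (λ e p∤e → when-no (p ∣? e) _ p∤e))
        (∏-cong (suc n) (λ d _ → ≈-trans (when-yes (p ∣? (d ℕ.* p)) _ (divides-refl d))
          (when-⇔ (d ℕ.* p ∣? np) (d ∣? n) _ (*-cancelʳ-∣ p {{ℕ.>-nonZero 1≤p}}) (*-monoˡ-∣ p))))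
      h₂≈ : ∀ i → h₂ i ≈ when (i ∣? n) (unless (p ∣? i) (Ψ i))
      h₂≈ i with p ∣? i
      ... | yes _ = ≈-sym (lem (i ∣? n))
        where
        lem : ∀ {P : Set} (d : Dec P) → when d one ≈ one
        lem (yes _) = ≈-refl
        lem (no _) = ≈-refl
      ... | no p∤i = when-⇔ (i ∣? np) (i ∣? n) (Ψ i)
          (λ i∣np → coprime-divisor (prime-∤⇒coprime pr p∤i) (subst (i ∣_) (ℕₚ.*-comm n p) i∣np)) (∣m⇒∣m*n p)
      right : ∏ (suc n ℕ.* p) h₂ ≈ ∏ (suc n) (λ d → when (d ∣? n) (unless (p ∣? d) (Ψ d)))
      right = ≈-trans (∏-cong (suc n ℕ.* p) (λ i _ → h₂≈ i))
        (∏-extend _ (ℕₚ.m≤m*n (suc n) p {{ℕ.>-nonZero 1≤p}}) (λ i n<i → when-no (i ∣? n) _ (big 1≤n n<i)))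

    -- Over the divisors of n both families multiply to x^(np) - 1: one by `∏-Ψ^`, the other by
    -- dilating `∏Ψ`. Strong induction identifies the factors at proper divisors, and cancelling
    -- these units leaves the factors at n; this takes the place of Möbius inversion.
    Ψ^-dil : ∀ n → 1 ≤ n → Ψ^ p n ≈ dil p (Ψ n)
    Ψ^-dil = <-rec (λ n → 1 ≤ n → Ψ^ p n ≈ dil p (Ψ n)) step
      where
      step : ∀ n → (∀ {d} → d < n → 1 ≤ d → Ψ^ p d ≈ dil p (Ψ d)) → 1 ≤ n → Ψ^ p n ≈ dil p (Ψ n)
      step n IH 1≤n = ∙-cancelˡ {∏ n D} (∏-Unit n D (λ i _ → Unit-when (i ∣? n) (λ _ → Unit-dil p 1≤p (Ψ-unit i)))) (begin
        ∏ n D ∙ Ψ^ p n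
          ≈⟨ ∙-cong (∏-cong n (λ i i<n → when-cong (i ∣? n) (λ i∣n → ≈-sym (IH i<n (pos i i∣n))))) (≈-sym (when-yes (n ∣? n) _ ∣-refl)) ⟩
        ∏ n Q ∙ Q n
          ≈⟨ ≈-sym (∏-snoc n Q) ⟩
        ∏ (suc n) Q
          ≈⟨ ∏-Ψ^ n 1≤n ⟩
        xpow-1 (n ℕ.* p)
          ≈⟨ ≈-sym (dil-xpow-1 p n 1≤p 1≤n) ⟩
        dil p (xpow-1 n)
          ≈⟨ dil-cong p (≈-sym (∏Ψ n 1≤n)) ⟩
        dil p (∏ (suc n) (Ψ∣ n))
          ≈⟨ dil-∏ p (suc n) (Ψ∣ n) 1≤p ⟩
        ∏ (suc n) (λ i → dil p (Ψ∣ n i))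
          ≈⟨ ∏-cong (suc n) (λ i _ → dil-when (i ∣? n) p (Ψ i) 1≤p) ⟩
        ∏ (suc n) D
          ≈⟨ ∏-snoc n D ⟩
        ∏ n D ∙ D n
          ≈⟨ ∙-cong ≈-refl (when-yes (n ∣? n) _ ∣-refl) ⟩
        ∏ n D ∙ dil p (Ψ n) ∎)
        where
        D Q : ℕ → Series
        D i = when (i ∣? n) (dil p (Ψ i))
        Q i = when (i ∣? n) (Ψ^ p i)
        pos : ∀ i → i ∣ n → 1 ≤ i
        pos (suc i) _ = s≤s z≤n
        pos zero 0∣n = contradiction (0∣⇒≡0 0∣n) (ℕₚ.m<n⇒n≢0 1≤n)

    Ψ-∣ : ∀ n → 1 ≤ n → p ∣ n → Ψ (n ℕ.* p) ≈ dil p (Ψ n)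
    Ψ-∣ n 1≤n p∣n with p ∣? n | Ψ^-dil n 1≤n
    ... | yes _ | e = ≈-trans (≈-sym (∙-identityʳ _)) e
    ... | no p∤n | _ = contradiction p∣n p∤n

    Ψ-∤ : ∀ n → 1 ≤ n → p ∤ n → Ψ (n ℕ.* p) ∙ Ψ n ≈ dil p (Ψ n)
    Ψ-∤ n 1≤n p∤n with p ∣? n | Ψ^-dil n 1≤n
    ... | yes p∣n | _ = contradiction p∣n p∤n
    ... | no _ | e = e

-- Cyclotomic series are polynomials

module Polynomiality where

  open import Defs
  open SeriesRing
  open Cyclotomic
  open import Data.Nat as ℕ using (ℕ; zero; suc; _<_; _≤_; z≤n; s≤s)
  import Data.Nat.Properties as ℕₚ
  open import Data.Nat.Divisibility
  open import Data.Nat.Induction using (<-rec)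
  open import Data.Nat.GCD using (gcd; gcd-GCD; gcd[m,n]∣m; gcd[m,n]∣n; module Bézout)
  open import Data.Integer using (ℤ; +_; -_; _+_; _*_)
  import Data.Integer.Properties as ℤₚ
  open import Data.Integer.Tactic.RingSolver using (solve-∀)
  open import Data.Product using (_×_; _,_; ∃-syntax)
  open import Data.Sum using ([_,_]′)
  open import Function using (_∘_)
  open import Relation.Nullary using (yes; no; Dec; contradiction)
  open import Relation.Binary.PropositionalEquality

  open SeriesSolver using (solve; _:*_; _:+_; :-_; _:=_)
  open ≈-R

  ⊕-cong : ∀ {f f′ g g′} → f ≈ f′ → g ≈ g′ → f ⊕ g ≈ f′ ⊕ g′
  ⊕-cong e e′ = pointwise λ k → cong₂ _+_ (at e k) (at e′ k)

  ⊖-cong : ∀ {f f′} → f ≈ f′ → ⊖ f ≈ ⊖ f′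
  ⊖-cong e = pointwise λ k → cong -_ (at e k)

  ZeroFrom : ℕ → Series → Set
  ZeroFrom n f = ∀ k → n ≤ k → f k ≡ + 0

  Poly : Series → Set
  Poly f = ∃[ n ] ZeroFrom n f

  ZeroFrom-∙ : ∀ a b {f g} → ZeroFrom a f → ZeroFrom b g → ZeroFrom (a ℕ.+ b) (f ∙ g)
  ZeroFrom-∙ zero b {f} {g} F G k _ =
    trans (at (∙-cong {f} {nil} {g} {g} (pointwise λ i → F i z≤n) ≈-refl) k) (at (nil-∙ g) k)
  ZeroFrom-∙ (suc a) b {f} {g} F G (suc k) (s≤s le) = trans (∙-suc f g k) (trans
    (cong₂ _+_ (trans (cong (f 0 *_) (G (suc k) (ℕₚ.m≤n⇒m≤1+n (ℕₚ.≤-trans (ℕₚ.m≤n+m b a) le)))) (ℤₚ.*-zeroʳ (f 0)))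
               (ZeroFrom-∙ a b {tail f} {g} (λ i a≤i → F (suc i) (s≤s a≤i)) G k le)) refl)

  Poly-≈ : ∀ {f g} → f ≈ g → Poly f → Poly g
  Poly-≈ e (n , F) = n , λ k n≤k → trans (sym (at e k)) (F k n≤k)

  Poly-∙ : ∀ {f g} → Poly f → Poly g → Poly (f ∙ g)
  Poly-∙ (a , F) (b , G) = a ℕ.+ b , ZeroFrom-∙ a b F G

  Poly-⊕ : ∀ {f g} → Poly f → Poly g → Poly (f ⊕ g)
  Poly-⊕ (a , F) (b , G) = a ℕ.+ b , λ k le → cong₂ _+_ (F k (ℕₚ.≤-trans (ℕₚ.m≤m+n a b) le)) (G k (ℕₚ.≤-trans (ℕₚ.m≤n+m b a) le))

  Poly-⊖ : ∀ {f} → Poly f → Poly (⊖ f)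
  Poly-⊖ (a , F) = a , λ k le → cong -_ (F k le)

  Poly-one : Poly one
  Poly-one = 1 , λ { (suc k) _ → refl }

  Poly-nil : Poly nil
  Poly-nil = 0 , λ _ _ → refl

  Poly-shift : ∀ p {f} → Poly f → Poly (shift p f)
  Poly-shift p {f} (a , F) = p ℕ.+ a , λ k le → go p k le
    where
    go : ∀ p k → p ℕ.+ a ≤ k → shift p f k ≡ + 0
    go zero    k       le       = F k le
    go (suc p) (suc k) (s≤s le) = go p k le

  Poly-when : {P : Set} (d : Dec P) {f : Series} → Poly f → Poly (when d f)
  Poly-when (yes _) F = F
  Poly-when (no _)  F = Poly-one

  Poly-unless : {P : Set} (d : Dec P) {f : Series} → Poly f → Poly (unless d f)
  Poly-unless (yes _) F = Poly-one
  Poly-unless (no _)  F = F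

  opaque
    unfolding ∏
    Poly-∏ : ∀ n h → (∀ i → i < n → Poly (h i)) → Poly (∏ n h)
    Poly-∏ zero    h P = Poly-one
    Poly-∏ (suc n) h P = Poly-∙ (P 0 (s≤s z≤n)) (Poly-∏ n (h ∘ suc) (λ i i<n → P (suc i) (s≤s i<n)))

  infix 8 x^_
  x^_ : ℕ → Series
  x^ n = shift n one

  Poly-x^ : ∀ n → Poly (x^ n)
  Poly-x^ n = Poly-shift n Poly-one

  x^-+ : ∀ a b → x^ a ∙ x^ b ≈ x^ (a ℕ.+ b)
  x^-+ a b = ≈-trans (shift-∙ a one (x^ b)) (≈-trans (pointwise λ k → shift-cong a k (λ j _ → at (∙-identityˡ (x^ b)) j))
    (pointwise (go a)))
    where
    go : ∀ a k → shift a (x^ b) k ≡ (x^ (a ℕ.+ b)) k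
    go zero    k       = refl
    go (suc a) zero    = refl
    go (suc a) (suc k) = go a k

  pow-1 : ℕ → Series
  pow-1 n = x^ n ⊕ ⊖ one

  shift-one-≢ : ∀ n k → k ≢ n → shift n one k ≡ + 0
  shift-one-≢ zero    zero    e = contradiction refl e
  shift-one-≢ zero    (suc k) e = refl
  shift-one-≢ (suc n) zero    e = refl
  shift-one-≢ (suc n) (suc k) e = shift-one-≢ n k (λ q → e (cong suc q))

  shift-one-≡ : ∀ n → shift n one n ≡ + 1
  shift-one-≡ zero    = refl
  shift-one-≡ (suc n) = shift-one-≡ n

  xpow-1≈ : ∀ N → 1 ≤ N → xpow-1 N ≈ pow-1 N
  xpow-1≈ N@(suc _) 1≤N = pointwise go
    where
    go : ∀ k → xpow-1 N k ≡ (pow-1 N) k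
    go zero = refl
    go (suc k) with suc k ℕ.≟ N
    ... | yes refl = sym (trans (ℤₚ.+-identityʳ _) (shift-one-≡ (suc k)))
    ... | no ne = sym (trans (ℤₚ.+-identityʳ _) (shift-one-≢ N (suc k) ne))

  geo : ℕ → ℕ → Series
  geo g zero    = nil
  geo g (suc n) = geo g n ⊕ x^ (n ℕ.* g)

  Poly-geo : ∀ g n → Poly (geo g n)
  Poly-geo g zero    = Poly-nil
  Poly-geo g (suc n) = Poly-⊕ (Poly-geo g n) (Poly-x^ (n ℕ.* g))

  geo-sum : ∀ g n → pow-1 (n ℕ.* g) ≈ pow-1 g ∙ geo g n
  geo-sum g zero = ≈-trans (pointwise λ k → ℤₚ.+-inverseʳ (one k)) (≈-sym (≈-trans (∙-comm _ nil) (nil-∙ _)))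
  geo-sum g (suc n) = begin
    x^ (g ℕ.+ n ℕ.* g) ⊕ ⊖ one             ≈⟨ ⊕-cong (≈-sym (x^-+ g (n ℕ.* g))) (≈-refl {⊖ one}) ⟩
    x^ g ∙ x^ (n ℕ.* g) ⊕ ⊖ one            ≈⟨ lem (x^ g) (x^ (n ℕ.* g)) one ⟩
    (x^ (n ℕ.* g) ⊕ ⊖ one) ⊕ (x^ g ∙ x^ (n ℕ.* g) ⊕ ⊖ (x^ (n ℕ.* g)))
      ≈⟨ ⊕-cong (geo-sum g n) (⊕-cong (≈-refl {x^ g ∙ x^ (n ℕ.* g)}) (⊖-cong (≈-sym (∙-identityˡ (x^ (n ℕ.* g)))))) ⟩
    (pow-1 g ∙ geo g n) ⊕ (x^ g ∙ x^ (n ℕ.* g) ⊕ ⊖ (one ∙ x^ (n ℕ.* g)))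
      ≈⟨ lem2 (x^ g) one (geo g n) (x^ (n ℕ.* g)) ⟩
    pow-1 g ∙ (geo g n ⊕ x^ (n ℕ.* g)) ∎
    where
    lemℤ : ∀ c b o → c + - o ≡ (b + - o) + (c + - b)
    lemℤ = solve-∀
    lem : ∀ a b o → a ∙ b ⊕ ⊖ o ≈ (b ⊕ ⊖ o) ⊕ (a ∙ b ⊕ ⊖ b)
    lem a b o = pointwise λ k → lemℤ ((a ∙ b) k) (b k) (o k)
    lem2 : ∀ a o q b → ((a ⊕ ⊖ o) ∙ q) ⊕ (a ∙ b ⊕ ⊖ (o ∙ b)) ≈ (a ⊕ ⊖ o) ∙ (q ⊕ b)
    lem2 = solve 4 (λ a o q b → ((a :+ :- o) :* q) :+ (a :* b :+ :- (o :* b)) := (a :+ :- o) :* (q :+ b)) ≈-refl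

  -- (y^n − 1)/(y − 1) ≡ n modulo y − 1, with y = x^g.
  geo-mod : ∀ g n → ∃[ T ] Poly T × (geo g n ≈ const (+ n) ⊕ pow-1 g ∙ T)
  geo-mod g zero = nil , Poly-nil , pointwise λ
    { zero → sym (at (≈-trans (∙-comm (pow-1 g) nil) (nil-∙ _)) 0 ∙≡)
    ; (suc k) → sym (at (≈-trans (∙-comm (pow-1 g) nil) (nil-∙ _)) (suc k) ∙≡) }
    where
    _∙≡ : ∀ {z : ℤ} → z ≡ + 0 → + 0 + z ≡ + 0
    refl ∙≡ = refl
  geo-mod g (suc n) with geo-mod g n
  ... | T , PT , e = T ⊕ geo g n , Poly-⊕ PT (Poly-geo g n) , (begin
    geo g n ⊕ x^ (n ℕ.* g)
      ≈⟨ ⊕-cong e (≈-trans (pointwise λ k → lem1 ((x^ (n ℕ.* g)) k) (one k)) (⊕-cong (≈-refl {one}) (geo-sum g n))) ⟩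
    (const (+ n) ⊕ pow-1 g ∙ T) ⊕ (one ⊕ pow-1 g ∙ geo g n)
      ≈⟨ lem (const (+ n)) one (pow-1 g) T (geo g n) ⟩
    (const (+ n) ⊕ one) ⊕ pow-1 g ∙ (T ⊕ geo g n)
      ≈⟨ ⊕-cong const-suc (≈-refl {pow-1 g ∙ (T ⊕ geo g n)}) ⟩
    const (+ suc n) ⊕ pow-1 g ∙ (T ⊕ geo g n) ∎)
    where
    const-suc : const (+ n) ⊕ one ≈ const (+ suc n)
    const-suc = pointwise λ { zero → cong +_ (ℕₚ.+-comm n 1) ; (suc k) → refl }
    lem1 : ∀ a o → a ≡ o + (a + - o)
    lem1 a o = sym (trans (ℤₚ.+-comm o _) (trans (ℤₚ.+-assoc a (- o) o) (trans (cong (λ z → a + z) (ℤₚ.+-inverseˡ o)) (ℤₚ.+-identityʳ a))))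
    lem : ∀ c o y T q → (c ⊕ y ∙ T) ⊕ (o ⊕ y ∙ q) ≈ (c ⊕ o) ⊕ y ∙ (T ⊕ q)
    lem = solve 5 (λ c o y T q → (c :+ y :* T) :+ (o :+ y :* q) := (c :+ o) :+ y :* (T :+ q)) ≈-refl

  -- A Bézout identity over the rationals with denominators cleared. The constant 1 cannot be
  -- expected: Φ_1 and Φ_p lead to p. A nonzero integer is enough, since `Poly-scale⁻¹` cancels it.
  record Comaximal (U V : Series) : Set where
    constructor comax
    field
      {α β}  : Series
      {n}    : ℤ
      polyα  : Poly α
      polyβ  : Poly β
      n≢0    : n ≢ + 0
      bezout : α ∙ U ⊕ β ∙ V ≈ const n

  Comaximal-sym : ∀ {U V} → Comaximal U V → Comaximal V U
  Comaximal-sym {U} {V} (comax {α} {β} pa pb n e) = comax pb pa n (≈-trans (pointwise λ k → ℤₚ.+-comm ((β ∙ V) k) ((α ∙ U) k)) e)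

  Comaximal-one : ∀ {U} → Comaximal U one
  Comaximal-one {U} = comax {α = nil} {β = one} {n = + 1} Poly-nil Poly-one (λ ())
    (≈-trans (⊕-cong (nil-∙ U) (∙-identityˡ one)) (≈-trans (pointwise λ k → ℤₚ.+-identityˡ _) one≈const1))

  -- The product of the two Bézout identities: every term except b b′ V W contains U.
  Comaximal-∙ : ∀ {U V W} → Poly U → Poly V → Poly W → Comaximal U V → Comaximal U W → Comaximal U (V ∙ W)
  Comaximal-∙ {U} {V} {W} PU PV PW (comax {a} {b} {m} pa pb m≢0 e) (comax {a′} {b′} {n} pa′ pb′ n≢0 e′) =
    comax {α = (a ∙ a′ ∙ U ⊕ a ∙ b′ ∙ W) ⊕ b ∙ a′ ∙ V} {β = b ∙ b′} {n = m * n}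
      (Poly-⊕ (Poly-⊕ (Poly-∙ (Poly-∙ pa pa′) PU) (Poly-∙ (Poly-∙ pa pb′) PW)) (Poly-∙ (Poly-∙ pb pa′) PV))
      (Poly-∙ pb pb′)
      (λ z → [ m≢0 , n≢0 ]′ (ℤₚ.i*j≡0⇒i≡0∨j≡0 m z))
      (≈-trans (lem a b a′ b′ U V W) (≈-trans (∙-cong e e′) (≈-trans (const-∙ m (const n))
        (pointwise λ { zero → refl ; (suc k) → ℤₚ.*-zeroʳ m }))))
    where
    lem : ∀ a b a′ b′ U V W → ((a ∙ a′ ∙ U ⊕ a ∙ b′ ∙ W) ⊕ b ∙ a′ ∙ V) ∙ U ⊕ b ∙ b′ ∙ (V ∙ W) ≈ (a ∙ U ⊕ b ∙ V) ∙ (a′ ∙ U ⊕ b′ ∙ W)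
    lem = solve 7 (λ a b a′ b′ U V W → ((a :* a′ :* U :+ a :* b′ :* W) :+ b :* a′ :* V) :* U :+ b :* b′ :* (V :* W) := (a :* U :+ b :* V) :* (a′ :* U :+ b′ :* W)) ≈-refl

  opaque
    unfolding ∏
    Comaximal-∏ : ∀ {U} n h → Poly U → (∀ i → i < n → Poly (h i)) → (∀ i → i < n → Comaximal U (h i)) → Comaximal U (∏ n h)
    Comaximal-∏ zero    h PU P C = Comaximal-one
    Comaximal-∏ (suc n) h PU P C = Comaximal-∙ PU (P 0 (s≤s z≤n)) (Poly-∏ n (h ∘ suc) (λ i i<n → P (suc i) (s≤s i<n)))
      (C 0 (s≤s z≤n)) (Comaximal-∏ n (h ∘ suc) PU (λ i i<n → P (suc i) (s≤s i<n)) (λ i i<n → C (suc i) (s≤s i<n)))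

  Poly-scale⁻¹ : ∀ {n f} → n ≢ + 0 → Poly (const n ∙ f) → Poly f
  Poly-scale⁻¹ {n} {f} n≢0 (a , F) = a , λ k le →
    [ (λ n≡0 → contradiction n≡0 n≢0) , (λ e → e) ]′ (ℤₚ.i*j≡0⇒i≡0∨j≡0 n (trans (sym (at (const-∙ n f) k)) (F k le)))

  -- Multiplying α U + β V = n by W/(UV) gives α W/V + β W/U = n W/(UV). The left side is a
  -- polynomial, and W/(UV) is already a series over the integers, so n can be cancelled.
  Comaximal-divides : ∀ {U V} W → Unit U → Unit V → Comaximal U V →
                      Poly (W ∙ inv U) → Poly (W ∙ inv V) → Poly (W ∙ inv (U ∙ V))
  Comaximal-divides {U} {V} W u v (comax {a} {b} {n} pa pb n≢0 e) PU PV = Poly-scale⁻¹ n≢0 (Poly-≈ eq (Poly-⊕ (Poly-∙ pa PV) (Poly-∙ pb PU)))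
    where
    lem2 : ∀ a b W U V iu iv → a ∙ (U ∙ iu) ∙ (W ∙ iv) ⊕ b ∙ (V ∙ iv) ∙ (W ∙ iu) ≈ (a ∙ U ⊕ b ∙ V) ∙ (W ∙ (iu ∙ iv))
    lem2 = solve 7 (λ a b W U V iu iv → a :* (U :* iu) :* (W :* iv) :+ b :* (V :* iv) :* (W :* iu) := (a :* U :+ b :* V) :* (W :* (iu :* iv))) ≈-refl
    eq : a ∙ (W ∙ inv V) ⊕ b ∙ (W ∙ inv U) ≈ const n ∙ (W ∙ inv (U ∙ V))
    eq = begin
      a ∙ (W ∙ inv V) ⊕ b ∙ (W ∙ inv U)
        ≈⟨ ⊕-cong (∙-cong (≈-trans (≈-sym (∙-identityʳ a)) (∙-cong ≈-refl (≈-sym (∙-inv u)))) ≈-refl)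
                  (∙-cong (≈-trans (≈-sym (∙-identityʳ b)) (∙-cong ≈-refl (≈-sym (∙-inv v)))) ≈-refl) ⟩
      a ∙ (U ∙ inv U) ∙ (W ∙ inv V) ⊕ b ∙ (V ∙ inv V) ∙ (W ∙ inv U)
        ≈⟨ lem2 a b W U V (inv U) (inv V) ⟩
      (a ∙ U ⊕ b ∙ V) ∙ (W ∙ (inv U ∙ inv V))
        ≈⟨ ∙-cong e (∙-cong ≈-refl (≈-sym (inv-∙ u v))) ⟩
      const n ∙ (W ∙ inv (U ∙ V)) ∎

  ∣⇒1≤ : ∀ {d n} → 1 ≤ n → d ∣ n → 1 ≤ d
  ∣⇒1≤ {zero}  1≤n 0∣n = contradiction (0∣⇒≡0 0∣n) (ℕₚ.m<n⇒n≢0 1≤n)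
  ∣⇒1≤ {suc d} _   _   = s≤s z≤n

  Poly-properΨ : ∀ e → (∀ i → i < e → Poly (Ψ i)) → Poly (properΨ e)
  Poly-properΨ e P = Poly-∏ e _ (λ i i<e → Poly-when (i ∣? e) (P i i<e))

  x^*-1-Ψ : ∀ d a → 1 ≤ d → (properΨ d ∙ geo d a) ∙ Ψ d ≈ pow-1 (a ℕ.* d)
  x^*-1-Ψ d a 1≤d = ≈-trans (lem (properΨ d) (geo d a) (Ψ d)) (≈-trans (∙-cong (≈-trans (properΨ∙Ψ d 1≤d) (xpow-1≈ d 1≤d)) ≈-refl)
    (≈-sym (geo-sum d a)))
    where
    lem : ∀ p q r → (p ∙ q) ∙ r ≈ (p ∙ r) ∙ q
    lem = solve 3 (λ p q r → (p :* q) :* r := (p :* r) :* q) ≈-refl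

  module _ {d e : ℕ} (1≤d : 1 ≤ d) (d<e : d < e) (P : ∀ i → i ≤ e → Poly (Ψ i)) where
    private
      g = gcd d e
      g∣d = gcd[m,n]∣m d e
      g∣e = gcd[m,n]∣n d e
      1≤e : 1 ≤ e
      1≤e = ℕₚ.≤-trans 1≤d (ℕₚ.<⇒≤ d<e)
      1≤g : 1 ≤ g
      1≤g = ∣⇒1≤ 1≤d g∣d
      g<e : g < e
      g<e = ℕₚ.≤-<-trans (∣⇒≤ {{ℕ.>-nonZero 1≤d}} g∣d) d<e
      R : Series
      R = ∏ e (λ i → unless (i ∣? g) (Ψ∣ e i))
      PR : Poly R
      PR = Poly-∏ e _ (λ i i<e → Poly-unless (i ∣? g) (Poly-when (i ∣? e) (P i (ℕₚ.<⇒≤ i<e))))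
      Pd = Poly-properΨ d (λ i i<d → P i (ℕₚ.≤-trans (ℕₚ.<⇒≤ i<d) (ℕₚ.<⇒≤ d<e)))
      Pe = Poly-properΨ e (λ i i<e → P i (ℕₚ.<⇒≤ i<e))

      -- As g divides e and g < e, all divisors of g are proper divisors of e; their factors
      -- multiply to x^g - 1.
      properΨ-split : properΨ e ≈ xpow-1 g ∙ R
      properΨ-split = begin
        properΨ e
          ≈⟨ ∏-cong e (λ i _ → when-unless (i ∣? g) (Ψ∣ e i)) ⟩
        ∏ e (λ i → when (i ∣? g) (Ψ∣ e i) ∙ unless (i ∣? g) (Ψ∣ e i))
          ≈⟨ ∏-∙ e _ _ ⟩
        ∏ e (λ i → when (i ∣? g) (Ψ∣ e i)) ∙ R
          ≈⟨ ∙-cong (∏-cong e (λ i _ → when-cong (i ∣? g) (λ i∣g → when-yes (i ∣? e) (Ψ i) (∣-trans i∣g g∣e)))) ≈-refl ⟩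
        ∏ e (Ψ∣ g) ∙ R
          ≈⟨ ∙-cong (∏-extend (Ψ∣ g) g<e (λ i g<i → when-no (i ∣? g) (Ψ i) (>⇒∤ {{ℕ.>-nonZero 1≤g}} g<i))) ≈-refl ⟩
        ∏ (suc g) (Ψ∣ g) ∙ R
          ≈⟨ ∙-cong (∏Ψ g 1≤g) ≈-refl ⟩
        xpow-1 g ∙ R ∎

      n = quotient g∣e
      e≡ : e ≡ n ℕ.* g
      e≡ = _∣_.equality g∣e
      R∙Ψ : R ∙ Ψ e ≈ geo g n
      R∙Ψ = ∙-cancelˡ (xpow-1-Unit g 1≤g) (begin
        xpow-1 g ∙ (R ∙ Ψ e)    ≈⟨ ≈-sym (∙-assoc _ R (Ψ e)) ⟩
        (xpow-1 g ∙ R) ∙ Ψ e    ≈⟨ ∙-cong (≈-sym properΨ-split) ≈-refl ⟩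
        properΨ e ∙ Ψ e         ≈⟨ properΨ∙Ψ e 1≤e ⟩
        xpow-1 e                ≈⟨ xpow-1≈ e 1≤e ⟩
        pow-1 e                 ≈⟨ subst (λ t → pow-1 e ≈ pow-1 t) e≡ ≈-refl ⟩
        pow-1 (n ℕ.* g)         ≈⟨ geo-sum g n ⟩
        pow-1 g ∙ geo g n       ≈⟨ ∙-cong (≈-sym (xpow-1≈ g 1≤g)) ≈-refl ⟩
        xpow-1 g ∙ geo g n      ∎)

      comb : ∀ a b → g ℕ.+ b ≡ a → pow-1 a ⊕ ⊖ (x^ g) ∙ (pow-1 b) ≈ pow-1 g
      comb a b refl = ≈-trans (⊕-cong (⊕-cong (≈-sym (x^-+ g b)) (≈-refl {⊖ one})) (≈-refl {⊖ (x^ g) ∙ pow-1 b}))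
         (≈-trans (lem (x^ g) (x^ b) one) (⊕-cong (∙-identityʳ (x^ g)) (≈-refl {⊖ one})))
        where
        lem₁ : ∀ p q o → ⊖ p ∙ (q ⊕ ⊖ o) ≈ ⊖ (p ∙ q) ⊕ p ∙ o
        lem₁ = solve 3 (λ p q o → :- p :* (q :+ :- o) := :- (p :* q) :+ p :* o) ≈-refl
        lemℤ : ∀ c o d → (c + - o) + (- c + d) ≡ d + - o
        lemℤ = solve-∀
        lem : ∀ p q o → (p ∙ q ⊕ ⊖ o) ⊕ ⊖ p ∙ (q ⊕ ⊖ o) ≈ p ∙ o ⊕ ⊖ o
        lem p q o = ≈-trans (⊕-cong (≈-refl {p ∙ q ⊕ ⊖ o}) (lem₁ p q o)) (pointwise λ k → lemℤ ((p ∙ q) k) (o k) ((p ∙ o) k))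

      -- Φ_d divides x^(ud) - 1 and Φ_e divides x^(ve) - 1 for all u and v. Bézout makes two such
      -- exponents a and b differ by g = a - b, and (x^a - 1) - x^g (x^b - 1) = x^g - 1.
      x^g-1 : ∃[ A ] ∃[ B ] Poly A × Poly B × (A ∙ Ψ d ⊕ B ∙ Ψ e ≈ pow-1 g)
      x^g-1 with Bézout.identity (gcd-GCD d e)
      ... | Bézout.+- x y eq = properΨ d ∙ geo d x , ⊖ (x^ g) ∙ (properΨ e ∙ geo e y)
            , Poly-∙ Pd (Poly-geo d x) , Poly-∙ (Poly-⊖ (Poly-x^ g)) (Poly-∙ Pe (Poly-geo e y))
            , ≈-trans (⊕-cong (x^*-1-Ψ d x 1≤d) (≈-trans (∙-assoc _ _ _) (∙-cong ≈-refl (x^*-1-Ψ e y 1≤e))))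
                (comb (x ℕ.* d) (y ℕ.* e) eq)
      ... | Bézout.-+ x y eq = ⊖ (x^ g) ∙ (properΨ d ∙ geo d x) , properΨ e ∙ geo e y
            , Poly-∙ (Poly-⊖ (Poly-x^ g)) (Poly-∙ Pd (Poly-geo d x)) , Poly-∙ Pe (Poly-geo e y)
            , ≈-trans (⊕-cong (≈-trans (∙-assoc _ _ _) (∙-cong ≈-refl (x^*-1-Ψ d x 1≤d))) (x^*-1-Ψ e y 1≤e))
                (≈-trans (pointwise λ k → ℤₚ.+-comm ((⊖ (x^ g) ∙ (pow-1 (x ℕ.* d))) k) ((pow-1 (y ℕ.* e)) k)) (comb (y ℕ.* e) (x ℕ.* d) eq))

    -- R Φ_e = (x^e - 1)/(x^g - 1) is congruent to n = e/g modulo x^g - 1, and x^g - 1 is itself a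
    -- combination of Φ_d and Φ_e. Subtracting T times that combination leaves the integer n.
    Comaximal-Ψ : Comaximal (Ψ d) (Ψ e)
    Comaximal-Ψ with x^g-1 | geo-mod g n
    ... | A , B , PA , PB , eq | T , PT , eqT = comax {α = ⊖ T ∙ A} {β = R ⊕ ⊖ T ∙ B} {n = + n}
      (Poly-∙ (Poly-⊖ PT) PA) (Poly-⊕ PR (Poly-∙ (Poly-⊖ PT) PB))
      (λ n≡0 → ℕₚ.m<n⇒n≢0 1≤e (trans e≡ (cong (ℕ._* g) (ℤₚ.+-injective n≡0))))
      (begin
        (⊖ T ∙ A) ∙ Ψ d ⊕ (R ⊕ ⊖ T ∙ B) ∙ Ψ e
          ≈⟨ lem T A B R (Ψ d) (Ψ e) ⟩
        R ∙ Ψ e ⊕ ⊖ T ∙ (A ∙ Ψ d ⊕ B ∙ Ψ e)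
          ≈⟨ ⊕-cong (≈-trans R∙Ψ eqT) (∙-cong ≈-refl eq) ⟩
        (const (+ n) ⊕ pow-1 g ∙ T) ⊕ ⊖ T ∙ (pow-1 g)
          ≈⟨ lem2 (const (+ n)) (pow-1 g) T ⟩
        const (+ n) ∎)
      where
      lem : ∀ T A B R d e → (⊖ T ∙ A) ∙ d ⊕ (R ⊕ ⊖ T ∙ B) ∙ e ≈ R ∙ e ⊕ ⊖ T ∙ (A ∙ d ⊕ B ∙ e)
      lem = solve 6 (λ T A B R d e → (:- T :* A) :* d :+ (R :+ :- T :* B) :* e := R :* e :+ :- T :* (A :* d :+ B :* e)) ≈-refl
      lem2 : ∀ c y T → (c ⊕ y ∙ T) ⊕ ⊖ T ∙ y ≈ c
      lem2 c y T = ≈-trans (⊕-cong (≈-refl {c ⊕ y ∙ T}) (lem₁ T y)) (pointwise λ k → lemℤ (c k) ((y ∙ T) k))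
        where
        lem₁ : ∀ T y → ⊖ T ∙ y ≈ ⊖ (y ∙ T)
        lem₁ = solve 2 (λ T y → :- T :* y := :- (y :* T)) ≈-refl
        lemℤ : ∀ c d → (c + d) + - d ≡ c
        lemℤ = solve-∀

  -- x^N - 1 is divided by Φ_j for the proper divisors j of N in increasing order. Each Φ_j divides
  -- x^N - 1 alone and is comaximal with the product of the earlier ones, so by `Comaximal-divides`
  -- the quotient remains a polynomial.
  Poly-Ψ : ∀ N → Poly (Ψ N)
  Poly-Ψ = <-rec (λ N → Poly (Ψ N)) step
    where
    step : ∀ N → (∀ {d} → d < N → Poly (Ψ d)) → Poly (Ψ N)
    step zero IH = subst Poly (sym Ψ-zero) Poly-one
    step N@(suc n) IH = Poly-≈ (≈-sym (Ψ-∏ n)) (partial N ℕₚ.≤-refl)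
      where
      U : ℕ → Series
      U j = ∏ j (Ψ∣ N)
      W = xpow-1 N
      uU : ∀ j → Unit (U j)
      uU j = ∏-Unit j _ (λ i _ → Ψ∣-Unit N i)
      PΨ∣ : ∀ i → i < N → Poly (Ψ∣ N i)
      PΨ∣ i i<N = Poly-when (i ∣? N) (IH i<N)
      comaximal : ∀ j → j < N → j ∣ N → ∀ i → i < j → Comaximal (Ψ j) (Ψ∣ N i)
      comaximal j j<N j∣N i i<j with i ∣? N
      ... | no _    = Comaximal-one
      ... | yes i∣N = Comaximal-sym (Comaximal-Ψ (∣⇒1≤ (s≤s z≤n) i∣N) i<j (λ k k≤j → IH (ℕₚ.≤-<-trans k≤j j<N)))
      quot : ∀ j → j < N → j ∣ N → Poly (W ∙ inv (Ψ j))
      quot j j<N (divides q eq) = Poly-≈ (begin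
          properΨ j ∙ geo j q
            ≈⟨ ≈-sym (≈-trans (∙-cong ≈-refl (∙-inv (Ψ-unit j))) (∙-identityʳ _)) ⟩
          (properΨ j ∙ geo j q) ∙ (Ψ j ∙ inv (Ψ j))
            ≈⟨ ≈-sym (∙-assoc _ _ _) ⟩
          ((properΨ j ∙ geo j q) ∙ Ψ j) ∙ inv (Ψ j)
            ≈⟨ ∙-cong (≈-trans (x^*-1-Ψ j q (∣⇒1≤ (s≤s z≤n) (divides q eq)))
                 (subst (λ t → pow-1 t ≈ W) eq (≈-sym (xpow-1≈ N (s≤s z≤n))))) ≈-refl ⟩
          W ∙ inv (Ψ j) ∎)
        (Poly-∙ (Poly-properΨ j (λ i i<j → IH (ℕₚ.<-trans i<j j<N))) (Poly-geo j q))
      partial : ∀ j → j ≤ N → Poly (W ∙ inv (U j))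
      snoc : ∀ j → j < N → Dec (j ∣ N) → Poly (W ∙ inv (U j ∙ Ψ∣ N j))
      partial zero _ = Poly-≈ (≈-sym (≈-trans (∙-cong ≈-refl (≈-sym (inv-unique (uU 0) (≈-trans (∙-identityʳ (U 0)) (∏-ones 0 _ (λ _ ())))))) (∙-identityʳ W)))
        (Poly-≈ (≈-sym (xpow-1≈ N (s≤s z≤n))) (Poly-⊕ (Poly-x^ N) (Poly-⊖ Poly-one)))
      partial (suc j) j<N = Poly-≈ (∙-cong ≈-refl (inv-cong (Unit-∙ (uU j) (Ψ∣-Unit N j)) (≈-sym (∏-snoc j (Ψ∣ N)))))
        (snoc j j<N (j ∣? N))
      snoc j j<N (yes j∣N) = Poly-≈ (∙-cong ≈-refl (inv-cong (Unit-∙ (uU j) (Ψ-unit j)) (∙-cong ≈-refl (≈-sym (when-yes (j ∣? N) (Ψ j) j∣N)))))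
        (Comaximal-divides W (uU j) (Ψ-unit j)
          (Comaximal-sym (Comaximal-∏ j (Ψ∣ N) (IH j<N) (λ i i<j → PΨ∣ i (ℕₚ.<-trans i<j j<N)) (comaximal j j<N j∣N)))
          (partial j (ℕₚ.<⇒≤ j<N)) (quot j j<N j∣N))
      snoc j j<N (no j∤N) = Poly-≈ (∙-cong ≈-refl (inv-cong (uU j) (≈-sym (≈-trans (∙-cong ≈-refl (when-no (j ∣? N) (Ψ j) j∤N)) (∙-identityʳ (U j))))))
        (partial j (ℕₚ.<⇒≤ j<N))

-- Realising an integer as a coefficient

module Realisation where

  open import Defs
  open PrimeClusters using (prime-above; prime>1; cluster; Cluster)
  open SeriesRing
  open Polynomiality using (x^_; shift-one-≢)
  open import Data.Nat as ℕ using (ℕ; zero; suc; _<_; _≤_; z≤n; s≤s; _%_; NonZero)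
  import Data.Nat.Properties as ℕₚ
  open import Data.Nat.Divisibility
  open import Data.Nat.DivMod using (m≡m%n+[m/n]*n; m%n<n; m∣n⇒o%n%m≡o%m)
  open import Data.Nat.Primality using (Prime; prime⇒irreducible)
  import Data.Nat.Tactic.RingSolver as ℕSolver
  open import Data.Integer using (ℤ; +_; -[1+_]; -_; _+_; _*_; ∣_∣)
  import Data.Integer.Properties as ℤₚ
  open import Data.Integer.Tactic.RingSolver using (solve-∀)
  open import Data.List using (List; []; _∷_; length)
  open import Data.List.Relation.Unary.All as All using (All; []; _∷_)
  open import Data.List.Relation.Unary.AllPairs using (_∷_)
  open import Data.List.Relation.Unary.Unique.Propositional using (Unique)
  open import Data.Product using (_×_; _,_; ∃-syntax; proj₁; proj₂)
  open import Data.Sum using (_⊎_; inj₁; inj₂)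
  open import Relation.Nullary using (yes; no; Dec; contradiction)
  open import Relation.Binary.PropositionalEquality

  Sign : ℤ → Set
  Sign a = a ≡ + 1 ⊎ a ≡ - (+ 1)

  quot : ℕ → Series → Series
  quot p A = A ∙ inv (dil p A)

  chain : List ℕ → Series → Series
  chain []       A = A
  chain (p ∷ ps) A = chain ps (quot p A)

  inv-one : ∀ A → A 0 ≡ + 1 → inv A 1 ≡ - A 1
  inv-one A e = trans (inv-suc A 0) (trans (cong₂ (λ u v → - (u * v)) e (∙-zero (tail A) (inv A)))
    (cong -_ (trans (ℤₚ.*-identityˡ _) (trans (cong (A 1 *_) (trans (inv-zero A) e)) (ℤₚ.*-identityʳ (A 1))))))

  monic⇒Unit : ∀ A → A 0 ≡ + 1 → Unit A
  monic⇒Unit A e = unit (cong₂ _*_ e e)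

  -- Modulo x^(2p) the series 1/A(x^p) is 1 - `A 1` x^p, by `inv-one`; so A receives just one
  -- shifted copy of itself.
  quot-below : ∀ p A {k} → 2 ≤ p → A 0 ≡ + 1 → k < p ℕ.+ p → quot p A k ≡ A k + - A 1 * shift p A k
  quot-below p A {k} 2≤p A0 k<2p = begin
    (A ∙ inv (dil p A)) k
      ≡⟨ at (∙-cong (≈-refl {A}) (≈-sym (dil-inv p 1≤p (monic⇒Unit A A0)))) k ⟩
    (A ∙ dil p (inv A)) k
      ≡⟨ ∙-cong≤ k (λ _ _ → refl) (λ i i≤k → lem i (ℕₚ.≤-<-trans i≤k k<2p)) ⟩
    (A ∙ trunc) k
      ≡⟨ at (∙-comm A trunc) k ⟩
    (trunc ∙ A) k
      ≡⟨ at (∙-distribʳ one (scale (- A 1) (x^ p)) A) k ⟩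
    (one ∙ A) k + (scale (- A 1) (x^ p) ∙ A) k
      ≡⟨ cong₂ _+_ (at (∙-identityˡ A) k) (trans (at (scale-∙ (- A 1) (x^ p) A) k)
           (cong (- A 1 *_) (trans (at (shift-∙ p one A) k) (shift-cong p k (λ j _ → at (∙-identityˡ A) j))))) ⟩
    A k + - A 1 * shift p A k ∎
    where
    open ≡-Reasoning
    1≤p = ℕₚ.<⇒≤ 2≤p
    trunc = one ⊕ scale (- A 1) (x^ p)
    lem : ∀ i → i < p ℕ.+ p → dil p (inv A) i ≡ trunc i
    lem i i<2p with p ∣? i
    ... | no p∤i = trans (dil-∤ p (inv A) i p∤i) (sym (cong₂ _+_ (one-0 i (λ { refl → p∤i (p ∣0) }))
          (trans (cong (- A 1 *_) (shift-one-≢ p i (λ { refl → p∤i ∣-refl }))) (ℤₚ.*-zeroʳ (- A 1)))))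
      where
      one-0 : ∀ i → i ≢ 0 → one i ≡ + 0
      one-0 zero    e = contradiction refl e
      one-0 (suc i) e = refl
    ... | yes (divides-refl zero) = trans (dil-* p (inv A) 0 1≤p) (trans (trans (inv-zero A) A0)
          (sym (trans (cong (λ z → + 1 + - A 1 * z) (shift-< p one 1≤p)) (cong (λ z → + 1 + z) (ℤₚ.*-zeroʳ (- A 1))))))
    ... | yes (divides-refl (suc zero)) = trans (dil-* p (inv A) 1 1≤p) (trans (inv-one A A0) (sym (trans
          (cong₂ (λ a b → a + - A 1 * b) (one-p (1 ℕ.* p) (ℕₚ.≤-trans 1≤p (ℕₚ.≤-reflexive (sym (ℕₚ.*-identityˡ p)))))
                 (shift-+ p one 0))
          (trans (ℤₚ.+-identityˡ _) (ℤₚ.*-identityʳ (- A 1))))))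
      where
      one-p : ∀ q → 1 ≤ q → one q ≡ + 0
      one-p (suc q) _ = refl
    ... | yes (divides-refl (suc (suc q))) = contradiction i<2p (ℕₚ.≤⇒≯ (ℕₚ.+-monoʳ-≤ p (ℕₚ.m≤m+n p (q ℕ.* p))))

  quot-< : ∀ p A {k} → 2 ≤ p → A 0 ≡ + 1 → k < p → quot p A k ≡ A k
  quot-< p A {k} 2≤p A0 k<p = trans (quot-below p A 2≤p A0 (ℕₚ.<-≤-trans k<p (ℕₚ.m≤m+n p p)))
    (trans (cong (λ z → A k + - A 1 * z) (shift-< p A k<p)) (trans (cong (λ z → A k + z) (ℤₚ.*-zeroʳ (- A 1))) (ℤₚ.+-identityʳ (A k))))

  quot-0 : ∀ p A → 2 ≤ p → A 0 ≡ + 1 → quot p A 0 ≡ + 1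
  quot-0 p A 2≤p A0 = trans (quot-< p A 2≤p A0 (ℕₚ.<⇒≤ 2≤p)) A0

  chain-< : ∀ ps A {k} → All (λ p → 2 ≤ p × k < p) ps → A 0 ≡ + 1 → chain ps A k ≡ A k
  chain-< []       A []                  A0 = refl
  chain-< (p ∷ ps) A ((2≤p , k<p) ∷ all) A0 = trans (chain-< ps (quot p A) all (quot-0 p A 2≤p A0)) (quot-< p A 2≤p A0 k<p)

  -- H has no terms from q on, so the copies of H placed at multiples of q do not overlap; e and j
  -- are remainder and quotient of the exponent by q.
  dil-digits : ∀ q H G e j → e < q → (∀ k → q ≤ k → H k ≡ + 0) → (H ∙ dil q G) (e ℕ.+ j ℕ.* q) ≡ H e * G j
  dil-digits q H G e j e<q Hz = trans (at (∙-comm H (dil q G)) _) (go G j)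
    where
    1≤q : 1 ≤ q
    1≤q = ℕₚ.≤-trans (s≤s z≤n) e<q
    expand : ∀ G k → (dil q G ∙ H) k ≡ G 0 * H k + shift q (dil q (tail G) ∙ H) k
    expand G k = trans (at (∙-cong (dil-head q G 1≤q) (≈-refl {H})) k) (trans (at (∙-distribʳ (const (G 0)) (shift q (dil q (tail G))) H) k)
      (cong₂ _+_ (at (const-∙ (G 0) H) k) (at (shift-∙ q (dil q (tail G)) H) k)))
    go : ∀ G j → (dil q G ∙ H) (e ℕ.+ j ℕ.* q) ≡ H e * G j
    go G zero = trans (cong (dil q G ∙ H) (ℕₚ.+-identityʳ e)) (trans (expand G e)
      (trans (cong (λ z → G 0 * H e + z) (shift-< q _ e<q)) (trans (ℤₚ.+-identityʳ _) (ℤₚ.*-comm (G 0) (H e)))))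
    go G (suc j) = trans (cong (dil q G ∙ H) (lem e q (j ℕ.* q))) (trans (expand G _)
      (trans (cong₂ (λ a b → G 0 * a + b) (Hz _ (ℕₚ.m≤m+n q _)) (shift-+ q (dil q (tail G) ∙ H) (e ℕ.+ j ℕ.* q)))
        (trans (cong (_+ (dil q (tail G) ∙ H) (e ℕ.+ j ℕ.* q)) (ℤₚ.*-zeroʳ (G 0))) (trans (ℤₚ.+-identityˡ _) (go (tail G) j)))))
      where
      lem : ∀ e q r → e ℕ.+ (q ℕ.+ r) ≡ q ℕ.+ (e ℕ.+ r)
      lem = ℕSolver.solve-∀

  Periodic : ℕ → Series → Set
  Periodic T G = ∀ k → G (T ℕ.+ k) ≡ G k

  Periodic-* : ∀ {T G} → Periodic T G → ∀ u k → G (u ℕ.* T ℕ.+ k) ≡ G k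
  Periodic-* per zero    k = refl
  Periodic-* {T} {G} per (suc u) k = trans (cong G (ℕₚ.+-assoc T (u ℕ.* T) k)) (trans (per _) (Periodic-* per u k))

  -- Multiples of T on both sides express a congruence modulo T without subtraction.
  Periodic-≡ : ∀ {T G} → Periodic T G → ∀ {a b} u v → u ℕ.* T ℕ.+ a ≡ v ℕ.* T ℕ.+ b → G a ≡ G b
  Periodic-≡ {T} {G} per {a} {b} u v e = trans (sym (Periodic-* per u a)) (trans (cong G e) (Periodic-* per v b))

  -- `H1` makes each prime contribute ±1, `H0` and `top` offer two places for a nonzero lowest
  -- digit, and `neg` supplies the sign that `inv H 0` = 1 lacks.
  record Base (H : Series) : Set where
    field
      H0   : H 0 ≡ + 1
      H1   : Sign (H 1)
      D    : ℕ
      top  : Sign (H D)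
      high : ∀ k → D < k → H k ≡ + 0
      T    : ℕ
      1≤T  : 1 ≤ T
      per  : Periodic T (inv H)
      j⁻   : ℕ
      neg  : inv H j⁻ ≡ - (+ 1)

  -- A_{i+1}(k) = A_i(k) − A_i(1) A_i(k − p) for k < 2p, so each p contributes −f σ.
  chain-sum : ∀ (f σ : ℤ) (G : Series) x k → k < x ℕ.+ x → ∀ ps A →
    A 0 ≡ + 1 → A 1 ≡ f → (∀ j → j < x → A j ≡ G j) →
    All (λ p → 2 ≤ p × x ≤ p × ∃[ w ] p ℕ.+ w ≡ k × G w ≡ σ) ps →
    chain ps A k ≡ A k + + length ps * (- f * σ)
  chain-sum f σ G x k k<2x [] A A0 A1 AG [] = sym (trans (cong (λ z → A k + z) (ℤₚ.*-zeroˡ (- f * σ))) (ℤₚ.+-identityʳ (A k)))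
  chain-sum f σ G x k k<2x (p ∷ ps) A A0 A1 AG ((2≤p , x≤p , w , refl , Gw) ∷ all) = trans
    (chain-sum f σ G x k k<2x ps (quot p A) (quot-0 p A 2≤p A0) (trans (quot-< p A 2≤p A0 2≤p) A1)
       -- Every p is at least x, so agreement with G below x survives the step, and all
       -- contributions can be read off from G.
       (λ j j<x → trans (quot-< p A 2≤p A0 (ℕₚ.<-≤-trans j<x x≤p)) (AG j j<x)) all)
    (trans (cong (_+ + length ps * (- f * σ)) eq) (lem (A k) (- f * σ) (+ length ps)))
    where
    w<x : w < x
    w<x = ℕₚ.+-cancelˡ-< x _ _ (ℕₚ.≤-<-trans (ℕₚ.+-monoˡ-≤ w x≤p) k<2x)
    eq : quot p A k ≡ A k + - f * σ
    eq = trans (quot-below p A 2≤p A0 (ℕₚ.<-≤-trans k<2x (ℕₚ.+-mono-≤ x≤p x≤p)))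
      (cong₂ (λ a b → A k + - a * b) A1 (trans (shift-+ p A w) (trans (AG w w<x) Gw)))
    lem : ∀ a b n → (a + b) + n * b ≡ a + (+ 1 + n) * b
    lem = solve-∀

  signFor : ∀ f z → Sign f → ∃[ σ ] Sign σ × (+ ∣ z ∣ * (- f * σ) ≡ z)
  signFor f (+ n)      (inj₁ refl) = - (+ 1) , inj₂ refl , ℤₚ.*-identityʳ (+ n)
  signFor f (+ n)      (inj₂ refl) = + 1 , inj₁ refl , ℤₚ.*-identityʳ (+ n)
  signFor f (-[1+ n ]) (inj₁ refl) = + 1 , inj₁ refl , trans (ℤₚ.*-comm (+ suc n) (- (+ 1))) (ℤₚ.-1*i≡-i (+ suc n))
  signFor f (-[1+ n ]) (inj₂ refl) = - (+ 1) , inj₂ refl , trans (ℤₚ.*-comm (+ suc n) (- (+ 1))) (ℤₚ.-1*i≡-i (+ suc n))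

  PrimesAbove : ℕ → List ℕ → Set
  PrimesAbove L ps = Unique ps × All (λ p → Prime p × L < p) ps

  module _ {H : Series} (base : Base H) where
    open Base base

    digitSign : ∀ e σ → Sign (H e) → Sign σ → ∃[ j ] H e * inv H j ≡ σ
    digitSign e σ (inj₁ He) (inj₁ refl) = 0 , cong₂ _*_ He (trans (inv-zero H) H0)
    digitSign e σ (inj₁ He) (inj₂ refl) = j⁻ , cong₂ _*_ He neg
    digitSign e σ (inj₂ He) (inj₁ refl) = j⁻ , cong₂ _*_ He neg
    digitSign e σ (inj₂ He) (inj₂ refl) = 0 , cong₂ _*_ He (trans (inv-zero H) H0)

    module _ (q : ℕ) (D+D<q : D ℕ.+ D < q) where
      private
        D<q : D < q
        D<q = ℕₚ.≤-<-trans (ℕₚ.m≤m+n D D) D+D<q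
        1≤q : 1 ≤ q
        1≤q = ℕₚ.≤-trans (s≤s z≤n) D<q
        instance
          q≢0 : NonZero q
          q≢0 = ℕ.>-nonZero 1≤q

      quot-digits : ∀ e j → e < q → quot q H (e ℕ.+ j ℕ.* q) ≡ H e * inv H j
      quot-digits e j e<q = trans (at (∙-cong (≈-refl {H}) (≈-sym (dil-inv q 1≤q (monic⇒Unit H H0)))) _)
        (dil-digits q H (inv H) e j e<q (λ k q≤k → high k (ℕₚ.<-≤-trans D<q q≤k)))

      quot-Periodic : Periodic (T ℕ.* q) (quot q H)
      quot-Periodic k = begin
        quot q H (T ℕ.* q ℕ.+ k)
          ≡⟨ cong (quot q H) (trans (cong (T ℕ.* q ℕ.+_) (m≡m%n+[m/n]*n k q)) (lem T q (k % q) (k ℕ./ q))) ⟩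
        quot q H (k % q ℕ.+ (T ℕ.+ k ℕ./ q) ℕ.* q)
          ≡⟨ quot-digits (k % q) (T ℕ.+ k ℕ./ q) (m%n<n k q) ⟩
        H (k % q) * inv H (T ℕ.+ k ℕ./ q)
          ≡⟨ cong (H (k % q) *_) (per (k ℕ./ q)) ⟩
        H (k % q) * inv H (k ℕ./ q)
          ≡⟨ sym (quot-digits (k % q) (k ℕ./ q) (m%n<n k q)) ⟩
        quot q H (k % q ℕ.+ (k ℕ./ q) ℕ.* q)
          ≡⟨ cong (quot q H) (sym (m≡m%n+[m/n]*n k q)) ⟩
        quot q H k ∎
        where
        open ≡-Reasoning
        lem : ∀ T q r s → T ℕ.* q ℕ.+ (r ℕ.+ s ℕ.* q) ≡ r ℕ.+ (T ℕ.+ s) ℕ.* q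
        lem = ℕSolver.solve-∀

      -- The lowest digit of i is 0 or D, whichever moves out of the support of H when α is added.
      position : ∀ α σ → q ∤ α → Sign σ → ∃[ i ] quot q H i ≡ σ × quot q H (i ℕ.+ α) ≡ + 0
      position α σ q∤α sσ = choose (D ℕ.+ ρ ℕ.<? q)
        where
        ρ = α % q
        0<ρ : 0 < ρ
        0<ρ = ℕₚ.n≢0⇒n>0 (λ e → q∤α (m%n≡0⇒n∣m α q e))
        place : ∀ e → e < q → Sign (H e) → D < e ℕ.+ ρ → e ℕ.+ ρ < q → ∃[ i ] quot q H i ≡ σ × quot q H (i ℕ.+ α) ≡ + 0
        place e e<q se D<e+ρ e+ρ<q with digitSign e σ se sσ
        ... | j , eq = e ℕ.+ j ℕ.* q , trans (quot-digits e j e<q) eq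
          , trans (cong (quot q H) (trans (cong (e ℕ.+ j ℕ.* q ℕ.+_) (m≡m%n+[m/n]*n α q)) (lem e j q ρ (α ℕ./ q))))
              (trans (quot-digits (e ℕ.+ ρ) (j ℕ.+ α ℕ./ q) e+ρ<q) (trans (cong (_* inv H (j ℕ.+ α ℕ./ q)) (high _ D<e+ρ)) (ℤₚ.*-zeroˡ (inv H (j ℕ.+ α ℕ./ q)))))
          where
          lem : ∀ e j q r s → e ℕ.+ j ℕ.* q ℕ.+ (r ℕ.+ s ℕ.* q) ≡ (e ℕ.+ r) ℕ.+ (j ℕ.+ s) ℕ.* q
          lem = ℕSolver.solve-∀
        choose : Dec (D ℕ.+ ρ < q) → ∃[ i ] quot q H i ≡ σ × quot q H (i ℕ.+ α) ≡ + 0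
        choose (yes lt) = place D D<q top (ℕₚ.m<m+n D 0<ρ) lt
        -- Here D + ρ ≥ q > 2D, so ρ > D: the digit ρ lies beyond the support of H.
        choose (no nlt) = place 0 1≤q (inj₁ H0) (ℕₚ.+-cancelˡ-< D _ _ (ℕₚ.<-≤-trans D+D<q (ℕₚ.≮⇒≥ nlt))) (m%n<n α q)

    realise : ∀ z L → ∃[ ps ] ∃[ k ] PrimesAbove L ps × chain ps H k ≡ z
    realise z L with prime-above (L ℕ.+ (D ℕ.+ D))
    -- One prime more than the absolute value of z is requested. The first is not adjoined; it
    -- supplies facts about α and x, even when z = 0. The bound L + q keeps the others distinct from
    -- q.
    ... | q , prq , L+2D<q = go (cluster C 1≤C (suc ∣ z ∣) (L ℕ.+ q))
      where
      2≤q : 2 ≤ q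
      2≤q = prime>1 prq
      1≤q : 1 ≤ q
      1≤q = ℕₚ.<⇒≤ 2≤q
      D+D<q : D ℕ.+ D < q
      D+D<q = ℕₚ.≤-<-trans (ℕₚ.m≤n+m (D ℕ.+ D) L) L+2D<q
      C : ℕ
      C = T ℕ.* q
      1≤C : 1 ≤ C
      1≤C = ℕₚ.*-mono-≤ 1≤T 1≤q
      instance
        C≢0 : NonZero C
        C≢0 = ℕ.>-nonZero 1≤C
        q≢0 : NonZero q
        q≢0 = ℕ.>-nonZero 1≤q
      G : Series
      G = quot q H
      f : ℤ
      f = H 1
      go : Cluster C 1≤C (suc ∣ z ∣) (L ℕ.+ q) → ∃[ ps ] ∃[ k ] PrimesAbove L ps × chain ps H k ≡ z
      go record { primes = [] ; size = () }
      go record { x = x ; α = α ; primes = p₀ ∷ ps ; size = size ; distinct = _ ∷ uniq ; member = m₀ ∷ member }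
        with signFor f z H1
      ... | σ , sσ , val with position q D+D<q α σ q∤α sσ
        where
        q∣p₀ : q ∣ α → q ∣ p₀
        q∣p₀ q∣α = m%n≡0⇒n∣m p₀ q (trans (sym (m∣n⇒o%n%m≡o%m q C p₀ (divides-refl T)))
          (trans (cong (_% q) (proj₂ (proj₂ (proj₂ (proj₂ m₀))))) (n∣m⇒m%n≡0 α q q∣α)))
        -- q divides C, so p₀ ≡ α modulo q, while p₀ is a prime larger than q.
        q∤α : q ∤ α
        q∤α q∣α with prime⇒irreducible (proj₁ m₀) (q∣p₀ q∣α)
        ... | inj₁ q≡1 = contradiction (sym q≡1) (ℕₚ.<⇒≢ 2≤q)
        ... | inj₂ q≡p = contradiction q≡p (ℕₚ.<⇒≢ (ℕₚ.≤-<-trans (ℕₚ.m≤n+m q L) (proj₁ (proj₂ m₀))))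
      ... | i , Gi , Gi+α = q ∷ ps , k
          , (All.map (λ { (_ , L+q<p , _) → ℕₚ.<⇒≢ (ℕₚ.≤-<-trans (ℕₚ.m≤n+m q L) L+q<p) }) member ∷ uniq
            , (prq , ℕₚ.≤-<-trans (ℕₚ.m≤m+n L (D ℕ.+ D)) L+2D<q) ∷ All.map (λ { (pr , L+q<p , _) → pr , ℕₚ.≤-<-trans (ℕₚ.m≤m+n L q) L+q<p }) member)
          , (begin
              chain ps G k
                ≡⟨ chain-sum f σ G x k k<2x ps G (quot-0 q H 2≤q H0) (quot-< q H 2≤q H0 2≤q) (λ _ _ → refl) (All.map contribution member) ⟩
              G k + + length ps * (- f * σ)
                ≡⟨ cong₂ (λ a n → a + + n * (- f * σ)) Gk (ℕₚ.suc-injective size) ⟩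
              + 0 + + ∣ z ∣ * (- f * σ)
                ≡⟨ trans (ℤₚ.+-identityˡ _) val ⟩
              z ∎)
        where
        open ≡-Reasoning
        y r u k : ℕ
        -- k becomes the exponent in [2x - C, 2x) that is congruent to i + α modulo C; adding (C -
        -- 1) y stands for subtracting y modulo C.
        y = x ℕ.+ x ℕ.∸ C
        r = (i ℕ.+ α ℕ.+ (C ℕ.∸ 1) ℕ.* y) % C
        u = (i ℕ.+ α ℕ.+ (C ℕ.∸ 1) ℕ.* y) ℕ./ C
        k = y ℕ.+ r
        C≤2x : C ≤ x ℕ.+ x
        C≤2x = ℕₚ.≤-trans (ℕₚ.m≤n+m C p₀) (ℕₚ.<⇒≤ (proj₁ (proj₂ (proj₂ (proj₂ m₀)))))
        C+y : C ℕ.+ y ≡ x ℕ.+ x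
        C+y = ℕₚ.m+[n∸m]≡n C≤2x
        k<2x : k < x ℕ.+ x
        k<2x = subst (k <_) (trans (ℕₚ.+-comm y C) C+y) (ℕₚ.+-monoʳ-< y (m%n<n (i ℕ.+ α ℕ.+ (C ℕ.∸ 1) ℕ.* y) C))
        k≡ : u ℕ.* C ℕ.+ k ≡ y ℕ.* C ℕ.+ (i ℕ.+ α)
        k≡ = begin
          u ℕ.* C ℕ.+ (y ℕ.+ r)                       ≡⟨ lem₁ (u ℕ.* C) y r ⟩
          y ℕ.+ (r ℕ.+ u ℕ.* C)                       ≡⟨ cong (y ℕ.+_) (sym (m≡m%n+[m/n]*n (i ℕ.+ α ℕ.+ (C ℕ.∸ 1) ℕ.* y) C)) ⟩
          y ℕ.+ (i ℕ.+ α ℕ.+ (C ℕ.∸ 1) ℕ.* y)         ≡⟨ lem₂ y (i ℕ.+ α) (C ℕ.∸ 1) ⟩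
          y ℕ.* (1 ℕ.+ (C ℕ.∸ 1)) ℕ.+ (i ℕ.+ α)       ≡⟨ cong (λ c → y ℕ.* c ℕ.+ (i ℕ.+ α)) (ℕₚ.m+[n∸m]≡n 1≤C) ⟩
          y ℕ.* C ℕ.+ (i ℕ.+ α)                       ∎
          where
          lem₁ : ∀ a y r → a ℕ.+ (y ℕ.+ r) ≡ y ℕ.+ (r ℕ.+ a)
          lem₁ = ℕSolver.solve-∀
          lem₂ : ∀ y a c → y ℕ.+ (a ℕ.+ c ℕ.* y) ≡ y ℕ.* (1 ℕ.+ c) ℕ.+ a
          lem₂ = ℕSolver.solve-∀
        per-G : Periodic C G
        per-G = quot-Periodic q D+D<q
        Gk : G k ≡ + 0
        Gk = trans (Periodic-≡ per-G u y k≡) Gi+α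
        contribution : ∀ {p} → Prime p × L ℕ.+ q < p × x ≤ p × p ℕ.+ C < x ℕ.+ x × p % C ≡ α →
                       2 ≤ p × x ≤ p × ∃[ w ] p ℕ.+ w ≡ k × G w ≡ σ
        contribution {p} (pr , _ , x≤p , p+C<2x , mod) = prime>1 pr , x≤p , k ℕ.∸ p , p+w , trans (Periodic-≡ per-G (u ℕ.+ p ℕ./ C) y eq) Gi
          where
          p≤k : p ≤ k
          p≤k = ℕₚ.≤-trans (ℕₚ.<⇒≤ (ℕₚ.+-cancelʳ-< C _ _ (subst (p ℕ.+ C <_) (trans (sym C+y) (ℕₚ.+-comm C y)) p+C<2x))) (ℕₚ.m≤m+n y r)
          p+w : p ℕ.+ (k ℕ.∸ p) ≡ k
          p+w = ℕₚ.m+[n∸m]≡n p≤k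
          lem : ∀ u v C w a → ((u ℕ.+ v) ℕ.* C ℕ.+ w) ℕ.+ a ≡ u ℕ.* C ℕ.+ ((a ℕ.+ v ℕ.* C) ℕ.+ w)
          lem = ℕSolver.solve-∀
          -- As p ≡ α modulo C, adding α to both sides reduces k - p ≡ i to k ≡ i + α.
          eq : (u ℕ.+ p ℕ./ C) ℕ.* C ℕ.+ (k ℕ.∸ p) ≡ y ℕ.* C ℕ.+ i
          eq = ℕₚ.+-cancelʳ-≡ α _ _ (begin
            ((u ℕ.+ p ℕ./ C) ℕ.* C ℕ.+ (k ℕ.∸ p)) ℕ.+ α              ≡⟨ lem u (p ℕ./ C) C (k ℕ.∸ p) α ⟩
            u ℕ.* C ℕ.+ ((α ℕ.+ p ℕ./ C ℕ.* C) ℕ.+ (k ℕ.∸ p))        ≡⟨ cong (λ t → u ℕ.* C ℕ.+ ((t ℕ.+ p ℕ./ C ℕ.* C) ℕ.+ (k ℕ.∸ p))) (sym mod) ⟩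
            u ℕ.* C ℕ.+ ((p % C ℕ.+ p ℕ./ C ℕ.* C) ℕ.+ (k ℕ.∸ p))    ≡⟨ cong (λ t → u ℕ.* C ℕ.+ (t ℕ.+ (k ℕ.∸ p))) (sym (m≡m%n+[m/n]*n p C)) ⟩
            u ℕ.* C ℕ.+ (p ℕ.+ (k ℕ.∸ p))                            ≡⟨ cong (u ℕ.* C ℕ.+_) p+w ⟩
            u ℕ.* C ℕ.+ k                                            ≡⟨ k≡ ⟩
            y ℕ.* C ℕ.+ (i ℕ.+ α)                                    ≡⟨ sym (ℕₚ.+-assoc (y ℕ.* C) i α) ⟩
            (y ℕ.* C ℕ.+ i) ℕ.+ α                                    ∎)

-- Series that represent Φ_N and 1/Φ_N

module Values where

  open import Defs
  open PrimeClusters using (prime-above; prime>1; prime∤1; prime-∤⇒coprime)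
  open SeriesRing
  open Cyclotomic
  open Polynomiality
  open Realisation
  open import Data.Bool using (Bool; true; false; not)
  open import Data.Nat as ℕ using (ℕ; zero; suc; _<_; _≤_; z≤n; s≤s)
  import Data.Nat.Properties as ℕₚ
  open import Data.Nat.Divisibility
  open import Data.Nat.Primality using (Prime; prime?; prime⇒irreducible; euclidsLemma)
  open import Data.Nat.Primality.Factorisation using (factorise; PrimeFactorisation)
  open import Data.Nat.Coprimality as Cop using (Coprime; coprime-divisor; coprime-Bézout; gcd≡1⇒coprime)
  open import Data.Nat.GCD using (gcd; module Bézout)
  open import Data.Nat.ListAction using (product)
  import Data.Nat.Tactic.RingSolver as ℕSolver
  open import Data.Integer as ℤ using (ℤ; +_; -_; _+_; _*_)
  import Data.Integer.Properties as ℤₚ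
  open import Data.List using (List; []; _∷_)
  open import Data.List.Relation.Unary.All as All using (All; []; _∷_)
  open import Data.List.Relation.Unary.AllPairs using ([]; _∷_)
  open import Data.List.Relation.Unary.Unique.Propositional using (Unique)
  open import Data.Product using (_×_; _,_; ∃-syntax; proj₁; proj₂)
  open import Data.Sum using (_⊎_; inj₁; inj₂)
  open import Relation.Nullary using (yes; no; contradiction; ¬_)
  open import Relation.Binary.PropositionalEquality

  Φ^± : Bool → ℕ → Series
  Φ^± false N = Ψ N
  Φ^± true  N = inv (Ψ N)

  Φ^±-Unit : ∀ ε N → Unit (Φ^± ε N)
  Φ^±-Unit false N = Ψ-unit N
  Φ^±-Unit true  N = Unit-inv (Ψ-unit N)

  record Rep (N : ℕ) (ε : Bool) (A : Series) (h : ℕ) : Set where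
    constructor rep
    field
      1≤N : 1 ≤ N
      1≤h : 1 ≤ h
      eq  : Φ^± ε N ≈ dil h A

  Rep-Unit : ∀ {N ε A h} → Rep N ε A h → Unit A
  Rep-Unit {N} {ε} {A} {h} (rep _ 1≤h eq) = unit (trans (cong₂ _*_ e e) (square (Φ^±-Unit ε N)))
    where
    e : A 0 ≡ Φ^± ε N 0
    e = sym (trans (at eq 0) (dil-zero h A 1≤h))

  Rep-flip : ∀ {N ε A h} → Rep N ε A h → Rep N (not ε) (inv A) h
  Rep-flip {N} {ε} {A} {h} R@(rep 1≤N 1≤h eq) = rep 1≤N 1≤h
    (≈-trans (lem ε) (≈-trans (inv-cong (Φ^±-Unit ε N) eq) (≈-sym (dil-inv h 1≤h (Rep-Unit R)))))
    where
    lem : ∀ ε → Φ^± (not ε) N ≈ inv (Φ^± ε N)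
    lem false = ≈-refl
    lem true  = ≈-sym (inv-involutive (Ψ-unit N))

  dil-comm : ∀ p q f → 1 ≤ p → 1 ≤ q → dil p (dil q f) ≈ dil q (dil p f)
  dil-comm p q f 1≤p 1≤q = ≈-trans (dil-dil p q f 1≤p 1≤q)
    (subst (λ t → dil t f ≈ dil q (dil p f)) (ℕₚ.*-comm q p) (≈-sym (dil-dil q p f 1≤q 1≤p)))

  Rep-old : ∀ {N ε A h p} → Prime p → p ∣ N → Rep N ε A h → Rep (N ℕ.* p) ε A (p ℕ.* h)
  Rep-old {N} {ε} {A} {h} {p} pr p∣N (rep 1≤N 1≤h eq) = rep (ℕₚ.*-mono-≤ 1≤N 1≤p) (ℕₚ.*-mono-≤ 1≤p 1≤h)
    (≈-trans (lem ε) (≈-trans (dil-cong p eq) (dil-dil p h A 1≤p 1≤h)))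
    where
    1≤p = ℕₚ.<⇒≤ (prime>1 pr)
    lem : ∀ ε → Φ^± ε (N ℕ.* p) ≈ dil p (Φ^± ε N)
    lem false = Ψ-∣ pr N 1≤N p∣N
    lem true  = ≈-trans (inv-cong (Ψ-unit (N ℕ.* p)) (Ψ-∣ pr N 1≤N p∣N)) (≈-sym (dil-inv p 1≤p (Ψ-unit N)))

  -- `quot p` turns Φ_N into 1/Φ_(Np), hence the flipped exponent. Dilation by h is multiplicative
  -- and commutes with dilation by p, so `quot p` may be applied to A beforehand.
  Rep-new : ∀ {N ε A h p} → Prime p → p ∤ N → Rep N ε A h → Rep (N ℕ.* p) (not ε) (quot p A) h
  Rep-new {N} {ε} {A} {h} {p} pr p∤N R@(rep 1≤N 1≤h eq) = rep (ℕₚ.*-mono-≤ 1≤N 1≤p) 1≤h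
    (≈-trans (lem ε) (≈-sym (begin
      dil h (A ∙ inv (dil p A))           ≈⟨ dil-∙ h A (inv (dil p A)) 1≤h ⟩
      dil h A ∙ dil h (inv (dil p A))     ≈⟨ ∙-cong ≈-refl (dil-inv h 1≤h uA) ⟩
      dil h A ∙ inv (dil h (dil p A))     ≈⟨ ∙-cong ≈-refl (inv-cong (Unit-dil h 1≤h uA) (≈-trans (dil-comm h p A 1≤h 1≤p) (dil-cong p (≈-sym eq)))) ⟩
      dil h A ∙ inv (dil p (Φ^± ε N))     ≈⟨ ∙-cong (≈-sym eq) ≈-refl ⟩
      quot p (Φ^± ε N)                    ∎)))
    where
    open ≈-R
    1≤p = ℕₚ.<⇒≤ (prime>1 pr)
    uA : Unit (dil p A)
    uA = Unit-dil p 1≤p (Rep-Unit R)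
    uN = Ψ-unit N
    uNp = Ψ-unit (N ℕ.* p)
    udN = Unit-dil p 1≤p uN
    lem : ∀ ε → Φ^± (not ε) (N ℕ.* p) ≈ quot p (Φ^± ε N)
    lem false = ≈-sym (inv-unique uNp (≈-trans (≈-sym (∙-assoc _ _ _)) (≈-trans (∙-cong (Ψ-∤ pr N 1≤N p∤N) ≈-refl) (∙-inv udN))))
    lem true  = ≈-sym (begin
      inv (Ψ N) ∙ inv (dil p (inv (Ψ N)))   ≈⟨ ∙-cong ≈-refl (inv-cong (Unit-dil p 1≤p (Unit-inv uN)) (dil-inv p 1≤p uN)) ⟩
      inv (Ψ N) ∙ inv (inv (dil p (Ψ N)))   ≈⟨ ∙-cong ≈-refl (inv-involutive udN) ⟩
      inv (Ψ N) ∙ dil p (Ψ N)               ≈⟨ ∙-cong ≈-refl (≈-sym (≈-trans (∙-comm (Ψ N) (Ψ (N ℕ.* p))) (Ψ-∤ pr N 1≤N p∤N))) ⟩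
      inv (Ψ N) ∙ (Ψ N ∙ Ψ (N ℕ.* p))       ≈⟨ inv-∙-cancel (Ψ (N ℕ.* p)) uN ⟩
      Ψ (N ℕ.* p)                           ∎)

  flips : List ℕ → Bool → Bool
  flips []       ε = ε
  flips (p ∷ ps) ε = flips ps (not ε)

  flips-not : ∀ ps ε → flips ps (not ε) ≡ not (flips ps ε)
  flips-not []       ε = refl
  flips-not (p ∷ ps) ε = flips-not ps (not ε)

  prime∤prime : ∀ {p q} → Prime p → Prime q → p ≢ q → p ∤ q
  prime∤prime prp prq p≢q p∣q with prime⇒irreducible prq p∣q
  ... | inj₁ p≡1 = ℕₚ.<⇒≢ (prime>1 prp) (sym p≡1)
  ... | inj₂ p≡q = p≢q p≡q

  Rep-chain : ∀ ps {N ε A h} → Unique ps → All (λ p → Prime p × p ∤ N) ps → Rep N ε A h →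
              Rep (N ℕ.* product ps) (flips ps ε) (chain ps A) h
  Rep-chain [] {N} {ε} {A} {h} _ _ R = subst (λ n → Rep n ε A h) (sym (ℕₚ.*-identityʳ N)) R
  Rep-chain (p ∷ ps) {N} {ε} {A} {h} (p∉ ∷ uniq) ((pr , p∤N) ∷ all) R =
    subst (λ n → Rep n (flips ps (not ε)) (chain ps (quot p A)) h) (ℕₚ.*-assoc N p (product ps))
      (Rep-chain ps uniq (All.map new (All.zip (p∉ , all))) (Rep-new pr p∤N R))
    where
    new : ∀ {q} → p ≢ q × Prime q × q ∤ N → Prime q × q ∤ N ℕ.* p
    new {q} (p≢q , prq , q∤N) = prq , λ q∣ → case (euclidsLemma N p prq q∣)
      where
      case : ¬ (q ∣ N ⊎ q ∣ p)
      case (inj₁ q∣N) = q∤N q∣N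
      case (inj₂ q∣p) = prime∤prime prq pr (λ e → p≢q (sym e)) q∣p

  last-nonzero : ∀ n f → ZeroFrom n f → f 0 ≢ + 0 → ∃[ D ] f D ≢ + 0 × (∀ k → D < k → f k ≡ + 0)
  last-nonzero zero    f Z f0 = contradiction (Z 0 z≤n) f0
  last-nonzero (suc n) f Z f0 with f n ℤ.≟ + 0
  ... | no fn≢0 = n , fn≢0 , Z
  ... | yes fn≡0 = last-nonzero n f (λ k n≤k → case k (ℕₚ.m≤n⇒m<n∨m≡n n≤k)) f0
    where
    case : ∀ k → n < k ⊎ n ≡ k → f k ≡ + 0
    case k (inj₁ n<k)  = Z k n<k
    case k (inj₂ refl) = fn≡0

  top-∙ : ∀ D E f g → (∀ k → D < k → f k ≡ + 0) → (∀ k → E < k → g k ≡ + 0) → (f ∙ g) (D ℕ.+ E) ≡ f D * g E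
  top-∙ zero E f g F G = trans (at (∙-cong {f} {const (f 0)} (pointwise λ { zero → refl ; (suc k) → F (suc k) (s≤s z≤n) }) (≈-refl {g})) E)
    (at (const-∙ (f 0) g) E)
  top-∙ (suc D) E f g F G = trans (∙-suc f g (D ℕ.+ E)) (trans (cong₂ _+_
    (trans (cong (f 0 *_) (G _ (s≤s (ℕₚ.m≤n+m E D)))) (ℤₚ.*-zeroʳ (f 0)))
    (top-∙ D E (tail f) g (λ k D<k → F (suc k) (s≤s D<k)) G)) (ℤₚ.+-identityˡ _))

  ∣i∣≡1⇒Sign : ∀ i → ℤ.∣ i ∣ ≡ 1 → Sign i
  ∣i∣≡1⇒Sign (+ .1) refl = inj₁ refl
  ∣i∣≡1⇒Sign ℤ.-[1+ .0 ] refl = inj₂ refl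

  i*j≡1⇒Sign : ∀ i j → i * j ≡ + 1 → Sign j
  i*j≡1⇒Sign i j e = ∣i∣≡1⇒Sign j (ℕₚ.m*n≡1⇒n≡1 ℤ.∣ i ∣ ℤ.∣ j ∣ (trans (sym (ℤₚ.abs-* i j)) (cong ℤ.∣_∣ e)))

  Sign⇒≢0 : ∀ {i} → Sign i → i ≢ + 0
  Sign⇒≢0 (inj₁ refl) ()
  Sign⇒≢0 (inj₂ refl) ()

  Unit⇒≢0 : ∀ {f} → Unit f → f 0 ≢ + 0
  Unit⇒≢0 u e = contradiction (trans (sym (square u)) (cong₂ _*_ e e)) λ ()

  module _ {N : ℕ} {H : Series} {h : ℕ} (R : Rep N false H h) where
    open Rep R
    private
      H≡ : ∀ k → H k ≡ Ψ N (k ℕ.* h)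
      H≡ k = sym (trans (at eq (k ℕ.* h)) (dil-* h H k 1≤h))

    opaque
      Rep-ZeroFrom : ∃[ n ] ZeroFrom n H
      Rep-ZeroFrom with Poly-Ψ N
      ... | n , Z = n , λ k n≤k → trans (H≡ k) (Z _ (ℕₚ.≤-trans n≤k (ℕₚ.m≤m*n k h {{ℕ.>-nonZero 1≤h}})))

    -- Both facts come from x^N - 1 = `properΨ N` · Φ_N. Comparing leading terms gives E + D h = N
    -- and a leading coefficient ±1. The quotient (x^N - 1)/Φ_N has degree E < N, so the
    -- coefficients of 1/Φ_N repeat with period N.
    Rep-Base : H 0 ≡ + 1 → Sign (H 1) → ∀ j → inv H j ≡ - (+ 1) → Base H
    Rep-Base H0 H1 j neg
      with last-nonzero (proj₁ Rep-ZeroFrom) H (proj₂ Rep-ZeroFrom) (Unit⇒≢0 (Rep-Unit R))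
         | last-nonzero _ (properΨ N) (proj₂ (Poly-properΨ N (λ i _ → Poly-Ψ i))) (Unit⇒≢0 (properΨ-Unit N))
    ... | D , HD≢0 , high | E , BE≢0 , highB = record
      { H0 = H0 ; H1 = H1 ; D = D ; top = i*j≡1⇒Sign (properΨ N E) (H D) (trans lead (trans (cong (xpow-1 N) E+Dh≡N) (xpow-1-top N 1≤N)))
      ; high = high ; T = N ; 1≤T = 1≤N ; per = per ; j⁻ = j ; neg = neg }
      where
      -- `H 1` ≠ 0 excludes degree 0; thus E + D h is not 0, the only other exponent at which x^N -
      -- 1 has a nonzero coefficient.
      1≤D : 1 ≤ D
      1≤D with D ℕ.≟ 0
      ... | yes refl = contradiction (high 1 (s≤s z≤n)) (Sign⇒≢0 H1)
      ... | no D≢0   = ℕₚ.n≢0⇒n>0 D≢0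
      highΨ : ∀ k → D ℕ.* h < k → Ψ N k ≡ + 0
      highΨ k lt with h ∣? k
      ... | no h∤k = trans (at eq k) (dil-∤ h H k h∤k)
      ... | yes (divides-refl q) = trans (sym (H≡ q)) (high q (ℕₚ.*-cancelʳ-< h D q lt))
      lead : properΨ N E * H D ≡ xpow-1 N (E ℕ.+ D ℕ.* h)
      lead = trans (cong (properΨ N E *_) (H≡ D)) (trans (sym (top-∙ E (D ℕ.* h) (properΨ N) (Ψ N) highB highΨ)) (at (properΨ∙Ψ N 1≤N) _))
      1≤Dh : 1 ≤ D ℕ.* h
      1≤Dh = ℕₚ.*-mono-≤ 1≤D 1≤h
      E+Dh≡N : E ℕ.+ D ℕ.* h ≡ N
      E+Dh≡N with E ℕ.+ D ℕ.* h ℕ.≟ N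
      ... | yes e = e
      ... | no ne = contradiction (trans lead (xpow-1-mid N _ (ℕₚ.m<n⇒n≢0 (ℕₚ.≤-trans 1≤Dh (ℕₚ.m≤n+m _ E))) ne)) λ z →
              nz (ℤₚ.i*j≡0⇒i≡0∨j≡0 (properΨ N E) z)
        where
        nz : properΨ N E ≡ + 0 ⊎ H D ≡ + 0 → _
        nz (inj₁ e) = BE≢0 e
        nz (inj₂ e) = HD≢0 e
      E<N : E < N
      E<N = subst (E <_) E+Dh≡N (ℕₚ.m<m+n E 1≤Dh)
      I = inv (Ψ N)
      perI : ∀ k → I (N ℕ.+ k) ≡ I k
      perI k = sym (ℤₚ.i-j≡0⇒i≡j (I k) (I (N ℕ.+ k)) (begin
        I k + - I (N ℕ.+ k)
          ≡⟨ cong₂ (λ a b → a + - b) (sym (trans (at (shift-∙ N one I) (N ℕ.+ k)) (trans (shift-+ N (one ∙ I) k) (at (∙-identityˡ I) k)))) (sym (at (∙-identityˡ I) (N ℕ.+ k))) ⟩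
        ((x^ N) ∙ I) (N ℕ.+ k) + - (one ∙ I) (N ℕ.+ k)
          ≡⟨ at (solve 3 (λ a o i → a :* i :+ :- (o :* i) := (a :+ :- o) :* i) ≈-refl (x^ N) one I) (N ℕ.+ k) ⟩
        (pow-1 N ∙ I) (N ℕ.+ k)
          ≡⟨ at (∙-cong (≈-trans (≈-sym (xpow-1≈ N 1≤N)) (≈-sym (properΨ∙Ψ N 1≤N))) (≈-refl {I})) (N ℕ.+ k) ⟩
        ((properΨ N ∙ Ψ N) ∙ I) (N ℕ.+ k)
          ≡⟨ at (≈-trans (∙-assoc (properΨ N) (Ψ N) I) (≈-trans (∙-cong ≈-refl (∙-inv (Ψ-unit N))) (∙-identityʳ (properΨ N)))) (N ℕ.+ k) ⟩
        properΨ N (N ℕ.+ k)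
          ≡⟨ highB (N ℕ.+ k) (ℕₚ.<-≤-trans E<N (ℕₚ.m≤m+n N k)) ⟩
        + 0 ∎))
        where
        open ≡-Reasoning
        open SeriesSolver using (solve; _:*_; _:+_; :-_; _:=_)
      inv-H≡ : ∀ k → inv H k ≡ I (k ℕ.* h)
      inv-H≡ k = sym (trans (at (Rep.eq (Rep-flip R)) (k ℕ.* h)) (dil-* h (inv H) k 1≤h))
      per : Periodic N (inv H)
      per k = trans (inv-H≡ (N ℕ.+ k)) (trans (cong I (trans (ℕₚ.*-distribʳ-+ h N k) (cong (ℕ._+ k ℕ.* h) (ℕₚ.*-comm N h))))
        (trans (Periodic-* {N} {I} perI h (k ℕ.* h)) (sym (inv-H≡ k))))

  quot-1 : ∀ p A → 2 ≤ p → Unit A → quot p A 1 ≡ A 1 * A 0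
  quot-1 p A 2≤p u = trans (at (∙-cong (≈-refl {A}) (≈-sym (dil-inv p (ℕₚ.<⇒≤ 2≤p) u))) 1)
    (trans (∙-suc A (dil p (inv A)) 0) (trans (cong₂ _+_ (trans (cong (A 0 *_) (dil-small p (inv A) 2≤p)) (ℤₚ.*-zeroʳ (A 0)))
      (trans (∙-zero (tail A) (dil p (inv A))) (cong (A 1 *_) (trans (dil-zero p (inv A) (ℕₚ.<⇒≤ 2≤p)) (inv-zero A))))) (ℤₚ.+-identityˡ _)))

  quot-0-Unit : ∀ p A → 2 ≤ p → Unit A → quot p A 0 ≡ + 1
  quot-0-Unit p A 2≤p u = trans (∙-zero A _) (trans (cong (A 0 *_) (trans (inv-zero _) (dil-zero p A (ℕₚ.<⇒≤ 2≤p)))) (square u))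

  Sign-* : ∀ {a b} → Sign a → Sign b → Sign (a * b)
  Sign-* (inj₁ refl) (inj₁ refl) = inj₁ refl
  Sign-* (inj₁ refl) (inj₂ refl) = inj₂ refl
  Sign-* (inj₂ refl) (inj₁ refl) = inj₂ refl
  Sign-* (inj₂ refl) (inj₂ refl) = inj₁ refl

  Sign-neg : ∀ {a} → Sign a → Sign (- a)
  Sign-neg (inj₁ refl) = inj₂ refl
  Sign-neg (inj₂ refl) = inj₁ refl

  Unit⇒Sign : ∀ {f} → Unit f → Sign (f 0)
  Unit⇒Sign {f} u = i*j≡1⇒Sign (f 0) (f 0) (square u)

  Start : ℕ → Set
  Start N = ∃[ h ] ∃[ H ] Rep N false H h × Sign (H 1)

  Start-1 : Start 1
  Start-1 = 1 , xpow-1 1 , rep (s≤s z≤n) (s≤s z≤n) (≈-trans (begin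
      Ψ 1                              ≈⟨ Ψ-∏ 0 ⟩
      xpow-1 1 ∙ inv (properΨ 1)       ≈⟨ ∙-cong ≈-refl (≈-sym (inv-unique (properΨ-Unit 1) (≈-trans (∙-identityʳ _)
                                            (∏-ones 1 (Ψ∣ 1) (λ { zero _ → when-no (0 ∣? 1) (Ψ 0) (λ d → contradiction (0∣⇒≡0 d) λ ()) ; (suc i) (s≤s ()) }))))) ⟩
      xpow-1 1 ∙ one                   ≈⟨ ∙-identityʳ _ ⟩
      xpow-1 1                         ∎)
    (pointwise λ k → sym (trans (cong (dil 1 (xpow-1 1)) (sym (ℕₚ.*-identityʳ k))) (dil-* 1 (xpow-1 1) k (s≤s z≤n))))) , inj₁ refl
    where open ≈-R

  Rep-invQuot : ∀ {N H h p} → Prime p → p ∤ N → Rep N false H h → Rep (N ℕ.* p) false (inv (quot p H)) h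
  Rep-invQuot pr p∤N R = Rep-flip (Rep-new pr p∤N R)

  invQuot-0 : ∀ {H p} → Prime p → Unit H → inv (quot p H) 0 ≡ + 1
  invQuot-0 {H} {p} pr u = trans (inv-zero _) (quot-0-Unit p H (prime>1 pr) u)

  invQuot-1 : ∀ {H p} → Prime p → Unit H → inv (quot p H) 1 ≡ - (H 1 * H 0)
  invQuot-1 {H} {p} pr u = trans (inv-one (quot p H) (quot-0-Unit p H (prime>1 pr) u)) (cong -_ (quot-1 p H (prime>1 pr) u))

  -- For a new p the series becomes H(x^p)/H(x), with linear coefficient - `H 1` `H 0`, again a
  -- sign.
  Start-* : ∀ {N p} → Prime p → Start N → Start (N ℕ.* p)
  Start-* {N} {p} pr (h , H , R , H1) with p ∣? N
  ... | yes p∣N = p ℕ.* h , H , Rep-old pr p∣N R , H1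
  ... | no p∤N = h , inv (quot p H) , Rep-invQuot pr p∤N R
        , subst Sign (sym (invQuot-1 pr (Rep-Unit R))) (Sign-neg (Sign-* H1 (Unit⇒Sign (Rep-Unit R))))

  multiply : ∀ {P : ℕ → Set} {Q : ℕ → Set} → (∀ {N p} → Q p → P N → P (N ℕ.* p)) → ∀ N ps → All Q ps → P N → P (N ℕ.* product ps)
  multiply {P} step N []       []         PN = subst P (sym (ℕₚ.*-identityʳ N)) PN
  multiply {P} step N (p ∷ ps) (q ∷ all) PN = subst P (ℕₚ.*-assoc N p (product ps)) (multiply {P} step (N ℕ.* p) ps all (step q PN))

  start : ∀ m → 1 ≤ m → Start m
  start m 1≤m = subst Start (trans (ℕₚ.*-identityˡ _) (sym (isFactorisation F))) (multiply {Start} {Prime} Start-* 1 (factors F) (factorsPrime F) Start-1)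
    where
    open PrimeFactorisation
    F = factorise m {{ℕ.>-nonZero 1≤m}}

  -- ε stays free because each new prime flips the exponents of A and B together;
  -- `Good⇒coefficients` reads off the two values in either order.
  record Good (z : ℤ) (k₁ k₂ N : ℕ) : Set where
    constructor good
    field
      {ε}   : Bool
      {A B} : Series
      {h}   : ℕ
      repA  : Rep N ε A h
      repB  : Rep N (not ε) B h
      A0    : A 0 ≡ + 1
      B0    : B 0 ≡ + 1
      Ak    : A k₁ ≡ z
      Bk    : B k₂ ≡ z

  Good-* : ∀ {z k₁ k₂ N p} → Prime p × k₁ ℕ.+ k₂ < p → Good z k₁ k₂ N → Good z k₁ k₂ (N ℕ.* p)
  Good-* {z} {k₁} {k₂} {N} {p} (pr , k<p) (good {ε} {A} {B} ra rb A0 B0 Ak Bk) with p ∣? N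
  ... | yes p∣N = good (Rep-old pr p∣N ra) (Rep-old pr p∣N rb) A0 B0 Ak Bk
  ... | no p∤N = good (Rep-new pr p∤N ra) (Rep-new pr p∤N rb) (quot-0 p A 2≤p A0) (quot-0 p B 2≤p B0)
        (trans (quot-< p A 2≤p A0 (ℕₚ.≤-<-trans (ℕₚ.m≤m+n k₁ k₂) k<p)) Ak)
        (trans (quot-< p B 2≤p B0 (ℕₚ.≤-<-trans (ℕₚ.m≤n+m k₂ k₁) k<p)) Bk)
    where 2≤p = prime>1 pr

  Good⇒coefficients : ∀ {z k₁ k₂ N} → Good z k₁ k₂ N → (∃[ k ] a N k ≡ z) × (∃[ k ] c N k ≡ z)
  Good⇒coefficients {z} {k₁} {k₂} {N} (good {ε} {A} {B} {h} ra rb _ _ Ak Bk) = go ε ra rb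
    where
    value : ∀ {ε A k} → Rep N ε A h → A k ≡ z → Φ^± ε N (k ℕ.* h) ≡ z
    value {ε} {A} {k} (rep _ 1≤h eq) Ak = trans (at eq (k ℕ.* h)) (trans (dil-* h A k 1≤h) Ak)
    toA : ∀ k → Ψ N k ≡ z → a N k ≡ z
    toA k e = trans (cong (λ f → f k) (sym (Ψ-Φ N))) e
    toC : ∀ k → inv (Ψ N) k ≡ z → c N k ≡ z
    toC k e = trans (cong (λ f → f k) (sym (trans (inv-invS (Ψ N)) (cong invS (Ψ-Φ N))))) e
    go : ∀ ε → Rep N ε A h → Rep N (not ε) B h → (∃[ k ] a N k ≡ z) × (∃[ k ] c N k ≡ z)
    go false ra rb = (k₁ ℕ.* h , toA _ (value {k = k₁} ra Ak)) , (k₂ ℕ.* h , toC _ (value {k = k₂} rb Bk))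
    go true  ra rb = (k₂ ℕ.* h , toA _ (value {k = k₂} rb Bk)) , (k₁ ℕ.* h , toC _ (value {k = k₁} ra Ak))

  coprime-* : ∀ {a b n} → Coprime a n → Coprime b n → Coprime (a ℕ.* b) n
  coprime-* {a} {b} {n} ca cb {i} (i∣ab , i∣n) = cb (coprime-divisor {i} {a} {b} (λ { (j∣i , j∣a) → ca (j∣a , ∣-trans j∣i i∣n) }) i∣ab , i∣n)

  prime>⇒∤ : ∀ {p n} → 1 ≤ n → n < p → p ∤ n
  prime>⇒∤ 1≤n n<p = >⇒∤ {{ℕ.>-nonZero 1≤n}} n<p

  coprime-product : ∀ {n} ps → 1 ≤ n → All (λ p → Prime p × n < p) ps → Coprime (product ps) n
  coprime-product []       1≤n []                (i∣1 , _) = ∣1⇒≡1 i∣1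
  coprime-product (p ∷ ps) 1≤n ((pr , n<p) ∷ all) =
    coprime-* (Cop.sym (prime-∤⇒coprime pr (prime>⇒∤ 1≤n n<p))) (coprime-product ps 1≤n all)

  -- The two passes

  module _ (m s : ℕ) (1≤m : 1 ≤ m) (1≤s : 1 ≤ s) where

    -- W is kept coprime to s so that W u ≡ t modulo s stays solvable. A prime above `limit` divides
    -- neither m W nor s, so it is new and preserves this.
    record State (ε : Bool) (A : Series) : Set where
      constructor state
      field
        {W h} : ℕ
        cop   : Coprime W s
        repW  : Rep (m ℕ.* W) ε A h
      limit : ℕ
      limit = m ℕ.* W ℕ.+ s

    open State using (limit)

    module _ {ε A} (S : State ε A) where
      open State S using (W; h; cop; repW)

      ∤-limit : ∀ {p} → limit S < p → p ∤ m ℕ.* W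
      ∤-limit lt = prime>⇒∤ (Rep.1≤N repW) (ℕₚ.≤-<-trans (ℕₚ.m≤m+n _ s) lt)

      State-flip : State (not ε) (inv A)
      State-flip = state cop (Rep-flip repW)

      State-chain : ∀ ps → PrimesAbove (limit S) ps → State (flips ps ε) (chain ps A)
      State-chain ps (uniq , all) = state {W = W ℕ.* product ps}
        (coprime-* cop (coprime-product ps 1≤s (All.map (λ { (pr , lt) → pr , ℕₚ.≤-<-trans (ℕₚ.m≤n+m s _) lt }) all)))
        (subst (λ n → Rep n (flips ps ε) (chain ps A) h) (ℕₚ.*-assoc m W (product ps))
          (Rep-chain ps uniq (All.map (λ { (pr , lt) → pr , ∤-limit lt }) all) repW))

    State-prime : ∀ {ε A p} (S : State ε A) → Prime p → limit S < p → State (not ε) (quot p A)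
    State-prime {p = p} S pr lt = State-chain S (p ∷ []) ([] ∷ [] , (pr , lt) ∷ [])

    State-Unit : ∀ {ε A} → State ε A → Unit A
    State-Unit (state _ r) = Rep-Unit r

    opaque
      -- One large prime turns the head into 1 and keeps the linear coefficient a sign. If that sign
      -- is -1, a second prime reverses it.
      opening : ∃[ H ] State false H × H 0 ≡ + 1 × H 1 ≡ + 1
      opening with start m 1≤m
      ... | h , H , R , H1 = fix (prime-above (limit S₀))
        where
        S₀ : State false H
        S₀ = state {W = 1} (λ { (i∣1 , _) → ∣1⇒≡1 i∣1 }) (subst (λ n → Rep n false H h) (sym (ℕₚ.*-identityʳ m)) R)
        fix : ∃[ p ] Prime p × limit S₀ < p → ∃[ H ] State false H × H 0 ≡ + 1 × H 1 ≡ + 1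
        fix (p , pr , lt) = go (subst Sign (sym (invQuot-1 pr uH)) (Sign-neg (Sign-* H1 (Unit⇒Sign uH))))
          where
          uH : Unit H
          uH = Rep-Unit R
          K : Series
          K = inv (quot p H)
          S₁ : State false K
          S₁ = State-flip (State-prime S₀ pr lt)
          K0 : K 0 ≡ + 1
          K0 = invQuot-0 pr uH
          go : Sign (K 1) → ∃[ H ] State false H × H 0 ≡ + 1 × H 1 ≡ + 1
          go (inj₁ K1) = K , S₁ , K0 , K1
          go (inj₂ K1) with prime-above (limit S₁)
          ... | q , prq , ltq = inv (quot q K) , State-flip (State-prime S₁ prq ltq) , invQuot-0 prq (State-Unit S₁)
              , trans (invQuot-1 prq (State-Unit S₁)) (cong₂ (λ u v → - (u * v)) K1 K0)

    opaque
      -- With p beyond the degree of the opening series H, the new series is 1/`quot p H`. Its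
      -- inverse `quot p H` has coefficient `H p` - `H 1` `H 0` = 0 - 1 at p; this is where `H 1` =
      -- +1 is used.
      first-base : ∃[ H ] ∃[ j ] State false H × H 0 ≡ + 1 × H 1 ≡ - (+ 1) × inv H j ≡ - (+ 1)
      first-base with opening
      ... | H , S , H0 , H1 with prime-above (proj₁ (Rep-ZeroFrom (State.repW S)) ℕ.+ limit S)
      ...   | p , pr , lt = inv (quot p H) , p , State-flip (State-prime S pr (ℕₚ.≤-<-trans (ℕₚ.m≤n+m (limit S) (proj₁ (Rep-ZeroFrom (State.repW S)))) lt))
            , invQuot-0 pr (State-Unit S) , trans (invQuot-1 pr (State-Unit S)) (cong₂ (λ u v → - (u * v)) H1 H0)
            , trans (at (inv-involutive (monic⇒Unit (quot p H) (quot-0 p H 2≤p H0))) p) (trans (quot-below p H 2≤p H0 (ℕₚ.m<m+n p (ℕₚ.<⇒≤ 2≤p)))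
                (cong₂ _+_ (proj₂ (Rep-ZeroFrom (State.repW S)) p (ℕₚ.<⇒≤ (ℕₚ.≤-<-trans (ℕₚ.m≤m+n (proj₁ (Rep-ZeroFrom (State.repW S))) (limit S)) lt)))
                  (cong₂ (λ u v → - u * v) H1 (trans (cong (shift p H) (sym (ℕₚ.+-identityʳ p))) (trans (shift-+ p H 0) H0)))))
        where
        2≤p : 2 ≤ p
        2≤p = prime>1 pr

    above⇒ : ∀ {L k ps} → k ≤ L → All (λ p → Prime p × L < p) ps → All (λ p → 2 ≤ p × k < p) ps
    above⇒ k≤L = All.map λ { (pr , lt) → prime>1 pr , ℕₚ.≤-<-trans k≤L lt }

    PrimesAbove-mono : ∀ {L L′ ps} → L ≤ L′ → PrimesAbove L′ ps → PrimesAbove L ps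
    PrimesAbove-mono le (u , all) = u , All.map (λ { (pr , lt) → pr , ℕₚ.≤-<-trans le lt }) all

    opaque
      realise-State : ∀ {H} (S : State false H) → H 0 ≡ + 1 → Sign (H 1) → ∀ j → inv H j ≡ - (+ 1) → ∀ z L →
        ∃[ ps ] ∃[ k ] PrimesAbove (L ℕ.+ limit S) ps × chain ps H k ≡ z
      realise-State S H0 H1 j neg z L = realise (Rep-Base (State.repW S) H0 H1 j neg) z (L ℕ.+ limit S)

    opaque
      -- Exponent -1 and `A 1` = -1 prepare the second pass: its base is `inv A`, which represents
      -- Φ, has linear coefficient 1, and has inverse A with the value -1 at position 1.
      first-value : ∀ z → ∃[ A ] ∃[ k ] State true A × A 0 ≡ + 1 × A 1 ≡ - (+ 1) × A k ≡ z
      first-value z with first-base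
      ... | H , j , S , H0 , H1 , neg with realise-State S H0 (inj₂ H1) j neg z 1
      ...   | ps , k , above , val = orient (flips ps false) (State-chain S ps (PrimesAbove-mono (ℕₚ.m≤n+m _ 1) above))
              (trans (chain-< ps H (above⇒ z≤n (proj₂ above)) H0) H0) (trans (chain-< ps H (above⇒ (ℕₚ.m≤m+n 1 _) (proj₂ above)) H0) H1) val
        where
        orient : ∀ ε {A} → State ε A → A 0 ≡ + 1 → A 1 ≡ - (+ 1) → A k ≡ z → ∃[ A ] ∃[ k ] State true A × A 0 ≡ + 1 × A 1 ≡ - (+ 1) × A k ≡ z
        orient true  {A} S A0 A1 Ak = A , k , S , A0 , A1 , Ak
        -- The number of adjoined primes decides the exponent; one more prime above k corrects it
        -- without touching the coefficients at 0, 1 and k.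
        orient false {A} S A0 A1 Ak with prime-above (k ℕ.+ limit S)
        ... | p , pr , lt = quot p A , k , State-prime S pr (ℕₚ.≤-<-trans (ℕₚ.m≤n+m _ k) lt) , quot-0 p A (prime>1 pr) A0
            , trans (quot-< p A (prime>1 pr) A0 (prime>1 pr)) A1 , trans (quot-< p A (prime>1 pr) A0 (ℕₚ.≤-<-trans (ℕₚ.m≤m+n k _) lt)) Ak

    -- The second pass must not spoil the first. Its primes exceed k, so `A k` survives, and they
    -- act on A and `inv A` alike, so the two results represent the same N with opposite exponents.
    extend : ∀ {z A k} ps k₂ (S : State true A) → PrimesAbove (k ℕ.+ limit S) ps → A 0 ≡ + 1 → A k ≡ z →
      chain ps (inv A) k₂ ≡ z → ∃[ W ] Coprime W s × 1 ≤ W × Good z k k₂ (m ℕ.* W)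
    extend {z} {A} {k} ps k₂ S above A0 Ak val = State.W S₁ , State.cop S₁ , W≥1 (State.W S₁) (Rep.1≤N (State.repW S₁))
      , good {ε = flips ps true} (State.repW S₁)
          (subst (λ ε → Rep (m ℕ.* State.W S₁) ε (chain ps (inv A)) (State.h S₁)) (flips-not ps true) (State.repW S₂))
          (trans (chain-< ps A (above⇒ z≤n (proj₂ above)) A0) A0) (trans (chain-< ps (inv A) (above⇒ z≤n (proj₂ above)) I0) I0)
          (trans (chain-< ps A (above⇒ (ℕₚ.m≤m+n k _) (proj₂ above)) A0) Ak) val
      where
      I0 : inv A 0 ≡ + 1
      I0 = trans (inv-zero A) A0
      above′ = PrimesAbove-mono (ℕₚ.m≤n+m (limit S) k) above
      S₁ = State-chain S ps above′
      S₂ = State-chain (State-flip S) ps above′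
      W≥1 : ∀ W → 1 ≤ m ℕ.* W → 1 ≤ W
      W≥1 zero    le = contradiction (subst (1 ≤_) (ℕₚ.*-zeroʳ m) le) λ ()
      W≥1 (suc W) _  = s≤s z≤n

    both-values : ∀ z → ∃[ k₁ ] ∃[ k₂ ] ∃[ W ] Coprime W s × 1 ≤ W × Good z k₁ k₂ (m ℕ.* W)
    both-values z = second (first-value z)
      where
      second : ∃[ A ] ∃[ k ] State true A × A 0 ≡ + 1 × A 1 ≡ - (+ 1) × A k ≡ z →
               ∃[ k₁ ] ∃[ k₂ ] ∃[ W ] Coprime W s × 1 ≤ W × Good z k₁ k₂ (m ℕ.* W)
      second (A , k , S , A0 , A1 , Ak) = conclude (realise-State S′ (trans (inv-zero A) A0)
          (inj₁ (trans (inv-one A A0) (cong -_ A1))) 1 (trans (at (inv-involutive (State-Unit S)) 1) A1) z k)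
        where
        S′ = State-flip S
        conclude : ∃[ ps ] ∃[ k₂ ] PrimesAbove (k ℕ.+ limit S′) ps × chain ps (inv A) k₂ ≡ z →
                   ∃[ k₁ ] ∃[ k₂ ] ∃[ W ] Coprime W s × 1 ≤ W × Good z k₁ k₂ (m ℕ.* W)
        conclude (ps , k₂ , above , val) = k , k₂ , extend ps k₂ S above A0 Ak val

  -- Multipliers with large prime factors in a residue class

  coprime-shift : ∀ {a S} → Coprime a S → Coprime (a ℕ.+ S) S
  coprime-shift {a} {S} c {i} (i∣ , i∣S) = c (∣m+n∣m⇒∣n (subst (i ∣_) (ℕₚ.+-comm a S) i∣) i∣S , i∣S)

  -- One prime q = K + 1 at a time. If q divides a + s x, then a + s x + s y is not divisible by q,
  -- since otherwise q would divide s y, which is coprime to a + s x. Afterwards q is absorbed into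
  -- the modulus.
  avoid-primes : ∀ K a s → Coprime a s →
    ∃[ x ] ∃[ y ] Coprime (a ℕ.+ s ℕ.* x) (s ℕ.* y) × (∀ p → Prime p → p ≤ K → p ∣ s ℕ.* y)
  avoid-primes zero a s c = 0 , 1 , subst₂ Coprime (sym (trans (cong (a ℕ.+_) (ℕₚ.*-zeroʳ s)) (ℕₚ.+-identityʳ a))) (sym (ℕₚ.*-identityʳ s)) c
    , λ p pr p≤0 → contradiction (ℕₚ.≤-trans (ℕₚ.<⇒≤ (prime>1 pr)) p≤0) λ ()
  avoid-primes (suc K) a s c with avoid-primes K a s c | prime? (suc K)
  ... | x , y , cop , div | no ¬pr = x , y , cop , λ p pr p≤ → div p pr (ℕₚ.≤-pred (ℕₚ.≤∧≢⇒< p≤ (λ { refl → ¬pr pr })))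
  ... | x , y , cop , div | yes pr with suc K ∣? (a ℕ.+ s ℕ.* x)
  ...   | no q∤ = x , y ℕ.* suc K
          , subst (Coprime _) (ℕₚ.*-assoc s y (suc K)) (Cop.sym (coprime-* (Cop.sym cop) (Cop.sym (prime-∤⇒coprime pr q∤))))
          , λ p prp p≤ → subst (p ∣_) (ℕₚ.*-assoc s y (suc K)) (case p prp (ℕₚ.m≤n⇒m<n∨m≡n p≤))
    where
    case : ∀ p → Prime p → p < suc K ⊎ p ≡ suc K → p ∣ s ℕ.* y ℕ.* suc K
    case p prp (inj₁ lt)   = ∣m⇒∣m*n (suc K) (div p prp (ℕₚ.≤-pred lt))
    case p prp (inj₂ refl) = n∣m*n (s ℕ.* y)
  ...   | yes q∣ = x ℕ.+ y , y ℕ.* suc K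
          , subst₂ Coprime (lem a s x y) (ℕₚ.*-assoc s y (suc K))
              (Cop.sym (coprime-* (Cop.sym (coprime-shift cop)) (Cop.sym (prime-∤⇒coprime pr q∤′))))
          , λ p prp p≤ → subst (p ∣_) (ℕₚ.*-assoc s y (suc K)) (case p prp (ℕₚ.m≤n⇒m<n∨m≡n p≤))
    where
    lem : ∀ a s x y → a ℕ.+ s ℕ.* x ℕ.+ s ℕ.* y ≡ a ℕ.+ s ℕ.* (x ℕ.+ y)
    lem = ℕSolver.solve-∀
    q∤′ : suc K ∤ a ℕ.+ s ℕ.* x ℕ.+ s ℕ.* y
    q∤′ q∣′ = prime∤1 pr (subst (suc K ∣_) (cop (q∣ , ∣m+n∣m⇒∣n q∣′ q∣)) ∣-refl)
    case : ∀ p → Prime p → p < suc K ⊎ p ≡ suc K → p ∣ s ℕ.* y ℕ.* suc K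
    case p prp (inj₁ lt)   = ∣m⇒∣m*n (suc K) (div p prp (ℕₚ.≤-pred lt))
    case p prp (inj₂ refl) = n∣m*n (s ℕ.* y)

  inverse-mod : ∀ W s → 1 ≤ W → Coprime W s → ∃[ a ] ∃[ b ] W ℕ.* a ≡ 1 ℕ.+ s ℕ.* b
  inverse-mod W s 1≤W c with coprime-Bézout c
  ... | Bézout.+- x y e = x , y , trans (ℕₚ.*-comm W x) (trans (sym e) (cong suc (ℕₚ.*-comm y s)))
  -- Here 1 + x W = y s, so x W ≡ -1 and its square is 1, which makes x (x W) the inverse. If x W =
  -- 0, then s = 1 and 1 serves.
  ... | Bézout.-+ x y e with x ℕ.* W in v
  ...   | zero = 1 , W ℕ.∸ 1 , trans (ℕₚ.*-identityʳ W) (trans (sym (ℕₚ.m+[n∸m]≡n 1≤W))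
            (cong suc (sym (trans (cong (ℕ._* (W ℕ.∸ 1)) (ℕₚ.m*n≡1⇒n≡1 y s (sym e))) (ℕₚ.*-identityˡ (W ℕ.∸ 1))))))
  ...   | suc v′ = x ℕ.* (x ℕ.* W) , v′ ℕ.* y , (begin
            W ℕ.* (x ℕ.* (x ℕ.* W))        ≡⟨ lem₁ W x ⟩
            (x ℕ.* W) ℕ.* (x ℕ.* W)        ≡⟨ cong₂ ℕ._*_ v v ⟩
            suc v′ ℕ.* suc v′              ≡⟨ lem₂ v′ ⟩
            1 ℕ.+ v′ ℕ.* suc (suc v′)      ≡⟨ cong (λ t → 1 ℕ.+ v′ ℕ.* t) e ⟩
            1 ℕ.+ v′ ℕ.* (y ℕ.* s)         ≡⟨ lem₃ v′ y s ⟩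
            1 ℕ.+ s ℕ.* (v′ ℕ.* y)         ∎)
    where
    open ≡-Reasoning
    lem₁ : ∀ W x → W ℕ.* (x ℕ.* (x ℕ.* W)) ≡ (x ℕ.* W) ℕ.* (x ℕ.* W)
    lem₁ = ℕSolver.solve-∀
    lem₂ : ∀ v → suc v ℕ.* suc v ≡ 1 ℕ.+ v ℕ.* suc (suc v)
    lem₂ = ℕSolver.solve-∀
    lem₃ : ∀ v y s → 1 ℕ.+ v ℕ.* (y ℕ.* s) ≡ 1 ℕ.+ s ℕ.* (v ℕ.* y)
    lem₃ = ℕSolver.solve-∀

  -- If a inverts W modulo s, then u has to lie in the class of a t, which is coprime to s, so
  -- `avoid-primes` finds a member without prime factors up to K. The extra summand s keeps u and n
  -- positive.
  rough-multiple : ∀ W s t K → 1 ≤ W → 1 ≤ s → Coprime W s → Coprime t s →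
    ∃[ n ] ∃[ u ] 1 ≤ n × 1 ≤ u × W ℕ.* u ≡ s ℕ.* n ℕ.+ t × (∀ p → Prime p → p ∣ u → K < p)
  rough-multiple W s t K 1≤W 1≤s cW ct with inverse-mod W s 1≤W cW
  ... | a , b , inverse with avoid-primes K (a ℕ.* t ℕ.+ s) s (coprime-shift (coprime-* ca ct))
    where
    ca : Coprime a s
    ca {i} (i∣a , i∣s) = ∣1⇒≡1 (∣m+n∣m⇒∣n (subst (i ∣_) (trans inverse (ℕₚ.+-comm 1 _)) (∣n⇒∣m*n W i∣a)) (∣m⇒∣m*n b i∣s))
  ...   | x , y , cop , div = b ℕ.* t ℕ.+ W ℕ.* suc x , u
        , ℕₚ.≤-trans (ℕₚ.*-mono-≤ 1≤W (s≤s (z≤n {x}))) (ℕₚ.m≤n+m _ (b ℕ.* t))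
        , ℕₚ.≤-trans 1≤s (ℕₚ.≤-trans (ℕₚ.m≤n+m s (a ℕ.* t)) (ℕₚ.m≤m+n _ (s ℕ.* x)))
        , trans (lem₁ W a t s x) (trans (cong (λ v → v ℕ.* t ℕ.+ W ℕ.* s ℕ.* suc x) inverse) (lem₂ W b t s x))
        , λ p pr p∣u → ℕₚ.≰⇒> λ p≤K → prime∤1 pr (subst (p ∣_) (cop (p∣u , div p pr p≤K)) ∣-refl)
    where
    u = a ℕ.* t ℕ.+ s ℕ.+ s ℕ.* x
    lem₁ : ∀ W a t s x → W ℕ.* (a ℕ.* t ℕ.+ s ℕ.+ s ℕ.* x) ≡ (W ℕ.* a) ℕ.* t ℕ.+ W ℕ.* s ℕ.* suc x
    lem₁ = ℕSolver.solve-∀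
    lem₂ : ∀ W b t s x → (1 ℕ.+ s ℕ.* b) ℕ.* t ℕ.+ W ℕ.* s ℕ.* suc x ≡ s ℕ.* (b ℕ.* t ℕ.+ W ℕ.* suc x) ℕ.+ t
    lem₂ = ℕSolver.solve-∀

  product-factors : ∀ u → 1 ≤ u → ∃[ ps ] u ≡ product ps × All (λ p → Prime p × p ∣ u) ps
  product-factors u 1≤u = factors F , isFactorisation F , subst (λ v → All (λ p → Prime p × p ∣ v) (factors F)) (sym (isFactorisation F)) (go (factors F) (factorsPrime F))
    where
    open PrimeFactorisation
    F = factorise u {{ℕ.>-nonZero 1≤u}}
    go : ∀ ps → All Prime ps → All (λ p → Prime p × p ∣ product ps) ps
    go []       []         = []
    go (p ∷ ps) (pr ∷ prs) = (pr , m∣m*n (product ps)) ∷ All.map (λ { (q , d) → q , ∣n⇒∣m*n p d }) (go ps prs)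

  all-values : ∀ m s t → 1 ≤ m → t < s → gcd s t ≡ 1 → ∀ z →
    ∃[ n ] 1 ≤ n × (∃[ k ] a (m ℕ.* (s ℕ.* n ℕ.+ t)) k ≡ z) × (∃[ k ] c (m ℕ.* (s ℕ.* n ℕ.+ t)) k ≡ z)
  all-values m s t 1≤m t<s g z = adjust (both-values m s 1≤m 1≤s z)
    where
    1≤s : 1 ≤ s
    1≤s = ℕₚ.≤-trans (s≤s z≤n) t<s
    Goal : Set
    Goal = ∃[ n ] 1 ≤ n × (∃[ k ] a (m ℕ.* (s ℕ.* n ℕ.+ t)) k ≡ z) × (∃[ k ] c (m ℕ.* (s ℕ.* n ℕ.+ t)) k ≡ z)
    adjust : ∃[ k₁ ] ∃[ k₂ ] ∃[ W ] Coprime W s × 1 ≤ W × Good z k₁ k₂ (m ℕ.* W) → Goal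
    -- The bound k₁ + k₂ is what `Good-*` demands of each prime factor of u, so that neither
    -- coefficient changes.
    adjust (k₁ , k₂ , W , cW , 1≤W , goodW) = conclude (rough-multiple W s t (k₁ ℕ.+ k₂) 1≤W 1≤s cW (Cop.sym (gcd≡1⇒coprime g)))
      where
      conclude : ∃[ n ] ∃[ u ] 1 ≤ n × 1 ≤ u × W ℕ.* u ≡ s ℕ.* n ℕ.+ t × (∀ p → Prime p → p ∣ u → k₁ ℕ.+ k₂ < p) → Goal
      conclude (n , u , 1≤n , 1≤u , Wu , rough) = n , 1≤n , Good⇒coefficients (subst (Good z k₁ k₂) N≡
          (multiply {Good z k₁ k₂} {λ p → Prime p × k₁ ℕ.+ k₂ < p} Good-* (m ℕ.* W) ps
            (All.map (λ { (pr , d) → pr , rough _ pr d }) (proj₂ (proj₂ (product-factors u 1≤u)))) goodW))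
        where
        ps = proj₁ (product-factors u 1≤u)
        N≡ : m ℕ.* W ℕ.* product ps ≡ m ℕ.* (s ℕ.* n ℕ.+ t)
        N≡ = trans (ℕₚ.*-assoc m W (product ps)) (cong (m ℕ.*_) (trans (cong (W ℕ.*_) (sym (proj₁ (proj₂ (product-factors u 1≤u))))) Wu))

open import Defs
open import Data.Nat using (ℕ; _≤_; _<_; _*_; _+_)
open import Data.Nat.GCD using (gcd)
open import Data.Integer using (ℤ)
open import Data.Product using (_×_; _,_; ∃-syntax)
open import Relation.Binary.PropositionalEquality using (_≡_)
open Values using (all-values)

theorem1p1 : (m s t : ℕ) → 1 ≤ m → t < s → gcd s t ≡ 1 →
    ((z : ℤ) → ∃[ n ] ∃[ k ] (1 ≤ n × a (m * (s * n + t)) k ≡ z))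
    × ((z : ℤ) → ∃[ n ] ∃[ k ] (1 ≤ n × c (m * (s * n + t)) k ≡ z))
theorem1p1 m s t 1≤m t<s coprime =
  (λ z → let n , 1≤n , (k , eq) , _ = all-values m s t 1≤m t<s coprime z in n , k , 1≤n , eq) ,
  (λ z → let n , 1≤n , _ , (k , eq) = all-values m s t 1≤m t<s coprime z in n , k , 1≤n , eq)
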